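{- Let $i\in[n]$, let $f,s_if,fs_i,s_ifs_i\in\mathbf{B}_{k,n}$ with $fs_i>f$, and let $P\in\mathcal{P}_{k,n}$ with $P_i=\mathrm U$ and $P_{i+1}=\mathrm R$ (so $s_iP\in\mathcal{P}_{k,n}$). Then for every $r$ there are bijections $$\mathcal{A}^r_{f,P}\cong\begin{cases}\mathcal{A}^r_{s_ifs_i,\,s_iP}, & s_if<f;\\ \mathcal{A}^{r-1}_{fs_i,\,s_iP}\sqcup\mathcal{A}^r_{s_ifs_i,\,s_iP}, & s_if>f.\end{cases}$$
   Context: Let $n\ge 2$, $0\le k\le n$, $[n]=\{1,\dots,n\}$. An $n$-periodic affine permutation is a bijection $f:\mathbb{Z}\to\mathbb{Z}$ with $f(i+n)=f(i)+n$ for all $i$. Products are read left to right: $(fg)(a)=g(f(a))$. $\mathbf{B}_{k,n}$ is the set of those with $\frac1n\sum_{i=1}^n(f(i)-i)=k$ and $i\le f(i)\le i+n$ for all $i$. Length: $\ell(f)=\#\{(a,b): a\in[n],\,b\in\mathbb{Z},\,a<b,\,f(a)>f(b)\}$. $s_i$ exchanges $i+mn$ and $i+1+mn$ for all $m$ and fixes all other integers. $fs_i>f$ means $\ell(fs_i)>\ell(f)$, and similarly for the other comparisons. Lattice paths: $\mathcal{P}_{k,n}$ is the set of lattice paths $P$ from $(0,0)$ to $(n-k,k)$ with unit steps $P_1,\dots,P_n\in\{\mathrm R,\mathrm U\}$; $s_iP$ is obtained by swapping $P_i$ and $P_{i+1}$, indices modulo $n$. Extend $P$ to a bi-infinite path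 with steps indexed by $\mathbb{Z}$ via $P_{i+n}=P_i$ (step $1$ starts at $(0,0)$), invariant under translation by $(n-k,k)$. The strip of $P$ is the region between the extended path $P$ (southern boundary) and $P+(0,k)$ (northern boundary). The southern edge labeled $i\in\mathbb{Z}$ is step $i$ of $P$, and the northern edge labeled $i$ is its translate by $(0,k)$. A periodic filling assigns to each unit box of the strip a crossing or an elbow, invariantly under translation by $(n-k,k)$. Strands enter at northern edges and travel right/down: in a crossing, left goes to right and top goes to bottom; in an elbow, a strand entering from the left exits at the bottom and one entering from the top exits right. The strand permutation sends $i$ to $j$ if the strand entering at northern edge $i$ exits at southern edge $j$. An $(f,P)$-affine Deogram is a periodic filling with strand permutation $f$ such that whenever two strands form an elbow, they have crossed each other an even number of times before it (counting from the northern boundary). $\mathcal{A}^r_{f,P}$ is the set of $(f,P)$-affine Deograms with exactly $r$ elbows modulo translation by $(n-k,k)$ (equivalently, distinguished $f$-subwords, with exactly $r$ unselected letters, of the reduced word obtained by reading the boxes of the strip from northwest to southeast); $\mathcal{A}^{r}_{f,P}=\varnothing$ for $r<0$. -}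

module Defs where

open import Data.Fin.Base using (Fin; fromℕ<; toℕ)
open import Data.Integer.Base using (ℤ; +_; -[1+_]; 0ℤ; 1ℤ; -_; _+_; _-_; _*_; _≤_; _<_; _%ℕ_)
open import Data.Integer.DivMod using (n%ℕd<d)
import Data.Integer.Divisibility.Signed as ℤ∣
import Data.Integer.Properties as ℤₚ
open import Data.Integer.Tactic.RingSolver using (solve-∀)
open import Data.List.Base using (List; []; _∷_; filter; foldr; length; map; upTo)
import Data.List.Membership.DecPropositional as DecMembership
open import Data.Nat.Base as ℕ using (ℕ; zero; suc; NonZero)
import Data.Nat.Divisibility as ℕ∣
open import Data.Product.Base using (Σ; ∃; ∃₂; _×_; _,_; proj₁; proj₂)
open import Data.Product.Properties using (≡-dec)
open import Data.Rational.Base using (_/_)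
open import Data.Vec.Base as Vec using (Vec; lookup; tabulate)
open import Function.Base using (_∘_)
open import Function.Bundles using (Bijection)
open import Function.Definitions using (Bijective)
open import Level using (0ℓ)
open import Relation.Binary.Bundles using (Setoid)
import Relation.Binary.Construct.On as On
open import Relation.Binary.Definitions using (DecidableEquality)
open import Relation.Binary.PropositionalEquality using (_≡_; refl; sym; trans; cong₂; setoid)
open import Relation.Nullary.Decidable using (yes; no)

HasCardinality : Setoid 0ℓ 0ℓ → ℕ → Set
HasCardinality S m = Bijection (setoid (Fin m)) S

record IsAffinePermutation (n : ℕ) (f : ℤ → ℤ) : Set where
  field
    bijective : Bijective _≡_ _≡_ f
    periodic  : ∀ i → f (i + + n) ≡ f i + + n

-- Products are read left to right.
infixl 7 _·_
_·_ : (ℤ → ℤ) → (ℤ → ℤ) → (ℤ → ℤ)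
f · g = g ∘ f

totalShift : ℕ → (ℤ → ℤ) → ℤ
totalShift n f = foldr _+_ 0ℤ (map (λ j → f (+ suc j) - + suc j) (upTo n))

record 𝐁 (n k : ℕ) .{{_ : NonZero n}} (f : ℤ → ℤ) : Set where
  field
    isAffinePermutation : IsAffinePermutation n f
    averageShift        : totalShift n f / n ≡ + k / 1
    lowerBound          : ∀ i → i ≤ f i
    upperBound          : ∀ i → f i ≤ i + + n

s : (n : ℕ) → ℤ → (ℤ → ℤ)
s n i a with + n ℤ∣.∣? (a - i) | + n ℤ∣.∣? (a - (i + 1ℤ))
... | yes _ | _     = a + 1ℤ
... | no  _ | yes _ = a - 1ℤ
... | no  _ | no  _ = a

IsInversion : ℕ → (ℤ → ℤ) → ℤ × ℤ → Set
IsInversion n f (a , b) = 1ℤ ≤ a × a ≤ + n × a < b × f b < f a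

Inversions : ℕ → (ℤ → ℤ) → Setoid 0ℓ 0ℓ
Inversions n f = On.setoid {B = Σ (ℤ × ℤ) (IsInversion n f)} (setoid (ℤ × ℤ)) proj₁

HasLength : ℕ → (ℤ → ℤ) → ℕ → Set
HasLength n f m = HasCardinality (Inversions n f) m

-- ℓ(f) < ℓ(g)
Shorter : ℕ → (ℤ → ℤ) → (ℤ → ℤ) → Set
Shorter n f g = ∃₂ λ p q → HasLength n f p × HasLength n g q × p ℕ.< q

data Step : Set where
  R U : Step

infix 4 _≟ˢ_
_≟ˢ_ : DecidableEquality Step
R ≟ˢ R = yes refl
R ≟ˢ U = no λ ()
U ≟ˢ R = no λ ()
U ≟ˢ U = yes refl

-- The word P₁ … Pₙ is a path from (0,0) to (n-k,k).
IsLatticePath : ∀ {n} → ℕ → Vec Step n → Set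
IsLatticePath k P = Vec.count (_≟ˢ U) P ≡ k

-- P_i for i ∈ ℤ, extended n-periodically; position 0 of the vector is P₁.
step : ∀ {n} .{{_ : NonZero n}} → Vec Step n → ℤ → Step
step {n} P i = lookup P (fromℕ< (n%ℕd<d (i - 1ℤ) n))

-- s_i P: the j-th step is P_{s_i(j)}, which swaps P_i and P_{i+1} modulo n.
swapSteps : ∀ {n} .{{_ : NonZero n}} → ℤ → Vec Step n → Vec Step n
swapSteps {n} i P = tabulate λ j → step P (s n i (+ suc (toℕ j)))

Point : Set
Point = ℤ × ℤ

infixl 6 _⊕_
_⊕_ : Point → Point → Point
(x , y) ⊕ (x′ , y′) = x + x′ , y + y′

infixl 7 _⊛_
_⊛_ : ℤ → Point → Point
m ⊛ (x , y) = m * x , m * y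

right₁ up₁ : Point
right₁ = 1ℤ , 0ℤ
up₁    = 0ℤ , 1ℤ

stepVector : Step → Point
stepVector R = right₁
stepVector U = up₁

-- Endpoint of step i of the extended path; step i runs from vertex (i-1) to
-- vertex i, and vertex 0 is the origin.
vertex : ∀ {n} .{{_ : NonZero n}} → Vec Step n → ℤ → Point
vertex P (+ zero)      = 0ℤ , 0ℤ
vertex P (+ suc m)     = vertex P (+ m) ⊕ stepVector (step P (+ suc m))
vertex P -[1+ zero ]   = vertex P (+ zero) ⊕ (- 1ℤ) ⊛ stepVector (step P 0ℤ)
vertex P -[1+ suc m ]  = vertex P -[1+ m ] ⊕ (- 1ℤ) ⊛ stepVector (step P -[1+ m ])

-- A unit edge is given by its direction (R horizontal, U vertical) and its
-- left, respectively lower, endpoint.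
Edge : Set
Edge = Step × Point

southEdge : ∀ {n} .{{_ : NonZero n}} → Vec Step n → ℤ → Edge
southEdge P i = step P i , vertex P (i - 1ℤ)

northEdge : ∀ {n} .{{_ : NonZero n}} → ℕ → Vec Step n → ℤ → Edge
northEdge k P i = step P i , vertex P (i - 1ℤ) ⊕ (0ℤ , + k)

-- A unit box is given by its lower left corner.
left right bottom top : Point → Edge
left   c = U , c
right  c = U , c ⊕ right₁
bottom c = R , c
top    c = R , c ⊕ up₁

-- The box lies between the horizontal edges of P and of P + (0,k) in its column.
InStrip : ∀ {n} .{{_ : NonZero n}} → ℕ → Vec Step n → Point → Set
InStrip k P (x , y) = ∃₂ λ i h → southEdge P i ≡ (R , (x , h)) × h ≤ y × y < h + + k

data Tile : Set where
  crossing elbow : Tile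

period : ℕ → ℕ → Point
period n k = + n - + k , + k

-- A filling is a function on all boxes of ℤ², but nothing below depends on its
-- values outside the strip, and 𝒜 identifies fillings that agree on the strip.
IsPeriodicFilling : ∀ {n} .{{_ : NonZero n}} → ℕ → Vec Step n → (Point → Tile) → Set
IsPeriodicFilling {n} k P D = ∀ c → InStrip k P c → D (c ⊕ period n k) ≡ D c

-- Strand k P D i e: the strand entering at northern edge i passes through e.
-- Elements are the initial segments of the strand, ending at e.
data Strand {n} .{{_ : NonZero n}} (k : ℕ) (P : Vec Step n) (D : Point → Tile) (i : ℤ) : Edge → Set where
  enter         : Strand k P D i (northEdge k P i)
  crossFromLeft : ∀ c → InStrip k P c → D c ≡ crossing → Strand k P D i (left c) → Strand k P D i (right c)
  crossFromTop  : ∀ c → InStrip k P c → D c ≡ crossing → Strand k P D i (top c)  → Strand k P D i (bottom c)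
  elbowFromLeft : ∀ c → InStrip k P c → D c ≡ elbow    → Strand k P D i (left c) → Strand k P D i (bottom c)
  elbowFromTop  : ∀ c → InStrip k P c → D c ≡ elbow    → Strand k P D i (top c)  → Strand k P D i (right c)

-- No box of the strip has a southern edge as its left or top side, so a strand
-- passing through a southern edge exits there.
HasStrandPermutation : ∀ {n} .{{_ : NonZero n}} → ℕ → Vec Step n → (Point → Tile) → (ℤ → ℤ) → Set
HasStrandPermutation k P D f = ∀ i → Strand k P D i (southEdge P (f i))

module _ {n : ℕ} .{{_ : NonZero n}} {k : ℕ} {P : Vec Step n} {D : Point → Tile} where

  crossingsOn : ∀ {i e} → Strand k P D i e → List Point
  crossingsOn enter                   = []
  crossingsOn (crossFromLeft c _ _ σ) = c ∷ crossingsOn σ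
  crossingsOn (crossFromTop  c _ _ σ) = c ∷ crossingsOn σ
  crossingsOn (elbowFromLeft _ _ _ σ) = crossingsOn σ
  crossingsOn (elbowFromTop  _ _ _ σ) = crossingsOn σ

  open DecMembership (≡-dec ℤₚ._≟_ ℤₚ._≟_) using (_∈?_)

  mutualCrossings : ∀ {i j e e′} → Strand k P D i e → Strand k P D j e′ → ℕ
  mutualCrossings σ τ = length (filter (_∈? crossingsOn τ) (crossingsOn σ))

IsDistinguished : ∀ {n} .{{_ : NonZero n}} → ℕ → Vec Step n → (Point → Tile) → Set
IsDistinguished k P D =
  ∀ c i j → InStrip k P c → D c ≡ elbow →
  (σ : Strand k P D i (left c)) (τ : Strand k P D j (top c)) →
  2 ℕ∣.∣ mutualCrossings σ τ

private
  ⊕-identity : ∀ p v → p ≡ p ⊕ 0ℤ ⊛ v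
  ⊕-identity (x , y) (u , w) = cong₂ _,_ (lem x u) (lem y w)
    where
    lem : ∀ a b → a ≡ a + 0ℤ * b
    lem = solve-∀

  ⊕-inverse : ∀ p m v → p ≡ (p ⊕ m ⊛ v) ⊕ (- m) ⊛ v
  ⊕-inverse (x , y) m (u , w) = cong₂ _,_ (lem x m u) (lem y m w)
    where
    lem : ∀ a m b → a ≡ (a + m * b) + (- m) * b
    lem = solve-∀

  ⊕-compose : ∀ p m m′ v → (p ⊕ m ⊛ v) ⊕ m′ ⊛ v ≡ p ⊕ (m + m′) ⊛ v
  ⊕-compose (x , y) m m′ (u , w) = cong₂ _,_ (lem x m m′ u) (lem y m m′ w)
    where
    lem : ∀ a m m′ b → (a + m * b) + m′ * b ≡ a + (m + m′) * b
    lem = solve-∀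

-- ℤ² modulo translation by the vector v
ModTranslation : Point → Setoid 0ℓ 0ℓ
ModTranslation v = record
  { Carrier       = Point
  ; _≈_           = λ p q → ∃ λ m → q ≡ p ⊕ m ⊛ v
  ; isEquivalence = record
    { refl  = λ {p} → 0ℤ , ⊕-identity p v
    ; sym   = λ { {p} (m , refl) → - m , ⊕-inverse p m v }
    ; trans = λ { {p} (m , refl) (m′ , refl) → m + m′ , ⊕-compose p m m′ v }
    }
  }

Elbows : ∀ {n} .{{_ : NonZero n}} → ℕ → Vec Step n → (Point → Tile) → Setoid 0ℓ 0ℓ
Elbows {n} k P D =
  On.setoid {B = Σ Point λ c → InStrip k P c × D c ≡ elbow} (ModTranslation (period n k)) proj₁

record AffineDeogram {n} .{{_ : NonZero n}} (k : ℕ) (r : ℤ) (f : ℤ → ℤ) (P : Vec Step n) : Set where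
  field
    tile              : Point → Tile
    periodic          : IsPeriodicFilling k P tile
    strandPermutation : HasStrandPermutation k P tile f
    distinguished     : IsDistinguished k P tile
    elbowCount        : ∃ λ m → r ≡ + m × HasCardinality (Elbows k P tile) m

open AffineDeogram public using (tile)

𝒜 : ∀ {n} .{{_ : NonZero n}} → ℕ → ℤ → (ℤ → ℤ) → Vec Step n → Setoid 0ℓ 0ℓ
𝒜 k r f P = record
  { Carrier       = AffineDeogram k r f P
  ; _≈_           = λ D E → ∀ c → InStrip k P c → tile D c ≡ tile E c
  ; isEquivalence = record
    { refl  = λ _ _ → refl
    ; sym   = λ D≈E c c∈ → sym (D≈E c c∈)
    ; trans = λ D≈E E≈F c c∈ → trans (D≈E c c∈) (E≈F c c∈)
    }
  }

{-# OPTIONS --safe #-}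
module Submission where

-- A path is recorded by the abscissa X(q) of its vertex number q = x + y, so that moving the
-- path across a box is the same as raising X by one at a single residue class mod n.  The boxes of
-- the strip can therefore be swept one class at a time, and a Deogram becomes a distinguished
-- subword: labels u of the strands along the moving path, composed with s_p at a crossing and
-- unchanged at an elbow, where u(p) < u(p+1) expresses that the two strands have crossed an even
-- number of times.  If w sweeps the boxes common to the strips of P and s_i P, then P is swept by
-- the letter i+k (position i+k is the northern edge i) followed by w, and s_i P by w followed by i.
--
-- Consider the boxes of w where the strands labelled i and i+1 (mod n) meet.  Changing tiles at
-- these boxes only exchanges the two labels afterwards, so the meeting boxes stay the same.  The bijection
-- moves every tile from one meeting box to the next one; the tile of the first letter goes to the first
-- meeting box, and the tile falling out at the end tells fs_i (elbow) from s_i f s_i (crossing).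
-- The last letter i is always crossed: an elbow there is excluded by f s_i > f and by the bounds
-- of s_i f.

open import Defs
open import Data.Empty using (⊥)
open import Data.Fin.Base as Fin using (Fin; fromℕ<; toℕ)
import Data.Fin.Properties as Finₚ
open import Data.Integer.Base using (ℤ; +_; -[1+_]; 0ℤ; 1ℤ; -1ℤ; -_; _+_; _-_; _*_; _≤_; _<_; +≤+; ∣_∣; _%ℕ_; _/ℕ_)
open import Data.Integer.DivMod using (a≡a%ℕn+[a/ℕn]*n; n%ℕd<d)
open import Data.Integer.Divisibility.Signed using (_∣_; divides; _∣?_; ∣⇒∣ᵤ; ∣m∣n⇒∣m+n; ∣m∣n⇒∣m-n)
import Data.Integer.Properties as ℤₚ
open import Data.Integer.Tactic.RingSolver using (solve-∀)
open import Data.List.Base using (List; []; _∷_; _++_; filter; length)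
import Data.List.Membership.DecPropositional as DecMembership
open import Data.List.Membership.Propositional using (_∈_; _∉_)
open import Data.List.Membership.Propositional.Properties using (∈-++⁻; ∈-++⁺ʳ)
open import Data.List.Relation.Unary.Any using (here; there)
open import Data.Nat.Base as ℕ using (ℕ; zero; suc; NonZero)
import Data.Nat.Divisibility as ℕ∣
open import Data.Nat.Induction using (<-wellFounded)
import Data.Nat.Properties as ℕₚ
open import Data.Product.Base using (Σ; ∃; ∃₂; _×_; _,_; proj₁; proj₂)
open import Data.Product.Properties using (≡-dec)
open import Data.Sum.Base using (_⊎_; inj₁; inj₂)
open import Data.Sum.Function.Setoid using (_⊎-inverse_)
open import Data.Sum.Relation.Binary.Pointwise using (_⊎ₛ_; inj₁; inj₂)
open import Data.Vec.Base as Vec using (Vec; []; _∷_; _∷ʳ_; lookup)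
import Data.Vec.Properties as Vecₚ
open import Function.Base using (_∘_)
open import Function.Bundles using (Bijection; Inverse)
import Function.Properties.Inverse as Inverseₚ
open import Induction.WellFounded using (Acc; acc)
open import Level using (0ℓ)
open import Relation.Binary.Bundles using (Setoid)
import Relation.Binary.Construct.On as On
open import Relation.Binary.Definitions using (Tri; tri<; tri≈; tri>)
open import Relation.Binary.PropositionalEquality
open import Relation.Nullary using (¬_; Dec; yes; no; contradiction)

-- Tiles may be moved because the elbow condition at a meeting box depends on one bit only: whether
-- label i stands before label i+1 on the moving path (`InOrder`). Letters between meetings leave
-- this bit alone, and so does an elbow at a meeting. Hence an elbow carried to the next meeting is
-- legal there exactly when it was legal where it came from; crossings carry no condition.
--
-- At the end of the sweep the labels invert `f`, so for an elbow that falls out the bit reads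
-- `f i < f (i + 1ℤ)`, which is s_i f > f. This is why fs_i occurs only in the second case, and the
-- loss of that elbow is the r - 1.
--
-- The first letter is a meeting as well: the positions i+k and i+k+1 of the northern boundary carry
-- the labels i and i+1.
--
-- At the last letter, an elbow needs increasing labels there, while f s_i > f puts the preimage of
-- i before that of i+1. For fs_i these contradict each other directly. For s_i f s_i the
-- conjugation can reverse the two preimages, but only if they are i+mn and i+1+mn for some m.

-- Integer inequalities, reduced to ring identities between differences

lin≤ : ∀ {a b c d} → a ≤ b → d - c ≡ b - a → c ≤ d
lin≤ {a} {b} a≤b eq = ℤₚ.0≤i-j⇒j≤i (subst (0ℤ ≤_) (sym eq) (ℤₚ.i≤j⇒0≤j-i a≤b))

<⇒+1≤ : ∀ {a b} → a < b → a + 1ℤ ≤ b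
<⇒+1≤ {a} {b} a<b = subst (_≤ b) (ℤₚ.+-comm 1ℤ a) (ℤₚ.i<j⇒suc[i]≤j a<b)

+1≤⇒< : ∀ {a b} → a + 1ℤ ≤ b → a < b
+1≤⇒< {a} {b} h = ℤₚ.suc[i]≤j⇒i<j (subst (_≤ b) (ℤₚ.+-comm a 1ℤ) h)

lin< : ∀ {a b c d} → a < b → d - c ≡ b - a → c < d
lin< {a} {b} {c} {d} a<b eq = +1≤⇒< (lin≤ (<⇒+1≤ a<b) (trans (lem d c) (trans (cong (_- 1ℤ) eq) (sym (lem b a)))))
  where
  lem : ∀ x y → x - (y + 1ℤ) ≡ x - y - 1ℤ
  lem = solve-∀

<+1⇒≤ : ∀ {a b} → a < b + 1ℤ → a ≤ b
<+1⇒≤ {a} {b} h = lin≤ (<⇒+1≤ h) (lem a b)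
  where
  lem : ∀ a b → b - a ≡ b + 1ℤ - (a + 1ℤ)
  lem = solve-∀

≤⇒<+1 : ∀ {a b} → a ≤ b → a < b + 1ℤ
≤⇒<+1 {a} {b} h = +1≤⇒< (ℤₚ.+-monoˡ-≤ 1ℤ h)

a<a+1 : ∀ a → a < a + 1ℤ
a<a+1 a = ≤⇒<+1 ℤₚ.≤-refl

a≤a+1 : ∀ a → a ≤ a + 1ℤ
a≤a+1 a = ℤₚ.<⇒≤ (a<a+1 a)

a-1<a : ∀ a → a - 1ℤ < a
a-1<a a = lin< (a<a+1 a) (lem a)
  where
  lem : ∀ a → a - (a - 1ℤ) ≡ a + 1ℤ - a
  lem = solve-∀

-1+1 : ∀ a → a - 1ℤ + 1ℤ ≡ a
-1+1 = solve-∀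

+1-1 : ∀ a → a + 1ℤ - 1ℤ ≡ a
+1-1 = solve-∀

+-swap-last : ∀ a b c → a + b + c ≡ a + c + b
+-swap-last = solve-∀

+-cancelʳ : ∀ c {a b} → a + c ≡ b + c → a ≡ b
+-cancelʳ c {a} {b} eq = trans (lem a c) (trans (cong (_- c) eq) (sym (lem b c)))
  where
  lem : ∀ a c → a ≡ a + c - c
  lem = solve-∀

ℤ-ind : {Q : ℤ → Set} → Q 0ℤ → (∀ m → Q m → Q (m + 1ℤ)) → (∀ m → Q (m + 1ℤ) → Q m) → ∀ m → Q m
ℤ-ind {Q} q₀ up down (+ zero)      = q₀
ℤ-ind {Q} q₀ up down (+ suc m)     = subst Q (cong +_ (ℕₚ.+-comm m 1)) (up (+ m) (ℤ-ind q₀ up down (+ m)))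
ℤ-ind {Q} q₀ up down -[1+ zero ]   = down -[1+ 0 ] q₀
ℤ-ind {Q} q₀ up down -[1+ suc m ]  = down -[1+ suc m ] (ℤ-ind q₀ up down -[1+ m ])

≤-ind : {Q : ℤ → Set} → (∀ m → Q m → Q (m + 1ℤ)) → ∀ {a b} → a ≤ b → Q a → Q b
≤-ind {Q} up {a} {b} a≤b qa = subst Q (lem a b) (go (b - a) (ℤₚ.i≤j⇒0≤j-i a≤b))
  where
  lem : ∀ a b → a + (b - a) ≡ b
  lem = solve-∀
  lem2 : ∀ a m → a + m + 1ℤ ≡ a + (1ℤ + m)
  lem2 = solve-∀
  go : ∀ d → 0ℤ ≤ d → Q (a + d)
  go (+ zero)  _ = subst Q (sym (ℤₚ.+-identityʳ a)) qa
  go (+ suc m) _ = subst Q (lem2 a (+ m)) (up _ (go (+ m) (+≤+ ℕ.z≤n)))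

-- Residues modulo n and the transpositions s_p

module Residues (n : ℕ) (2≤n : 2 ℕ.≤ n) where

  -- n ≥ 2 keeps the classes of p and p+1 apart; without this `s` would not be an involution.
  N∤1 : ¬ (+ n ∣ 1ℤ)
  N∤1 d with ℕ∣.∣1⇒≡1 (∣⇒∣ᵤ d)
  ... | refl = contradiction 2≤n λ { (ℕ.s≤s ()) }

  -- The first two cases present q in the explicit form p + mn or p+1 + mn, so that a match on
  -- `refl` replaces q by it.
  data Residue (p q : ℤ) : Set where
    at    : ∀ m → q ≡ p + m * + n → Residue p q
    after : ∀ m → q ≡ p + 1ℤ + m * + n → Residue p q
    away  : ¬ (+ n ∣ q - p) → ¬ (+ n ∣ q - (p + 1ℤ)) → Residue p q

  private
    back : ∀ p q → q ≡ p + (q - p)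
    back = solve-∀
    cancel : ∀ p m → p + m - p ≡ m
    cancel = solve-∀

  ∣⇒≡ : ∀ p q (d : + n ∣ q - p) → q ≡ p + _∣_.quotient d * + n
  ∣⇒≡ p q (divides m eq) = trans (back p q) (cong (λ z → p + z) eq)

  ≡⇒∣ : ∀ p {q} m → q ≡ p + m * + n → + n ∣ q - p
  ≡⇒∣ p m refl = divides m (cancel p (m * + n))

  residue : ∀ p q → Residue p q
  residue p q with + n ∣? (q - p) | + n ∣? (q - (p + 1ℤ))
  ... | yes d | _     = at (_∣_.quotient d) (∣⇒≡ p q d)
  ... | no _  | yes d = after (_∣_.quotient d) (∣⇒≡ (p + 1ℤ) q d)
  ... | no h  | no h′ = away h h′

  at≢after : ∀ p q → + n ∣ q - p → ¬ (+ n ∣ q - (p + 1ℤ))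
  at≢after p q d d′ = N∤1 (subst (+ n ∣_) (lem p q) (∣m∣n⇒∣m-n d d′))
    where
    lem : ∀ p q → q - p - (q - (p + 1ℤ)) ≡ 1ℤ
    lem = solve-∀

  s-at′ : ∀ p {a} → + n ∣ a - p → s n p a ≡ a + 1ℤ
  s-at′ p {a} d with + n ∣? (a - p) | + n ∣? (a - (p + 1ℤ))
  ... | yes _ | _ = refl
  ... | no h  | _ = contradiction d h

  s-after′ : ∀ p {a} → + n ∣ a - (p + 1ℤ) → s n p a ≡ a - 1ℤ
  s-after′ p {a} d with + n ∣? (a - p) | + n ∣? (a - (p + 1ℤ))
  ... | yes e | _     = contradiction d (at≢after p a e)
  ... | no _  | yes _ = refl
  ... | no _  | no h  = contradiction d h

  s-away : ∀ p {a} → ¬ (+ n ∣ a - p) → ¬ (+ n ∣ a - (p + 1ℤ)) → s n p a ≡ a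
  s-away p {a} h h′ with + n ∣? (a - p) | + n ∣? (a - (p + 1ℤ))
  ... | yes d | _     = contradiction d h
  ... | no _  | yes d = contradiction d h′
  ... | no _  | no _  = refl

  s-at : ∀ p m → s n p (p + m * + n) ≡ p + 1ℤ + m * + n
  s-at p m = trans (s-at′ p (≡⇒∣ p m refl)) (+-swap-last p _ _)

  s-after : ∀ p m → s n p (p + 1ℤ + m * + n) ≡ p + m * + n
  s-after p m = trans (s-after′ p (≡⇒∣ (p + 1ℤ) m refl)) (lem p (m * + n))
    where
    lem : ∀ p m → p + 1ℤ + m - 1ℤ ≡ p + m
    lem = solve-∀

  s-involutive : ∀ p a → s n p (s n p a) ≡ a
  s-involutive p a with residue p a
  ... | at m refl    = trans (cong (s n p) (s-at p m)) (s-after p m)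
  ... | after m refl = trans (cong (s n p) (s-after p m)) (s-at p m)
  ... | away h h′    = trans (cong (s n p) (s-away p h h′)) (s-away p h h′)

  s-injective : ∀ p {a b} → s n p a ≡ s n p b → a ≡ b
  s-injective p {a} {b} eq = trans (sym (s-involutive p a)) (trans (cong (s n p) eq) (s-involutive p b))

  s-bounds : ∀ p a → a - 1ℤ ≤ s n p a × s n p a ≤ a + 1ℤ
  s-bounds p a with + n ∣? (a - p) | + n ∣? (a - (p + 1ℤ))
  ... | yes _ | _     = ℤₚ.≤-trans (ℤₚ.<⇒≤ (a-1<a a)) (a≤a+1 a) , ℤₚ.≤-refl
  ... | no _  | yes _ = ℤₚ.≤-refl , ℤₚ.≤-trans (ℤₚ.<⇒≤ (a-1<a a)) (a≤a+1 a)
  ... | no _  | no _  = ℤₚ.<⇒≤ (a-1<a a) , a≤a+1 a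

  -- If s b < s a although a < b, the bounds give b ≤ s b + 1 ≤ s a ≤ a + 1 ≤ b. So the order is
  -- reversed only for a pair that `s` exchanges.
  s-mono-< : ∀ p {a b} → a < b → s n p a ≢ b → s n p a < s n p b
  s-mono-< p {a} {b} a<b sa≢b with ℤₚ.<-cmp (s n p a) (s n p b)
  ... | tri< lt _ _ = lt
  ... | tri≈ _ eq _ = contradiction (s-injective p eq) (ℤₚ.<⇒≢ a<b)
  ... | tri> _ _ gt = contradiction (ℤₚ.≤-antisym (ℤₚ.≤-trans (proj₂ (s-bounds p a)) (<⇒+1≤ a<b))
                                     (ℤₚ.≤-trans (lin≤ (proj₁ (s-bounds p b)) (lem b (s n p b))) (<⇒+1≤ gt))) sa≢b
    where
    lem : ∀ b c → c + 1ℤ - b ≡ c - (b - 1ℤ)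
    lem = solve-∀

  private
    cancelm : ∀ q p m → q + m - p - m ≡ q - p
    cancelm = solve-∀

  ∣-shift : ∀ q p m → + n ∣ q + m * + n - p → + n ∣ q - p
  ∣-shift q p m d = subst (+ n ∣_) (cancelm q p (m * + n)) (∣m∣n⇒∣m-n d (divides m refl))

  s-shift : ∀ p a m → s n p (a + m * + n) ≡ s n p a + m * + n
  s-shift p a m with residue p a
  ... | at m′ refl    = begin
    s n p (p + m′ * + n + m * + n)   ≡⟨ cong (s n p) (lem p m′ m (+ n)) ⟩
    s n p (p + (m′ + m) * + n)       ≡⟨ s-at p (m′ + m) ⟩
    p + 1ℤ + (m′ + m) * + n          ≡⟨ lem (p + 1ℤ) m′ m (+ n) ⟨
    p + 1ℤ + m′ * + n + m * + n      ≡⟨ cong (_+ m * + n) (s-at p m′) ⟨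
    s n p (p + m′ * + n) + m * + n   ∎
    where
    open ≡-Reasoning
    lem : ∀ p a b n → p + a * n + b * n ≡ p + (a + b) * n
    lem = solve-∀
  ... | after m′ refl = begin
    s n p (p + 1ℤ + m′ * + n + m * + n)   ≡⟨ cong (s n p) (lem (p + 1ℤ) m′ m (+ n)) ⟩
    s n p (p + 1ℤ + (m′ + m) * + n)       ≡⟨ s-after p (m′ + m) ⟩
    p + (m′ + m) * + n                    ≡⟨ lem p m′ m (+ n) ⟨
    p + m′ * + n + m * + n                ≡⟨ cong (_+ m * + n) (s-after p m′) ⟨
    s n p (p + 1ℤ + m′ * + n) + m * + n   ∎
    where
    open ≡-Reasoning
    lem : ∀ p a b n → p + a * n + b * n ≡ p + (a + b) * n
    lem = solve-∀
  ... | away h h′ = trans (s-away p (h ∘ ∣-shift a p m) (h′ ∘ ∣-shift a (p + 1ℤ) m)) (cong (_+ m * + n) (sym (s-away p h h′)))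

  s-translate : ∀ p t a → s n (p + t) (a + t) ≡ s n p a + t
  s-translate p t a with residue p a
  ... | at m refl    = trans (cong (s n (p + t)) (+-swap-last p (m * + n) t)) (trans (s-at (p + t) m) (trans (lem p t (m * + n)) (cong (_+ t) (sym (s-at p m)))))
    where
    lem : ∀ p t m → p + t + 1ℤ + m ≡ p + 1ℤ + m + t
    lem = solve-∀
  ... | after m refl = trans (cong (s n (p + t)) (lem p t (m * + n))) (trans (s-after (p + t) m) (trans (+-swap-last p t (m * + n)) (cong (_+ t) (sym (s-after p m)))))
    where
    lem : ∀ p t m → p + 1ℤ + m + t ≡ p + t + 1ℤ + m
    lem = solve-∀
  ... | away h h′ = trans (s-away (p + t) (h ∘ subst (+ n ∣_) (lem a t p)) (h′ ∘ subst (+ n ∣_) (lem′ a t p))) (cong (_+ t) (sym (s-away p h h′)))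
    where
    lem : ∀ a t p → a + t - (p + t) ≡ a - p
    lem = solve-∀
    lem′ : ∀ a t p → a + t - (p + t + 1ℤ) ≡ a - (p + 1ℤ)
    lem′ = solve-∀

-- Labels along the moving path and distinguished subwords

module Words (n : ℕ) (2≤n : 2 ℕ.≤ n) where
  open Residues n 2≤n public

  record Labelling (u : ℤ → ℤ) : Set where
    field
      periodic  : ∀ q m → u (q + m * + n) ≡ u q + m * + n
      injective : ∀ {q q′} → u q ≡ u q′ → q ≡ q′

  act : Tile → ℤ → (ℤ → ℤ) → (ℤ → ℤ)
  act crossing p u = u ∘ s n p
  act elbow    p u = u

  act-labelling : ∀ t p {u} → Labelling u → Labelling (act t p u)
  act-labelling elbow    p lab = lab
  act-labelling crossing p {u} lab = record
    { periodic  = λ q m → trans (cong u (s-shift p q m)) (periodic _ m)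
    ; injective = s-injective p ∘ injective
    }
    where open Labelling lab

  final : ∀ {N} → (ℤ → ℤ) → Vec ℤ N → Vec Tile N → (ℤ → ℤ)
  final u []      []      = u
  final u (p ∷ w) (t ∷ τ) = final (act t p u) w τ

  final-labelling : ∀ {N} (w : Vec ℤ N) τ {u} → Labelling u → Labelling (final u w τ)
  final-labelling []      []      lab = lab
  final-labelling (p ∷ w) (t ∷ τ) lab = final-labelling w τ (act-labelling t p lab)

  data Distinguished : ∀ {N} → (ℤ → ℤ) → Vec ℤ N → Vec Tile N → Set where
    []  : ∀ {u} → Distinguished u [] []
    _∷_ : ∀ {N u p t} {w : Vec ℤ N} {τ} → (t ≡ elbow → u p < u (p + 1ℤ)) →
          Distinguished (act t p u) w τ → Distinguished u (p ∷ w) (t ∷ τ)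

  weight : Tile → ℕ
  weight crossing = 0
  weight elbow    = 1

  elbows : ∀ {N} → Vec Tile N → ℕ
  elbows []      = 0
  elbows (t ∷ τ) = weight t ℕ.+ elbows τ

  final-∷ʳ : ∀ {N} (w : Vec ℤ N) τ p t {u} → final u (w ∷ʳ p) (τ ∷ʳ t) ≡ act t p (final u w τ)
  final-∷ʳ []      []      p t = refl
  final-∷ʳ (_ ∷ w) (_ ∷ τ) p t = final-∷ʳ w τ p t

  distinguished-∷ʳ⁺ : ∀ {N} {w : Vec ℤ N} {τ p t u} → Distinguished u w τ →
    (t ≡ elbow → final u w τ p < final u w τ (p + 1ℤ)) → Distinguished u (w ∷ʳ p) (τ ∷ʳ t)
  distinguished-∷ʳ⁺ []       last = last ∷ []
  distinguished-∷ʳ⁺ (x ∷ ds) last = x ∷ distinguished-∷ʳ⁺ ds last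

  distinguished-∷ʳ⁻ : ∀ {N} (w : Vec ℤ N) τ {p t u} → Distinguished u (w ∷ʳ p) (τ ∷ʳ t) →
    Distinguished u w τ × (t ≡ elbow → final u w τ p < final u w τ (p + 1ℤ))
  distinguished-∷ʳ⁻ []      []      (last ∷ []) = [] , last
  distinguished-∷ʳ⁻ (_ ∷ w) (_ ∷ τ) (x ∷ ds)    =
    let ds′ , last = distinguished-∷ʳ⁻ w τ ds in x ∷ ds′ , last

  elbows-∷ʳ : ∀ {N} (τ : Vec Tile N) t → elbows (τ ∷ʳ t) ≡ elbows τ ℕ.+ weight t
  elbows-∷ʳ []      t = ℕₚ.+-identityʳ (weight t)
  elbows-∷ʳ (a ∷ τ) t = trans (cong (weight a ℕ.+_) (elbows-∷ʳ τ t)) (sym (ℕₚ.+-assoc (weight a) _ _))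

  -- Passing tiles along the meetings of the strands i and i+1

  module Shifting (i : ℤ) where

    S : ℤ → ℤ
    S = s n i

    swap : Tile → ℤ → ℤ
    swap crossing = S
    swap elbow    = λ a → a

    -- For an injective u the label u p must be moved by `S`, so the two neighbouring labels are
    -- i+mn and i+1+mn with a common m, in either order.
    Meets : (ℤ → ℤ) → ℤ → Set
    Meets u p = S (u p) ≡ u (p + 1ℤ)

    -- Only the labels i and i+1 themselves are mentioned; periodicity carries the order to their
    -- common translates.
    InOrder : (ℤ → ℤ) → Set
    InOrder u = ∀ q q′ → u q ≡ i → u q′ ≡ i + 1ℤ → q < q′

    -- The invariant between the two runs of the word: their labels differ by `S` exactly while the
    -- pending tile is a crossing.
    Swapped : Tile → (ℤ → ℤ) → (ℤ → ℤ) → Set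
    Swapped b u u′ = ∀ q → u′ q ≡ swap b (u q)

    meets-sym : ∀ {u p} → Meets u p → S (u (p + 1ℤ)) ≡ u p
    meets-sym {u} {p} h = trans (cong S (sym h)) (s-involutive i (u p))

    meets-sym′ : ∀ {u p} → S (u (p + 1ℤ)) ≡ u p → Meets u p
    meets-sym′ {u} {p} h = trans (cong S (sym h)) (s-involutive i _)

    meets-swapped : ∀ b {u u′ p} → Swapped b u u′ → Meets u p → Meets u′ p
    meets-swapped elbow    {p = p} sw h = trans (cong S (sw p)) (trans h (sym (sw _)))
    meets-swapped crossing {u} {p = p} sw h = trans (cong S (trans (sw p) h)) (sym (sw _))

    meets-unswapped : ∀ b {u u′ p} → Swapped b u u′ → Meets u′ p → Meets u p
    meets-unswapped elbow    {p = p} sw h = trans (cong S (sym (sw p))) (trans h (sw _))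
    meets-unswapped crossing {p = p} sw h = s-injective i (trans (cong S (sym (sw p))) (trans h (sw _)))

    private
      p≢p+1 : ∀ {p} → p ≢ p + 1ℤ
      p≢p+1 {p} eq = ℤₚ.<⇒≢ (a<a+1 p) eq

    module _ {u : ℤ → ℤ} (lab : Labelling u) where
      open Labelling lab

      unperiodic : ∀ p q m → u p ≡ u q + m * + n → p ≡ q + m * + n
      unperiodic p q m eq = injective (trans eq (sym (periodic q m)))

      meeting : ∀ {p} → Meets u p →
        (∃ λ m → u p ≡ i + m * + n × u (p + 1ℤ) ≡ i + 1ℤ + m * + n) ⊎
        (∃ λ m → u p ≡ i + 1ℤ + m * + n × u (p + 1ℤ) ≡ i + m * + n)
      meeting {p} h with residue i (u p)
      ... | at m eq    = inj₁ (m , eq , trans (sym h) (trans (cong S eq) (s-at i m)))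
      ... | after m eq = inj₂ (m , eq , trans (sym h) (trans (cong S eq) (s-after i m)))
      ... | away x y   = contradiction (injective (trans (sym (s-away i x y)) h)) p≢p+1

      private
        solve-for : ∀ c m m′ N → c + m * N ≡ c + m′ * N + (m - m′) * N
        solve-for = solve-∀

        same : ∀ c m m′ {a b} → a ≡ c + m * + n → b ≡ c + m′ * + n → a ≡ b + (m - m′) * + n
        same c m m′ ea eb = trans ea (trans (solve-for c m m′ (+ n)) (cong (_+ (m - m′) * + n) (sym eb)))

      -- The positions exchanged by s_p carry exactly the labels exchanged by `S`, so the exchange
      -- may be made on either side of u.
      meets-act : ∀ {p} → Meets u p → ∀ q → u (s n p q) ≡ S (u q)
      meets-act {p} h q with residue p q
      ... | at m refl = begin
        u (s n p (p + m * + n))     ≡⟨ cong u (s-at p m) ⟩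
        u (p + 1ℤ + m * + n)        ≡⟨ periodic _ m ⟩
        u (p + 1ℤ) + m * + n        ≡⟨ cong (_+ m * + n) h ⟨
        S (u p) + m * + n           ≡⟨ s-shift i _ m ⟨
        S (u p + m * + n)           ≡⟨ cong S (periodic p m) ⟨
        S (u (p + m * + n))         ∎
        where open ≡-Reasoning
      ... | after m refl = begin
        u (s n p (p + 1ℤ + m * + n))  ≡⟨ cong u (s-after p m) ⟩
        u (p + m * + n)               ≡⟨ periodic _ m ⟩
        u p + m * + n                 ≡⟨ cong (_+ m * + n) (meets-sym {u} {p} h) ⟨
        S (u (p + 1ℤ)) + m * + n      ≡⟨ s-shift i _ m ⟨
        S (u (p + 1ℤ) + m * + n)      ≡⟨ cong S (periodic _ m) ⟨
        S (u (p + 1ℤ + m * + n))      ∎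
        where open ≡-Reasoning
      -- A label moved by `S` is a translate of the label at p or at p+1; injectivity would then put
      -- q into one of these two classes.
      ... | away x y = trans (cong u (s-away p x y)) (sym (s-away i not-at not-after))
        where
        no-p : ∀ c m m′ → u q ≡ c + m * + n → u p ≢ c + m′ * + n
        no-p c m m′ eq eq′ = x (≡⇒∣ p (m - m′) (unperiodic q p (m - m′) (same c m m′ eq eq′)))
        no-p+1 : ∀ c m m′ → u q ≡ c + m * + n → u (p + 1ℤ) ≢ c + m′ * + n
        no-p+1 c m m′ eq eq′ = y (≡⇒∣ (p + 1ℤ) (m - m′) (unperiodic q (p + 1ℤ) (m - m′) (same c m m′ eq eq′)))
        not-at : ¬ (+ n ∣ u q - i)
        not-at d with meeting h
        ... | inj₁ (m , e , _) = no-p i (_∣_.quotient d) m (∣⇒≡ i (u q) d) e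
        ... | inj₂ (m , _ , e) = no-p+1 i (_∣_.quotient d) m (∣⇒≡ i (u q) d) e
        not-after : ¬ (+ n ∣ u q - (i + 1ℤ))
        not-after d with meeting h
        ... | inj₁ (m , _ , e) = no-p+1 (i + 1ℤ) (_∣_.quotient d) m (∣⇒≡ (i + 1ℤ) (u q) d) e
        ... | inj₂ (m , e , _) = no-p (i + 1ℤ) (_∣_.quotient d) m (∣⇒≡ (i + 1ℤ) (u q) d) e

      private
        locate : ∀ c p {q} m → u p ≡ c + m * + n → u q ≡ c → q ≡ p + (- m) * + n
        locate c p {q} m ep eq = unperiodic q p (- m) (trans eq (trans (lem c m (+ n)) (cong (_+ (- m) * + n) (sym ep))))
          where
          lem : ∀ c m N → c ≡ c + m * N + (- m) * N
          lem = solve-∀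

        back : ∀ c p m → u p ≡ c + m * + n → u (p + (- m) * + n) ≡ c
        back c p m ep = trans (periodic p (- m)) (trans (cong (_+ (- m) * + n) ep) (lem c m (+ n)))
          where
          lem : ∀ c m N → c + m * N + (- m) * N ≡ c
          lem = solve-∀

      -- The meeting labels are translates of i and i+1 by the same number of periods, and
      -- translating back compares the positions of i and i+1.
      meets-inOrder : ∀ {p} → Meets u p → u p < u (p + 1ℤ) → InOrder u
      meets-inOrder {p} h lt q q′ eq eq′ with meeting h
      ... | inj₁ (m , e , e′) = subst₂ _<_ (sym (locate i p m e eq)) (sym (locate (i + 1ℤ) (p + 1ℤ) m e′ eq′)) (ℤₚ.+-monoˡ-< ((- m) * + n) (a<a+1 p))
      ... | inj₂ (m , e , e′) = contradiction lt (ℤₚ.<-asym (subst₂ _<_ (sym e′) (sym e) (ℤₚ.+-monoˡ-< _ (a<a+1 i))))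

      inOrder-meets : ∀ {p} → Meets u p → InOrder u → u p < u (p + 1ℤ)
      inOrder-meets {p} h ord with meeting h
      ... | inj₁ (m , e , e′) = subst₂ _<_ (sym e) (sym e′) (ℤₚ.+-monoˡ-< _ (a<a+1 i))
      ... | inj₂ (m , e , e′) = contradiction (ord _ _ (back i (p + 1ℤ) m e′) (back (i + 1ℤ) p m e)) (ℤₚ.<-asym (ℤₚ.+-monoˡ-< ((- m) * + n) (a<a+1 p)))

      meets-from : ∀ p a → S (u a) ≡ u (s n p a) → u a ≢ u (s n p a) → Meets u p
      meets-from p a eq neq with residue p a
      ... | at m refl = +-cancelʳ (m * + n) (begin
        S (u p) + m * + n           ≡⟨ s-shift i _ m ⟨
        S (u p + m * + n)           ≡⟨ cong S (periodic p m) ⟨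
        S (u (p + m * + n))         ≡⟨ eq ⟩
        u (s n p (p + m * + n))     ≡⟨ cong u (s-at p m) ⟩
        u (p + 1ℤ + m * + n)        ≡⟨ periodic _ m ⟩
        u (p + 1ℤ) + m * + n        ∎)
        where open ≡-Reasoning
      ... | after m refl = meets-sym′ {u} (+-cancelʳ (m * + n) (begin
        S (u (p + 1ℤ)) + m * + n       ≡⟨ s-shift i _ m ⟨
        S (u (p + 1ℤ) + m * + n)       ≡⟨ cong S (periodic _ m) ⟨
        S (u (p + 1ℤ + m * + n))       ≡⟨ eq ⟩
        u (s n p (p + 1ℤ + m * + n))   ≡⟨ cong u (s-after p m) ⟩
        u (p + m * + n)                ≡⟨ periodic _ m ⟩
        u p + m * + n                  ∎))
        where open ≡-Reasoning
      ... | away x y = contradiction (cong u (sym (s-away p x y))) neq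

      -- `s` reverses the order of two positions only if it exchanges them, and exchanging the
      -- positions of i and i+1 would make p a meeting.
      inOrder-act : ∀ {p} → ¬ Meets u p → InOrder u → InOrder (u ∘ s n p)
      inOrder-act {p} ¬h ord q q′ eq eq′ =
        subst₂ _<_ (s-involutive p q) (s-involutive p q′) (s-mono-< p (ord _ _ eq eq′) apart)
        where
        S[i+1] : S (i + 1ℤ) ≡ i
        S[i+1] = trans (cong S (lem i (+ n))) (trans (s-after i 0ℤ) (lem′ i (+ n)))
          where
          lem : ∀ i N → i + 1ℤ ≡ i + 1ℤ + 0ℤ * N
          lem = solve-∀
          lem′ : ∀ i N → i + 0ℤ * N ≡ i
          lem′ = solve-∀
        apart : s n p (s n p q) ≢ s n p q′
        apart e = ¬h (meets-from p q (trans (cong S uq) (trans S[i+1] (sym eq))) λ eq″ → p≢p+1 (trans (sym (trans eq″ eq)) uq))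
          where
          uq : u q ≡ i + 1ℤ
          uq = trans (cong u (trans (sym (s-involutive p q)) e)) eq′

    inOrder-unact : ∀ {u p} → Labelling u → ¬ Meets u p → InOrder (u ∘ s n p) → InOrder u
    inOrder-unact {u} {p} lab ¬h ord q q′ eq eq′ =
      inOrder-act (act-labelling crossing p lab) ¬h′ ord q q′ (trans (cong u (s-involutive p q)) eq) (trans (cong u (s-involutive p q′)) eq′)
      where
      ¬h′ : ¬ Meets (u ∘ s n p) p
      ¬h′ h = ¬h (meets-sym′ {u} (subst₂ (λ a b → S (u a) ≡ u b) (s-p p) (s-p+1 p) h))
        where
        s-p : ∀ p → s n p p ≡ p + 1ℤ
        s-p p = s-at′ p (≡⇒∣ p 0ℤ (sym (ℤₚ.+-identityʳ p)))
        s-p+1 : ∀ p → s n p (p + 1ℤ) ≡ p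
        s-p+1 p = trans (cong (s n p) (sym (s-p p))) (s-involutive p p)

    act-inOrder : ∀ t {u p} → Labelling u → ¬ Meets u p → InOrder u → InOrder (act t p u)
    act-inOrder elbow    lab ¬h ord = ord
    act-inOrder crossing lab ¬h ord = inOrder-act lab ¬h ord

    unact-inOrder : ∀ t {u p} → Labelling u → ¬ Meets u p → InOrder (act t p u) → InOrder u
    unact-inOrder elbow    lab ¬h ord = ord
    unact-inOrder crossing lab ¬h ord = inOrder-unact lab ¬h ord

    -- At a meeting each run applies its tile as a relabelling. The tile b cancels the discrepancy b
    -- and returns the second run to u; the tile a of the first run is then the new discrepancy.
    swapped-meet : ∀ a b {u u′ p} → Labelling u → Swapped b u u′ → Meets u p → Swapped a (act a p u) (act b p u′)
    swapped-meet a b {u} {u′} {p} lab sw h q = trans (undo b sw) (redo a)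
      where
      redo : ∀ a → u q ≡ swap a (act a p u q)
      redo elbow    = refl
      redo crossing = trans (sym (s-involutive i (u q))) (cong S (sym (meets-act lab h q)))
      undo : ∀ b → Swapped b u u′ → act b p u′ q ≡ u q
      undo elbow    sw = sw q
      undo crossing sw = trans (sw _) (trans (cong S (meets-act lab h q)) (s-involutive i (u q)))

    swapped-skip : ∀ a b {u u′ p} → Swapped b u u′ → Swapped b (act a p u) (act a p u′)
    swapped-skip elbow    b sw q = sw q
    swapped-skip crossing b sw q = sw _

    swapped-< : ∀ b {u u′ p} → Swapped b u u′ → ¬ Meets u p → u p < u (p + 1ℤ) → u′ p < u′ (p + 1ℤ)
    swapped-< elbow    sw ¬h lt = subst₂ _<_ (sym (sw _)) (sym (sw _)) lt
    swapped-< crossing sw ¬h lt = subst₂ _<_ (sym (sw _)) (sym (sw _)) (s-mono-< i lt ¬h)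

    swapped-sym : ∀ b {u u′} → Swapped b u u′ → Swapped b u′ u
    swapped-sym elbow    sw q = sym (sw q)
    swapped-sym crossing sw q = trans (sym (s-involutive i _)) (cong S (sym (sw q)))

    -- In Shift u b w τ τ′ b′, the tile b comes from the previous meeting and b′ is left over at the end.
    data Shift : ∀ {N} → (ℤ → ℤ) → Tile → Vec ℤ N → Vec Tile N → Vec Tile N → Tile → Set where
      done : ∀ {u b} → Shift u b [] [] [] b
      meet : ∀ {N u b b′ p a} {w : Vec ℤ N} {τ τ′} → Meets u p →
             Shift (act a p u) a w τ τ′ b′ → Shift u b (p ∷ w) (a ∷ τ) (b ∷ τ′) b′
      skip : ∀ {N u b b′ p a} {w : Vec ℤ N} {τ τ′} → ¬ Meets u p →
             Shift (act a p u) b w τ τ′ b′ → Shift u b (p ∷ w) (a ∷ τ) (a ∷ τ′) b′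

    shift : ∀ {N} u b (w : Vec ℤ N) τ → ∃₂ λ τ′ b′ → Shift u b w τ τ′ b′
    shift u b []      []      = [] , b , done
    shift u b (p ∷ w) (a ∷ τ) with S (u p) ℤₚ.≟ u (p + 1ℤ)
    ... | yes h = let τ′ , b′ , sh = shift (act a p u) a w τ in b ∷ τ′ , b′ , meet h sh
    ... | no ¬h = let τ′ , b′ , sh = shift (act a p u) b w τ in a ∷ τ′ , b′ , skip ¬h sh

    -- Meetings can be recognised in the second run alone, so u′ and the leftover tile determine b
    -- and τ. The labelling u is quantified afterwards because in the application it depends on b.
    unshift : ∀ {N} u′ (w : Vec ℤ N) τ′ b′ →
      ∃₂ λ b τ → ∀ {u} → Labelling u → Swapped b u u′ → Shift u b w τ τ′ b′
    unshift u′ []      []       b′ = b′ , [] , λ _ _ → done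
    unshift u′ (p ∷ w) (a ∷ τ′) b′ with S (u′ p) ℤₚ.≟ u′ (p + 1ℤ)
    ... | yes h = let b , τ , sh = unshift (act a p u′) w τ′ b′ in
      a , b ∷ τ , λ lab sw → let h′ = meets-unswapped a sw h in
        meet h′ (sh (act-labelling b p lab) (swapped-meet b a lab sw h′))
    ... | no ¬h = let b , τ , sh = unshift (act a p u′) w τ′ b′ in
      b , a ∷ τ , λ lab sw →
        skip (¬h ∘ meets-swapped b sw) (sh (act-labelling a p lab) (swapped-skip a b sw))

    shift-functional : ∀ {N u b} {w : Vec ℤ N} {τ τ₁ τ₂ b₁ b₂} →
      Shift u b w τ τ₁ b₁ → Shift u b w τ τ₂ b₂ → τ₁ ≡ τ₂ × b₁ ≡ b₂
    shift-functional done        done          = refl , refl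
    shift-functional (meet h x)  (meet _ y)    = let e , e′ = shift-functional x y in cong (_ ∷_) e , e′
    shift-functional (meet h x)  (skip ¬h y)   = contradiction h ¬h
    shift-functional (skip ¬h x) (meet h y)    = contradiction h ¬h
    shift-functional (skip ¬h x) (skip _ y)    = let e , e′ = shift-functional x y in cong (_ ∷_) e , e′

    -- Both first runs have the meetings of the common second run u′; the common leftover tile then
    -- determines the tiles one by one from the end.
    shift-injective : ∀ {N u₁ u₂ u′ b₁ b₂} {w : Vec ℤ N} {τ₁ τ₂ τ′ b′} → Labelling u₁ → Labelling u₂ →
      Swapped b₁ u₁ u′ → Swapped b₂ u₂ u′ →
      Shift u₁ b₁ w τ₁ τ′ b′ → Shift u₂ b₂ w τ₂ τ′ b′ → b₁ ≡ b₂ × τ₁ ≡ τ₂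
    shift-injective l₁ l₂ sw₁ sw₂ done done = refl , refl
    shift-injective l₁ l₂ sw₁ sw₂ (meet {b = b} {a = a₁} h₁ x) (meet {a = a₂} h₂ y)
      with shift-injective (act-labelling a₁ _ l₁) (act-labelling a₂ _ l₂)
             (swapped-meet a₁ b l₁ sw₁ h₁) (swapped-meet a₂ b l₂ sw₂ h₂) x y
    ... | refl , refl = refl , refl
    shift-injective {b₁ = b₁} {b₂} l₁ l₂ sw₁ sw₂ (meet h₁ x) (skip ¬h₂ y) =
      contradiction (meets-unswapped b₂ sw₂ (meets-swapped b₁ sw₁ h₁)) ¬h₂
    shift-injective {b₁ = b₁} {b₂} l₁ l₂ sw₁ sw₂ (skip ¬h₁ x) (meet h₂ y) =
      contradiction (meets-unswapped b₁ sw₁ (meets-swapped b₂ sw₂ h₂)) ¬h₁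
    shift-injective {b₁ = b₁} {b₂} l₁ l₂ sw₁ sw₂ (skip {a = a} ¬h₁ x) (skip ¬h₂ y)
      with shift-injective (act-labelling a _ l₁) (act-labelling a _ l₂)
             (swapped-skip a b₁ sw₁) (swapped-skip a b₂ sw₂) x y
    ... | refl , refl = refl , refl

    shift-final : ∀ {N u u′ b} {w : Vec ℤ N} {τ τ′ b′} → Labelling u → Swapped b u u′ →
      Shift u b w τ τ′ b′ → Swapped b′ (final u w τ) (final u′ w τ′)
    shift-final lab sw done = sw
    shift-final {b = b} lab sw (meet {a = a} h x) = shift-final (act-labelling a _ lab) (swapped-meet a b lab sw h) x
    shift-final {b = b} lab sw (skip {a = a} ¬h x) = shift-final (act-labelling a _ lab) (swapped-skip a b sw) x

    shift-elbows : ∀ {N u b} {w : Vec ℤ N} {τ τ′ b′} →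
      Shift u b w τ τ′ b′ → weight b ℕ.+ elbows τ ≡ elbows τ′ ℕ.+ weight b′
    shift-elbows {b = b} done = ℕₚ.+-identityʳ (weight b)
    shift-elbows {b = b} (meet h x) = trans (cong (weight b ℕ.+_) (shift-elbows x)) (sym (ℕₚ.+-assoc (weight b) _ _))
    shift-elbows {b = b} {b′ = b′} (skip {a = a} {τ = τ} {τ′} ¬h x) = begin
      weight b ℕ.+ (weight a ℕ.+ elbows τ)     ≡⟨ ℕₚ.+-assoc (weight b) _ _ ⟨
      weight b ℕ.+ weight a ℕ.+ elbows τ       ≡⟨ cong (ℕ._+ elbows τ) (ℕₚ.+-comm (weight b) _) ⟩
      weight a ℕ.+ weight b ℕ.+ elbows τ       ≡⟨ ℕₚ.+-assoc (weight a) _ _ ⟩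
      weight a ℕ.+ (weight b ℕ.+ elbows τ)     ≡⟨ cong (weight a ℕ.+_) (shift-elbows x) ⟩
      weight a ℕ.+ (elbows τ′ ℕ.+ weight b′)   ≡⟨ ℕₚ.+-assoc (weight a) _ _ ⟨
      weight a ℕ.+ elbows τ′ ℕ.+ weight b′     ∎
      where open ≡-Reasoning

    -- A pending elbow comes with `InOrder u`, established where the elbow was picked up and kept by
    -- the letters in between. At the meeting where the elbow is dropped, this is the required
    -- inequality.
    shift-distinguished : ∀ {N u u′ b} {w : Vec ℤ N} {τ τ′ b′} → Labelling u → Swapped b u u′ →
      Shift u b w τ τ′ b′ → (b ≡ elbow → InOrder u) → Distinguished u w τ →
      Distinguished u′ w τ′ × (b′ ≡ elbow → InOrder (final u w τ))
    shift-distinguished lab sw done ord [] = [] , ord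
    shift-distinguished {u′ = u′} {b} lab sw (meet {a = a} {w = w} {τ′ = τ′} h x) ord (d ∷ ds) =
      let ds′ , ord′ = shift-distinguished (act-labelling a _ lab) (swapped-meet a b lab sw h) x (ord″ a d) ds
      in first b sw ord ∷ ds′ , ord′
      where
      ord″ : ∀ a → (a ≡ elbow → _) → a ≡ elbow → InOrder (act a _ _)
      ord″ elbow d refl = meets-inOrder lab h (d refl)
      first : ∀ b → Swapped b _ u′ → (b ≡ elbow → InOrder _) → b ≡ elbow → _
      first elbow sw ord refl = subst₂ _<_ (sym (sw _)) (sym (sw _)) (inOrder-meets lab h (ord refl))
    shift-distinguished {b = b} lab sw (skip {a = a} ¬h x) ord (d ∷ ds) =
      let ds′ , ord′ = shift-distinguished (act-labelling a _ lab) (swapped-skip a b sw) x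
                         (act-inOrder a lab ¬h ∘ ord) ds
      in swapped-< b sw ¬h ∘ d ∷ ds′ , ord′

    -- The same transfer in reverse: the order known for the leftover elbow is carried back from the
    -- end of the word to the meeting that elbow came from.
    unshift-distinguished : ∀ {N u u′ b} {w : Vec ℤ N} {τ τ′ b′} → Labelling u → Swapped b u u′ →
      Shift u b w τ τ′ b′ → (b′ ≡ elbow → InOrder (final u w τ)) → Distinguished u′ w τ′ →
      Distinguished u w τ × (b ≡ elbow → InOrder u)
    unshift-distinguished lab sw done ord [] = [] , ord
    unshift-distinguished {u′ = u′} {b} lab sw (meet {a = a} h x) ord (d ∷ ds) =
      let ds′ , ord′ = unshift-distinguished (act-labelling a _ lab) (swapped-meet a b lab sw h) x ord ds
      in first a ord′ ∷ ds′ , ord″ b sw d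
      where
      first : ∀ a → (a ≡ elbow → InOrder (act a _ _)) → a ≡ elbow → _
      first elbow ord′ refl = inOrder-meets lab h (ord′ refl)
      ord″ : ∀ b → Swapped b _ u′ → (b ≡ elbow → _) → b ≡ elbow → InOrder _
      ord″ elbow sw d refl = meets-inOrder lab h (subst₂ _<_ (sw _) (sw _) (d refl))
    unshift-distinguished {b = b} lab sw (skip {a = a} ¬h x) ord (d ∷ ds) =
      let ds′ , ord′ = unshift-distinguished (act-labelling a _ lab) (swapped-skip a b sw) x ord ds
      in swapped-< b (swapped-sym b sw) (¬h ∘ meets-unswapped b sw) ∘ d ∷ ds′ , unact-inOrder a lab ¬h ∘ ord′

-- Finite sums, as a measure for the termination of sweeps

sumBelow : ℕ → (ℕ → ℕ) → ℕ
sumBelow zero    g = 0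
sumBelow (suc m) g = g m ℕ.+ sumBelow m g

sumBelow-mono-≤ : ∀ m {g h} → (∀ j → g j ℕ.≤ h j) → sumBelow m g ℕ.≤ sumBelow m h
sumBelow-mono-≤ zero    le = ℕ.z≤n
sumBelow-mono-≤ (suc m) le = ℕₚ.+-mono-≤ (le m) (sumBelow-mono-≤ m le)

sumBelow-mono-< : ∀ m {g h} j → j ℕ.< m → (∀ j → g j ℕ.≤ h j) → g j ℕ.< h j → sumBelow m g ℕ.< sumBelow m h
sumBelow-mono-< (suc m) j j<1+m le lt with ℕₚ.m<1+n⇒m<n∨m≡n j<1+m
... | inj₁ j<m  = ℕₚ.+-mono-≤-< (le m) (sumBelow-mono-< m j j<m le lt)
... | inj₂ refl = ℕₚ.+-mono-<-≤ lt (sumBelow-mono-≤ m le)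

-- Periodic paths as abscissa functions, their corners and sweeps

module Cuts (n : ℕ) .{{_ : NonZero n}} (2≤n : 2 ℕ.≤ n) (d : ℤ) where
  open Residues n 2≤n

  -- The parameter d is the horizontal part of the period, later n - k. In `steps` an unchanged
  -- abscissa is an up step, an increased one a right step.
  record Cut (X : ℤ → ℤ) : Set where
    field
      steps    : ∀ q → X q ≡ X (q - 1ℤ) ⊎ X q ≡ X (q - 1ℤ) + 1ℤ
      periodic : ∀ q m → X (q + m * + n) ≡ X q + m * d

    mono⁺ : ∀ q → X q ≤ X (q + 1ℤ)
    mono⁺ q with steps (q + 1ℤ)
    ... | inj₁ eq = ℤₚ.≤-reflexive (sym (trans eq (cong X (+1-1 q))))
    ... | inj₂ eq = ℤₚ.≤-trans (a≤a+1 (X q)) (ℤₚ.≤-reflexive (sym (trans eq (cong (λ z → X z + 1ℤ) (+1-1 q)))))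

    mono : ∀ {a b} → a ≤ b → X a ≤ X b
    mono {a} a≤b = ≤-ind {Q = λ q → X a ≤ X q} (λ m h → ℤₚ.≤-trans h (mono⁺ m)) a≤b ℤₚ.≤-refl

  -- An up step followed by a right step: vertex p is the top left corner of a box lying just
  -- southeast of the path.
  record Corner (X : ℤ → ℤ) (p : ℤ) : Set where
    constructor corner
    field
      before : X p ≡ X (p - 1ℤ)
      behind : X (p + 1ℤ) ≡ X p + 1ℤ

  corner-cong : ∀ {X Y p} t → (∀ q → Y q ≡ X q + t) → Corner X p → Corner Y p
  corner-cong {X} {Y} {p} t eq (corner e e′) = corner
    (trans (eq p) (trans (cong (_+ t) e) (sym (eq _))))
    (trans (eq _) (trans (cong (_+ t) e′) (trans (+-swap-last (X p) 1ℤ t) (cong (_+ 1ℤ) (sym (eq p))))))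

  corner-periodic : ∀ {X} → Cut X → ∀ {p} m → Corner X p → Corner X (p + m * + n)
  corner-periodic {X} cut {p} m (corner e e′) = corner
    (trans (periodic p m) (trans (cong (_+ m * d) e) (trans (sym (periodic _ m)) (cong X (+-swap-last p _ (m * + n))))))
    (trans (cong X (+-swap-last p _ _)) (trans (periodic _ m) (trans (cong (_+ m * d) e′) (trans (+-swap-last (X p) _ _) (cong (_+ 1ℤ) (sym (periodic p m)))))))
    where open Cut cut

  bump : ℤ → (ℤ → ℤ) → (ℤ → ℤ)
  bump p X q with + n ∣? (q - p)
  ... | yes _ = X q + 1ℤ
  ... | no  _ = X q

  bump-on : ∀ p X {q} → + n ∣ q - p → bump p X q ≡ X q + 1ℤ
  bump-on p X {q} h with + n ∣? (q - p)
  ... | yes _ = refl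
  ... | no ¬h = contradiction h ¬h

  bump-off : ∀ p X {q} → ¬ (+ n ∣ q - p) → bump p X q ≡ X q
  bump-off p X {q} ¬h with + n ∣? (q - p)
  ... | yes h = contradiction h ¬h
  ... | no _  = refl

  bump-at : ∀ p X m → bump p X (p + m * + n) ≡ X (p + m * + n) + 1ℤ
  bump-at p X m = bump-on p X (≡⇒∣ p m refl)

  bump-≥ : ∀ p X q → X q ≤ bump p X q
  bump-≥ p X q with + n ∣? (q - p)
  ... | yes _ = a≤a+1 (X q)
  ... | no _  = ℤₚ.≤-refl

  bump-cong : ∀ p {X Y} t → (∀ q → Y q ≡ X q + t) → ∀ q → bump p Y q ≡ bump p X q + t
  bump-cong p {X} t eq q with + n ∣? (q - p)
  ... | yes _ = trans (cong (_+ 1ℤ) (eq q)) (+-swap-last (X q) _ _)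
  ... | no _  = eq q

  private
    shift-before : ∀ p M → p + 1ℤ + M - 1ℤ ≡ p + M
    shift-before = solve-∀

  bump-at-1 : ∀ p X m → bump p X (p + m * + n - 1ℤ) ≡ X (p + m * + n - 1ℤ)
  bump-at-1 p X m = bump-off p X λ h → N∤1 (subst (+ n ∣_) (lem p (m * + n)) (∣m∣n⇒∣m-n (divides m refl) h))
    where
    lem : ∀ p M → M - (p + M - 1ℤ - p) ≡ 1ℤ
    lem = solve-∀

  bump-after : ∀ p X m → bump p X (p + 1ℤ + m * + n) ≡ X (p + 1ℤ + m * + n)
  bump-after p X m = bump-off p X λ h → N∤1 (subst (+ n ∣_) (lem p (m * + n)) (∣m∣n⇒∣m-n h (divides m refl)))
    where
    lem : ∀ p M → p + 1ℤ + M - p - M ≡ 1ℤ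
    lem = solve-∀

  bump-away : ∀ p X {q} → ¬ (+ n ∣ q - (p + 1ℤ)) → bump p X (q - 1ℤ) ≡ X (q - 1ℤ)
  bump-away p X {q} h = bump-off p X (h ∘ subst (+ n ∣_) (lem p q))
    where
    lem : ∀ p q → q - 1ℤ - p ≡ q - (p + 1ℤ)
    lem = solve-∀

  bump-cut : ∀ {X p} → Cut X → Corner X p → Cut (bump p X)
  bump-cut {X} {p} cut c = record { steps = steps′ ; periodic = periodic′ }
    where
    open Cut cut
    steps′ : ∀ q → bump p X q ≡ bump p X (q - 1ℤ) ⊎ bump p X q ≡ bump p X (q - 1ℤ) + 1ℤ
    steps′ q with residue p q
    ... | at m refl = inj₂ (trans (bump-at p X m) (cong (_+ 1ℤ) (trans before (sym (bump-at-1 p X m)))))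
      where open Corner (corner-periodic cut m c)
    ... | after m refl = inj₁ (trans (bump-after p X m) (trans (trans (cong X (+-swap-last p _ _)) behind) (trans (sym (bump-at p X m)) (cong (bump p X) (sym (shift-before p (m * + n)))))))
      where open Corner (corner-periodic cut m c)
    ... | away x y with steps q
    ...   | inj₁ e = inj₁ (trans (bump-off p X x) (trans e (sym (bump-away p X {q} y))))
    ...   | inj₂ e = inj₂ (trans (bump-off p X x) (trans e (cong (_+ 1ℤ) (sym (bump-away p X {q} y)))))
    periodic′ : ∀ q m → bump p X (q + m * + n) ≡ bump p X q + m * d
    periodic′ q m with + n ∣? (q - p)
    ... | yes h = trans (bump-on p X (subst (+ n ∣_) (lem q p (m * + n)) (∣m∣n⇒∣m+n h (divides m refl)))) (trans (cong (_+ 1ℤ) (periodic q m)) (+-swap-last (X q) _ _))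
      where
      lem : ∀ q p M → q - p + M ≡ q + M - p
      lem = solve-∀
    ... | no ¬h = trans (bump-off p X (¬h ∘ ∣-shift q p m)) (periodic q m)

  data Sweep : ∀ {N} → (ℤ → ℤ) → (ℤ → ℤ) → Vec ℤ N → Set where
    done : ∀ {X Y} → (∀ q → X q ≡ Y q) → Sweep X Y []
    flip : ∀ {N X Y p} {w : Vec ℤ N} → Corner X p → Sweep (bump p X) Y w → Sweep X Y (p ∷ w)

  sweep-≤ : ∀ {N X Y} {w : Vec ℤ N} → Sweep X Y w → ∀ q → X q ≤ Y q
  sweep-≤ (done eq)              q = ℤₚ.≤-reflexive (eq q)
  sweep-≤ {X = X} (flip {p = p} _ sw) q = ℤₚ.≤-trans (bump-≥ p X q) (sweep-≤ sw q)

  sweep-translate : ∀ {N X X′ Y Y′} {w : Vec ℤ N} t → (∀ q → X′ q ≡ X q + t) → (∀ q → Y′ q ≡ Y q + t) →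
    Sweep X Y w → Sweep X′ Y′ w
  sweep-translate t eX eY (done eq) = done λ q → trans (eX q) (trans (cong (_+ t) (eq q)) (sym (eY q)))
  sweep-translate t eX eY (flip {p = p} c sw) = flip (corner-cong t eX c) (sweep-translate t (bump-cong p t eX) eY sw)

  sweep-∷ʳ : ∀ {N X Y p} {w : Vec ℤ N} → Sweep X Y w → Corner Y p → Sweep X (bump p Y) (w ∷ʳ p)
  sweep-∷ʳ {X = X} {Y} {p} (done eq) c = flip (corner-cong 0ℤ eq₀ c) (done λ q → trans (bump-cong p 0ℤ eq₀ q) (ℤₚ.+-identityʳ _))
    where
    eq₀ : ∀ q → X q ≡ Y q + 0ℤ
    eq₀ q = trans (eq q) (sym (ℤₚ.+-identityʳ (Y q)))
  sweep-∷ʳ (flip c′ sw) c = flip c′ (sweep-∷ʳ sw c)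

  module _ (0<d : 0ℤ < d) (d<n : d < + n) {Y : ℤ → ℤ} (cutY : Cut Y) where

    private
      module Y = Cut cutY

    module _ {X : ℤ → ℤ} (cutX : Cut X) (X≤Y : ∀ q → X q ≤ Y q) where
      open Cut cutX

      private
        Y≤ : ∀ q → Y q ≤ Y (q - 1ℤ) + 1ℤ
        Y≤ q with Y.steps q
        ... | inj₁ e = ℤₚ.≤-trans (ℤₚ.≤-reflexive e) (a≤a+1 _)
        ... | inj₂ e = ℤₚ.≤-reflexive e

        leftwards : ∀ m q → X q < Y q → (∃ λ p → X p < Y p × X p ≡ X (p - 1ℤ)) ⊎ X (q - + m) ≡ X q - + m
        leftwards zero    q lt = inj₂ (trans (cong X (ℤₚ.+-identityʳ q)) (sym (ℤₚ.+-identityʳ (X q))))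
        leftwards (suc m) q lt with steps q
        ... | inj₁ e = inj₁ (q , lt , e)
        ... | inj₂ e with leftwards m (q - 1ℤ) (lin< (ℤₚ.<-≤-trans lt (Y≤ q)) (trans (lem (Y (q - 1ℤ)) (X (q - 1ℤ))) (cong (λ z → Y (q - 1ℤ) + 1ℤ - z) (sym e))))
          where
          lem : ∀ a b → a - b ≡ a + 1ℤ - (b + 1ℤ)
          lem = solve-∀
        ...   | inj₁ r  = inj₁ r
        ...   | inj₂ e′ = inj₂ (trans (cong X (lem q (+ m))) (trans e′ (trans (lem₂ (X (q - 1ℤ)) (+ m)) (cong (_- + suc m) (sym e)))))
          where
          lem : ∀ q m → q - (1ℤ + m) ≡ q - 1ℤ - m
          lem = solve-∀
          lem₂ : ∀ x m → x - m ≡ x + 1ℤ - (1ℤ + m)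
          lem₂ = solve-∀

        rightwards : ∀ m q → X q < Y q → X q ≡ X (q - 1ℤ) → (∃ λ p → X p < Y p × Corner X p) ⊎ X (q + + m) ≡ X q
        rightwards zero    q lt e = inj₂ (cong X (ℤₚ.+-identityʳ q))
        rightwards (suc m) q lt e with steps (q + 1ℤ)
        ... | inj₂ e′ = inj₁ (q , lt , corner e (trans e′ (cong (λ z → X z + 1ℤ) (+1-1 q))))
        ... | inj₁ e′ with rightwards m (q + 1ℤ) (subst (_< Y (q + 1ℤ)) (sym (trans e′ (cong X (+1-1 q)))) (ℤₚ.<-≤-trans lt (Y.mono⁺ q))) e′
        ...   | inj₁ r  = inj₁ r
        ...   | inj₂ e″ = inj₂ (trans (cong X (lem q (+ m))) (trans e″ (trans e′ (cong X (+1-1 q)))))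
          where
          lem : ∀ q m → q + (1ℤ + m) ≡ q + 1ℤ + m
          lem = solve-∀

      -- From q one walks left until an up step ends at the current vertex, then right until a right
      -- step follows. The gap to Y persists: going left along right steps X falls by one and Y by
      -- at most one, and going right along up steps X is constant while Y does not fall. Each walk
      -- ends within n steps, since 0 < d < n puts both kinds of step into every period.
      find-corner : ∀ q → X q < Y q → ∃ λ p → X p < Y p × Corner X p
      find-corner q lt with leftwards n q lt
      ... | inj₂ e = contradiction (lem₂ (X q) d (+ n) (trans (sym (periodic q -1ℤ)) (trans (cong X (lem q (+ n))) e))) (ℤₚ.<⇒≢ d<n)
        where
        lem : ∀ q N → q + -1ℤ * N ≡ q - N
        lem = solve-∀
        lem₁ : ∀ x d → d ≡ x - (x + -1ℤ * d)
        lem₁ = solve-∀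
        lem₃ : ∀ x d → x - (x - d) ≡ d
        lem₃ = solve-∀
        lem₂ : ∀ x d N → x + -1ℤ * d ≡ x - N → d ≡ N
        lem₂ x d N e = trans (lem₁ x d) (trans (cong (λ z → x - z) e) (lem₃ x N))
      ... | inj₁ (q′ , lt′ , e) with rightwards n q′ lt′ e
      ...   | inj₁ r  = r
      ...   | inj₂ e′ = contradiction (lem₂ (X q′) d (trans (sym (periodic q′ 1ℤ)) (trans (cong X (cong (λ z → q′ + z) (ℤₚ.*-identityˡ (+ n)))) e′))) (ℤₚ.<⇒≢ 0<d)
        where
        lem₁ : ∀ x d → 0ℤ ≡ x - x
        lem₁ = solve-∀
        lem₃ : ∀ x d → x + 1ℤ * d - x ≡ d
        lem₃ = solve-∀
        lem₂ : ∀ x d → x + 1ℤ * d ≡ x → 0ℤ ≡ d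
        lem₂ x d e = trans (lem₁ x d) (trans (cong (_- x) (sym e)) (lem₃ x d))

    private
      gap : (ℤ → ℤ) → ℕ → ℕ
      gap X j = ∣ Y (+ j) - X (+ j) ∣

      any-gap : ∀ m (g : ℕ → ℕ) → (∀ j → j ℕ.< m → g j ≡ 0) ⊎ ∃ λ j → g j ≢ 0
      any-gap zero    g = inj₁ λ _ ()
      any-gap (suc m) g with g m ℕₚ.≟ 0 | any-gap m g
      ... | no ne | _       = inj₂ (m , ne)
      ... | yes _ | inj₂ r  = inj₂ r
      ... | yes e | inj₁ h  = inj₁ λ j j<1+m → aux j (ℕₚ.m<1+n⇒m<n∨m≡n j<1+m)
        where
        aux : ∀ j → j ℕ.< m ⊎ j ≡ m → g j ≡ 0
        aux j (inj₁ lt)   = h j lt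
        aux j (inj₂ refl) = e

      gap-mono : ∀ {x x′ y} → x ≤ x′ → x′ ≤ y → ∣ y - x′ ∣ ℕ.≤ ∣ y - x ∣
      gap-mono {x} {x′} {y} le le′ = ℤₚ.drop‿+≤+ (subst₂ _≤_ (sym (ℤₚ.0≤i⇒+∣i∣≡i (ℤₚ.i≤j⇒0≤j-i le′))) (sym (ℤₚ.0≤i⇒+∣i∣≡i (ℤₚ.i≤j⇒0≤j-i (ℤₚ.≤-trans le le′)))) (ℤₚ.+-monoʳ-≤ y (ℤₚ.neg-mono-≤ le)))

      gap-mono-< : ∀ {x x′ y} → x < x′ → x′ ≤ y → ∣ y - x′ ∣ ℕ.< ∣ y - x ∣
      gap-mono-< {x} {x′} {y} lt le′ = ℤₚ.drop‿+<+ (subst₂ _<_ (sym (ℤₚ.0≤i⇒+∣i∣≡i (ℤₚ.i≤j⇒0≤j-i le′))) (sym (ℤₚ.0≤i⇒+∣i∣≡i (ℤₚ.i≤j⇒0≤j-i (ℤₚ.≤-trans (ℤₚ.<⇒≤ lt) le′)))) (ℤₚ.+-monoʳ-< y (ℤₚ.neg-mono-< lt)))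

      bump-≤ : ∀ {X p} → Cut X → (∀ q → X q ≤ Y q) → X p < Y p → ∀ q → bump p X q ≤ Y q
      bump-≤ {X} {p} cut le lt q with + n ∣? (q - p)
      ... | no _  = le q
      ... | yes (divides m e) = subst (λ z → X z + 1ℤ ≤ Y z) (sym (∣⇒≡ p q (divides m e)))
        (<⇒+1≤ (subst₂ _<_ (sym (Cut.periodic cut p m)) (sym (Y.periodic p m)) (ℤₚ.+-monoˡ-< (m * d) lt)))

      -- Induction on the total gap between X and Y over one period. A corner with X p < Y p can be
      -- flipped, with all its translates, without passing Y.
      sweep-acc : ∀ {X} → Cut X → (∀ q → X q ≤ Y q) → Acc ℕ._<_ (sumBelow n (gap X)) → ∃ λ N → Σ (Vec ℤ N) (Sweep X Y)
      sweep-acc {X} cut le (acc rs) with any-gap n (gap X)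
      ... | inj₁ none = 0 , [] , done everywhere
        where
        everywhere : ∀ q → X q ≡ Y q
        everywhere q = begin
          X q                                  ≡⟨ cong X (a≡a%ℕn+[a/ℕn]*n q n) ⟩
          X (+ (q %ℕ n) + q /ℕ n * + n)        ≡⟨ Cut.periodic cut _ (q /ℕ n) ⟩
          X (+ (q %ℕ n)) + q /ℕ n * d          ≡⟨ cong (_+ q /ℕ n * d) (ℤₚ.i-j≡0⇒i≡j (Y (+ (q %ℕ n))) (X (+ (q %ℕ n))) (ℤₚ.∣i∣≡0⇒i≡0 (none _ (n%ℕd<d q n)))) ⟨
          Y (+ (q %ℕ n)) + q /ℕ n * d          ≡⟨ Y.periodic _ (q /ℕ n) ⟨
          Y (+ (q %ℕ n) + q /ℕ n * + n)        ≡⟨ cong Y (a≡a%ℕn+[a/ℕn]*n q n) ⟨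
          Y q                                  ∎
          where open ≡-Reasoning
      ... | inj₂ (j , ne) with find-corner cut le (+ j) (ℤₚ.≤∧≢⇒< (le (+ j)) λ e → ne (cong ∣_∣ (ℤₚ.i≡j⇒i-j≡0 {Y (+ j)} {X (+ j)} (sym e))))
      ...   | p , lt , c =
        let le′ = bump-≤ cut le lt
            -- The representative of the class of p in the window 0, ..., n-1, where the gap drops
            -- strictly.
            j₀  = p %ℕ n
            on  = subst (λ z → + n ∣ + j₀ - z) (sym (a≡a%ℕn+[a/ℕn]*n p n)) (divides (- (p /ℕ n)) (lem (+ j₀) (p /ℕ n) (+ n)))
            less = sumBelow-mono-< n {gap (bump p X)} {gap X} j₀ (n%ℕd<d p n) (λ j → gap-mono (bump-≥ p X (+ j)) (le′ (+ j)))
                    (gap-mono-< (subst (X (+ j₀) <_) (sym (bump-on p X on)) (a<a+1 _)) (le′ (+ j₀)))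
            N , w , sw = sweep-acc (bump-cut cut c) le′ (rs less)
        in suc N , p ∷ w , flip c sw
        where
        lem : ∀ a m N → a - (a + m * N) ≡ (- m) * N
        lem = solve-∀

    sweep-exists : ∀ {X} → Cut X → (∀ q → X q ≤ Y q) → ∃ λ N → Σ (Vec ℤ N) (Sweep X Y)
    sweep-exists {X} cut le = sweep-acc cut le (<-wellFounded _)

  stepBetween : ℤ → ℤ → Step
  stepBetween a b with b ℤₚ.≟ a
  ... | yes _ = U
  ... | no _  = R

  stepBetween-U : ∀ {a b} → b ≡ a → stepBetween a b ≡ U
  stepBetween-U {a} {b} e with b ℤₚ.≟ a
  ... | yes _ = refl
  ... | no ne = contradiction e ne

  stepBetween-R : ∀ {a b} → b ≡ a + 1ℤ → stepBetween a b ≡ R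
  stepBetween-R {a} {b} e with b ℤₚ.≟ a
  ... | yes e′ = contradiction (trans (sym e′) e) (ℤₚ.<⇒≢ (a<a+1 a))
  ... | no _   = refl

  edge : (ℤ → ℤ) → ℤ → Edge
  edge X q = stepBetween (X (q - 1ℤ)) (X q) , (X (q - 1ℤ) , q - 1ℤ - X (q - 1ℤ))

  -- The box whose top left corner is vertex q of the cut; at a corner q it is the box swept by the
  -- flip.
  box : (ℤ → ℤ) → ℤ → Point
  box X q = X q , q - 1ℤ - X q

  module _ {X : ℤ → ℤ} {q : ℤ} (c : Corner X q) where
    open Corner c

    edge-left : edge X q ≡ left (box X q)
    edge-left = cong₂ _,_ (stepBetween-U before) (cong (λ x → x , q - 1ℤ - x) (sym before))

    edge-top : edge X (q + 1ℤ) ≡ top (box X q)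
    edge-top = cong₂ _,_ (stepBetween-R (trans behind (cong (λ z → X z + 1ℤ) (sym (+1-1 q)))))
      (cong₂ _,_ (trans (cong X (+1-1 q)) (sym (ℤₚ.+-identityʳ (X q))))
                 (trans (cong (λ z → z - X z) (+1-1 q)) (lem q (X q))))
      where
      lem : ∀ q x → q - x ≡ q - 1ℤ - x + 1ℤ
      lem = solve-∀

    module _ {X′ : ℤ → ℤ} (X′q : X′ q ≡ X q + 1ℤ) where

      edge-bottom : X′ (q - 1ℤ) ≡ X (q - 1ℤ) → edge X′ q ≡ bottom (box X q)
      edge-bottom e = cong₂ _,_ (stepBetween-R (trans X′q (cong (_+ 1ℤ) eq))) (cong (λ x → x , q - 1ℤ - x) (trans e (sym before)))
        where
        eq : X q ≡ X′ (q - 1ℤ)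
        eq = trans before (sym e)

      edge-right : X′ (q + 1ℤ) ≡ X (q + 1ℤ) → edge X′ (q + 1ℤ) ≡ right (box X q)
      edge-right e = cong₂ _,_ (stepBetween-U (trans e (trans behind (trans (sym X′q) (cong X′ (sym (+1-1 q)))))))
        (cong₂ _,_ (trans (cong X′ (+1-1 q)) X′q)
                   (trans (cong (λ z → z - X′ z) (+1-1 q)) (trans (cong (λ x → q - x) X′q) (lem q (X q)))))
        where
        lem : ∀ q x → q - (x + 1ℤ) ≡ q - 1ℤ - x + 0ℤ
        lem = solve-∀

-- Remainders, and the extended lattice path as a cut

%ℕ-unique : ∀ n .{{_ : NonZero n}} {a r} m → r ℕ.< n → a ≡ + r + m * + n → a %ℕ n ≡ r
%ℕ-unique n {a} {r} m r<n eq = go (a %ℕ n) r (m - a /ℕ n) (n%ℕd<d a n) r<n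
    (trans (lem₁ (+ (a %ℕ n)) (a /ℕ n * + n)) (trans (cong (_- a /ℕ n * + n) (trans (sym (a≡a%ℕn+[a/ℕn]*n a n)) eq)) (lem₂ (+ r) m (a /ℕ n) (+ n))))
  where
  lem₁ : ∀ a b → a ≡ a + b - b
  lem₁ = solve-∀
  lem₂ : ∀ r m m′ N → r + m * N - m′ * N ≡ r + (m - m′) * N
  lem₂ = solve-∀
  lem₃ : ∀ r m N → r + (- m) * N + m * N ≡ r
  lem₃ = solve-∀
  too-big : ∀ x y m → x ℕ.< n → + x ≢ + y + + suc m * + n
  too-big x y m x<n e = ℕₚ.<⇒≱ x<n (ℕₚ.≤-trans (ℕₚ.m≤m+n n (m ℕ.* n)) (ℕₚ.≤-trans (ℕₚ.m≤n+m _ y)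
    (ℕₚ.≤-reflexive (sym (ℤₚ.+-injective (trans e (cong (λ z → + y + z) (sym (ℤₚ.pos-* (suc m) n)))))))))
  go : ∀ x y m → x ℕ.< n → y ℕ.< n → + x ≡ + y + m * + n → x ≡ y
  go x y (+ zero)  _   _   e = ℤₚ.+-injective (trans e (ℤₚ.+-identityʳ (+ y)))
  go x y (+ suc m) x<n _   e = contradiction e (too-big x y m x<n)
  go x y -[1+ m ]  _   y<n e = contradiction (trans (sym (lem₃ (+ y) (+ suc m) (+ n))) (cong (_+ + suc m * + n) (sym e))) (too-big y x m y<n)

module Paths (n : ℕ) .{{_ : NonZero n}} (k : ℕ) (2≤n : 2 ℕ.≤ n) where
  open Residues n 2≤n
  open Cuts n 2≤n (+ n - + k)

  module _ (P : Vec Step n) where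

    private
      index : ℤ → Fin n
      index j = fromℕ< (n%ℕd<d (j - 1ℤ) n)

    step-periodic : ∀ j m → step P (j + m * + n) ≡ step P j
    step-periodic j m = cong (lookup P) (Finₚ.fromℕ<-cong _ _ eq _ _)
      where
      lem : ∀ j r m M N → j - 1ℤ ≡ r + M * N → j + m * N - 1ℤ ≡ r + (M + m) * N
      lem j r m M N e = trans (+-swap-last j _ _) (trans (cong (_+ m * N) e) (lem′ r m M N))
        where
        lem′ : ∀ r m M N → r + M * N + m * N ≡ r + (M + m) * N
        lem′ = solve-∀
      eq : (j + m * + n - 1ℤ) %ℕ n ≡ (j - 1ℤ) %ℕ n
      eq = %ℕ-unique n ((j - 1ℤ) /ℕ n + m) (n%ℕd<d (j - 1ℤ) n)
             (lem j (+ ((j - 1ℤ) %ℕ n)) m ((j - 1ℤ) /ℕ n) (+ n) (a≡a%ℕn+[a/ℕn]*n (j - 1ℤ) n))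

    step-suc : ∀ (j : Fin n) → step P (+ suc (toℕ j)) ≡ lookup P j
    step-suc j = cong (lookup P) (Finₚ.toℕ-injective (trans (Finₚ.toℕ-fromℕ< _)
      (%ℕ-unique n 0ℤ (Finₚ.toℕ<n j) (sym (ℤₚ.+-identityʳ (+ toℕ j))))))

    vertex-step : ∀ j → vertex P j ≡ vertex P (j - 1ℤ) ⊕ stepVector (step P j)
    vertex-step (+ zero)  = sym (undo (vertex P 0ℤ) (stepVector (step P 0ℤ)))
      where
      lem : ∀ a b → a + -1ℤ * b + b ≡ a
      lem = solve-∀
      undo : ∀ p v → p ⊕ (- 1ℤ) ⊛ v ⊕ v ≡ p
      undo (a , b) (c , d) = cong₂ _,_ (lem a c) (lem b d)
    vertex-step (+ suc m) = refl
    -- The predecessor of -[1+ m ] computes to -[1+ suc (m + 0) ], hence the correction by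
    -- `+-identityʳ`.
    vertex-step -[1+ m ]  = trans (sym (undo (vertex P -[1+ m ]) (stepVector (step P -[1+ m ]))))
                              (cong (λ z → vertex P -[1+ suc z ] ⊕ stepVector (step P -[1+ m ])) (sym (ℕₚ.+-identityʳ m)))
      where
      lem : ∀ a b → a + -1ℤ * b + b ≡ a
      lem = solve-∀
      undo : ∀ p v → p ⊕ (- 1ℤ) ⊛ v ⊕ v ≡ p
      undo (a , b) (c , d) = cong₂ _,_ (lem a c) (lem b d)

    abscissa : ℤ → ℤ
    abscissa j = proj₁ (vertex P j)

    private
      X = abscissa

    abscissa-U : ∀ j → step P j ≡ U → X j ≡ X (j - 1ℤ)
    abscissa-U j e = trans (cong proj₁ (vertex-step j)) (trans (cong (λ t → X (j - 1ℤ) + proj₁ (stepVector t)) e) (ℤₚ.+-identityʳ _))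

    abscissa-R : ∀ j → step P j ≡ R → X j ≡ X (j - 1ℤ) + 1ℤ
    abscissa-R j e = trans (cong proj₁ (vertex-step j)) (cong (λ t → X (j - 1ℤ) + proj₁ (stepVector t)) e)

    abscissa-steps : ∀ j → X j ≡ X (j - 1ℤ) ⊎ X j ≡ X (j - 1ℤ) + 1ℤ
    abscissa-steps j with step P j in e
    ... | U = inj₁ (abscissa-U j e)
    ... | R = inj₂ (abscissa-R j e)

    R-abscissa : ∀ j → X j ≡ X (j - 1ℤ) + 1ℤ → step P j ≡ R
    R-abscissa j e with step P j in e′
    ... | R = refl
    ... | U = contradiction (trans (sym (abscissa-U j e′)) e) (ℤₚ.<⇒≢ (a<a+1 _))

    -- Every step raises x + y by one and vertex 0 is the origin, so the index and the abscissa
    -- determine the ordinate.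
    vertex-coordinates : ∀ j → vertex P j ≡ (X j , j - X j)
    vertex-coordinates j = cong (X j ,_) (trans (lem (X j) (proj₂ (vertex P j))) (cong (_- X j) (ℤ-ind {Q = Sum} refl up down j)))
      where
      lem : ∀ x y → y ≡ x + y - x
      lem = solve-∀
      Sum : ℤ → Set
      Sum j = proj₁ (vertex P j) + proj₂ (vertex P j) ≡ j
      total : ∀ p t → proj₁ (p ⊕ stepVector t) + proj₂ (p ⊕ stepVector t) ≡ proj₁ p + proj₂ p + 1ℤ
      total (x , y) R = lem₁ x y
        where
        lem₁ : ∀ x y → x + 1ℤ + (y + 0ℤ) ≡ x + y + 1ℤ
        lem₁ = solve-∀
      total (x , y) U = lem₁ x y
        where
        lem₁ : ∀ x y → x + 0ℤ + (y + 1ℤ) ≡ x + y + 1ℤ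
        lem₁ = solve-∀
      next : ∀ m → proj₁ (vertex P (m + 1ℤ)) + proj₂ (vertex P (m + 1ℤ)) ≡ proj₁ (vertex P m) + proj₂ (vertex P m) + 1ℤ
      next m = trans (cong (λ v → proj₁ v + proj₂ v) (vertex-step (m + 1ℤ))) (trans (total (vertex P (m + 1ℤ - 1ℤ)) (step P (m + 1ℤ)))
                 (cong (λ z → proj₁ (vertex P z) + proj₂ (vertex P z) + 1ℤ) (+1-1 m)))
      up : ∀ m → Sum m → Sum (m + 1ℤ)
      up m e = trans (next m) (cong (_+ 1ℤ) e)
      down : ∀ m → Sum (m + 1ℤ) → Sum m
      down m e = +-cancelʳ 1ℤ (trans (sym (next m)) e)

    private
      -- Stated for a suffix Q of the word starting after vertex a, so that induction on the vector
      -- applies.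
      partial : ∀ {m} a (Q : Vec Step m) → (∀ j → step P (+ suc (a ℕ.+ toℕ j)) ≡ lookup Q j) →
        X (+ (a ℕ.+ m)) + + Vec.count (_≟ˢ U) Q ≡ X (+ a) + + m
      partial a [] h = cong (λ z → X (+ z) + 0ℤ) (ℕₚ.+-identityʳ a)
      partial {suc m} a (t ∷ Q) h with partial (suc a) Q (λ j → trans (cong (λ z → step P (+ suc z)) (sym (ℕₚ.+-suc a (toℕ j)))) (h (Fin.suc j)))
                                    | trans (cong (λ z → step P (+ suc z)) (sym (ℕₚ.+-identityʳ a))) (h Fin.zero)
      partial {suc m} a (U ∷ Q) h | ih | e =
        trans (cong (λ z → X (+ z) + (1ℤ + + Vec.count (_≟ˢ U) Q)) (ℕₚ.+-suc a m))
              (lem (X (+ suc (a ℕ.+ m))) (+ Vec.count (_≟ˢ U) Q) (+ m) ih (abscissa-U (+ suc a) e))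
        where
        lem : ∀ x {y z} c M → x + c ≡ y + M → y ≡ z → x + (1ℤ + c) ≡ z + (1ℤ + M)
        lem x {y} c M e refl = trans (lem₁ x c) (trans (cong (λ z → 1ℤ + z) e) (sym (lem₁ y M)))
          where
          lem₁ : ∀ x c → x + (1ℤ + c) ≡ 1ℤ + (x + c)
          lem₁ = solve-∀
      partial {suc m} a (R ∷ Q) h | ih | e =
        trans (cong (λ z → X (+ z) + + Vec.count (_≟ˢ U) Q) (ℕₚ.+-suc a m))
              (trans ih (trans (cong (_+ + m) (abscissa-R (+ suc a) e)) (ℤₚ.+-assoc (X (+ a)) 1ℤ (+ m))))

    abscissa-total : X (+ n) + + Vec.count (_≟ˢ U) P ≡ + n
    abscissa-total = trans (partial 0 P step-suc) (ℤₚ.+-identityˡ (+ n))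

    module _ (isPath : IsLatticePath k P) where

      private
        X[n] : X (+ n) ≡ + n - + k
        X[n] = trans (lem (X (+ n)) (+ k)) (cong (_- + k) (trans (cong (λ z → X (+ n) + + z) (sym isPath)) abscissa-total))
          where
          lem : ∀ a b → a ≡ a + b - b
          lem = solve-∀

        next : ∀ j → step P j ≡ step P (j + + n) → X (j - 1ℤ + + n) - X (j - 1ℤ) ≡ X (j + + n) - X j
        next j e with step P j in e₁
        ... | U = cong₂ _-_ (trans (cong X (+-swap-last j _ _)) (sym (abscissa-U (j + + n) (sym e)))) (sym (abscissa-U j e₁))
        ... | R = trans (trans (cong (λ z → X z - X (j - 1ℤ)) (+-swap-last j _ _)) (lem (X (j + + n - 1ℤ)) (X (j - 1ℤ))))
                    (sym (cong₂ _-_ (abscissa-R (j + + n) (sym e)) (abscissa-R j e₁)))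
          where
          lem : ∀ a b → a - b ≡ a + 1ℤ - (b + 1ℤ)
          lem = solve-∀

        +n : ∀ j → X (j + + n) - X j ≡ + n - + k
        +n = ℤ-ind {Q = λ j → X (j + + n) - X j ≡ + n - + k} base up down
          where
          base : X (0ℤ + + n) - X 0ℤ ≡ + n - + k
          base = trans (cong (λ z → X z - 0ℤ) (ℤₚ.+-identityˡ (+ n))) (trans (ℤₚ.+-identityʳ _) X[n])
          same : ∀ j → step P j ≡ step P (j + + n)
          same j = trans (sym (step-periodic j 1ℤ)) (cong (λ z → step P (j + z)) (ℤₚ.*-identityˡ (+ n)))
          eq : ∀ m → X (m + + n) - X m ≡ X (m + 1ℤ + + n) - X (m + 1ℤ)
          eq m = trans (cong (λ z → X (z + + n) - X z) (sym (+1-1 m))) (next (m + 1ℤ) (same (m + 1ℤ)))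
          up : ∀ m → X (m + + n) - X m ≡ + n - + k → X (m + 1ℤ + + n) - X (m + 1ℤ) ≡ + n - + k
          up m e = trans (sym (eq m)) e
          down : ∀ m → X (m + 1ℤ + + n) - X (m + 1ℤ) ≡ + n - + k → X (m + + n) - X m ≡ + n - + k
          down m e = trans (eq m) e

      abscissa-periodic : ∀ q m → X (q + m * + n) ≡ X q + m * (+ n - + k)
      abscissa-periodic q = ℤ-ind {Q = λ m → X (q + m * + n) ≡ X q + m * (+ n - + k)} base up down
        where
        d = + n - + k
        base : X (q + 0ℤ * + n) ≡ X q + 0ℤ * d
        base = trans (cong X (ℤₚ.+-identityʳ q)) (sym (ℤₚ.+-identityʳ (X q)))
        lem₁ : ∀ q m N → q + (m + 1ℤ) * N ≡ q + m * N + N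
        lem₁ = solve-∀
        lem₂ : ∀ a b → a ≡ b + (a - b)
        lem₂ = solve-∀
        next′ : ∀ m → X (q + (m + 1ℤ) * + n) ≡ X (q + m * + n) + d
        next′ m = trans (cong X (lem₁ q m (+ n))) (trans (lem₂ _ (X (q + m * + n))) (cong (λ z → X (q + m * + n) + z) (+n (q + m * + n))))
        up : ∀ m → X (q + m * + n) ≡ X q + m * d → X (q + (m + 1ℤ) * + n) ≡ X q + (m + 1ℤ) * d
        up m e = trans (next′ m) (trans (cong (_+ d) e) (sym (lem₁ (X q) m d)))
        down : ∀ m → X (q + (m + 1ℤ) * + n) ≡ X q + (m + 1ℤ) * d → X (q + m * + n) ≡ X q + m * d
        down m e = +-cancelʳ d (trans (sym (next′ m)) (trans e (lem₁ (X q) m d)))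

      abscissa-cut : Cut X
      abscissa-cut = record { steps = abscissa-steps ; periodic = abscissa-periodic }

  step-swapSteps : ∀ i P j → step (swapSteps i P) j ≡ step P (s n i j)
  step-swapSteps i P j = begin
    lookup (swapSteps i P) r′                                     ≡⟨ Vecₚ.lookup∘tabulate _ r′ ⟩
    step P (s n i (+ suc (toℕ r′)))                               ≡⟨ cong (λ z → step P (s n i (+ suc z))) (Finₚ.toℕ-fromℕ< (n%ℕd<d (j - 1ℤ) n)) ⟩
    step P (s n i (+ suc r))                                      ≡⟨ cong (λ z → step P (s n i z)) (lem j (+ r) m (+ n) (a≡a%ℕn+[a/ℕn]*n (j - 1ℤ) n)) ⟩
    step P (s n i (j + (- m) * + n))                              ≡⟨ cong (step P) (s-shift i j (- m)) ⟩
    step P (s n i j + (- m) * + n)                                ≡⟨ step-periodic P (s n i j) (- m) ⟩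
    step P (s n i j)                                              ∎
    where
    open ≡-Reasoning
    r  = (j - 1ℤ) %ℕ n
    r′ = fromℕ< (n%ℕd<d (j - 1ℤ) n)
    m  = (j - 1ℤ) /ℕ n
    lem : ∀ j r m N → j - 1ℤ ≡ r + m * N → 1ℤ + r ≡ j + (- m) * N
    lem j r m N e = trans (lem₁ r m N) (trans (cong (λ z → z + 1ℤ + (- m) * N) (sym e)) (cong (_+ (- m) * N) (-1+1 j)))
      where
      lem₁ : ∀ r m N → 1ℤ + r ≡ r + m * N + 1ℤ + (- m) * N
      lem₁ = solve-∀

-- Common crossings of two strands and their parity

open DecMembership (≡-dec ℤₚ._≟_ ℤₚ._≟_) using (_∈?_)

common : List Point → List Point → ℕ
common L M = length (filter (_∈? M) L)

common-∷-∈ : ∀ {x} L M → x ∈ M → common (x ∷ L) M ≡ suc (common L M)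
common-∷-∈ {x} L M x∈M with x ∈? M
... | yes _ = refl
... | no x∉M = contradiction x∈M x∉M

common-∷-∉ : ∀ {x} L M → x ∉ M → common (x ∷ L) M ≡ common L M
common-∷-∉ {x} L M x∉M with x ∈? M
... | yes x∈M = contradiction x∈M x∉M
... | no _ = refl

common-++ˡ : ∀ K L M → (∀ {x} → x ∈ K → x ∉ M) → common (K ++ L) M ≡ common L M
common-++ˡ []      L M h = refl
common-++ˡ (x ∷ K) L M h = trans (common-∷-∉ (K ++ L) M (h (here refl))) (common-++ˡ K L M (h ∘ there))

common-++ʳ : ∀ L K M → (∀ {x} → x ∈ L → x ∉ K) → common L (K ++ M) ≡ common L M
common-++ʳ []      K M h = refl
common-++ʳ (x ∷ L) K M h with x ∈? M
... | yes x∈M = trans (common-∷-∈ L (K ++ M) (∈-++⁺ʳ K x∈M)) (cong suc (common-++ʳ L K M (h ∘ there)))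
... | no  x∉M = trans (common-∷-∉ L (K ++ M) x∉) (common-++ʳ L K M (h ∘ there))
  where
  x∉ : x ∉ K ++ M
  x∉ x∈ with ∈-++⁻ K x∈
  ... | inj₁ x∈K = h (here refl) x∈K
  ... | inj₂ x∈M = x∉M x∈M

2∣suc⇒2∤ : ∀ m → 2 ℕ∣.∣ suc m → ¬ (2 ℕ∣.∣ m)
2∣suc⇒2∤ m d d′ with ℕ∣.∣1⇒≡1 (ℕ∣.∣m+n∣m⇒∣n (subst (2 ℕ∣.∣_) (ℕₚ.+-comm 1 m) d) d′)
... | ()

2∤⇒2∣suc : ∀ m → ¬ (2 ℕ∣.∣ m) → 2 ℕ∣.∣ suc m
2∤⇒2∣suc zero          h = contradiction (ℕ∣._∣0 2) h
2∤⇒2∣suc (suc zero)    h = ℕ∣.∣-refl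
2∤⇒2∣suc (suc (suc m)) h = ℕ∣.∣m∣n⇒∣m+n ℕ∣.∣-refl (2∤⇒2∣suc m (h ∘ ℕ∣.∣m∣n⇒∣m+n ℕ∣.∣-refl))

-- The coordinate sum of the top left corner (x, y+1), hence the index of that corner on every cut
-- through it.
diag : Point → ℤ
diag (x , y) = x + y + 1ℤ

-- The strip as the region between two cuts

module Strip (n : ℕ) .{{_ : NonZero n}} (k : ℕ) (2≤n : 2 ℕ.≤ n) (P : Vec Step n) (isPath : IsLatticePath k P) where
  open Words n 2≤n
  open Cuts n 2≤n (+ n - + k)
  open Paths n k 2≤n

  -- Raising the path by k keeps abscissae and adds k to the index x + y of each vertex, hence the
  -- shifted argument of `north`.
  south north : ℤ → ℤ
  south = abscissa P
  north q = south (q - + k)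

  south-cut : Cut south
  south-cut = abscissa-cut P isPath

  north-cut : Cut north
  north-cut = record
    { steps    = λ q → subst (λ z → north q ≡ south z ⊎ north q ≡ south z + 1ℤ) (+-swap-last q _ _) (steps (q - + k))
    ; periodic = λ q m → trans (cong south (+-swap-last q _ _)) (periodic (q - + k) m)
    }
    where open Cut south-cut

  stepBetween-step : ∀ j → stepBetween (south (j - 1ℤ)) (south j) ≡ step P j
  stepBetween-step j with step P j in e
  ... | U = stepBetween-U (abscissa-U P j e)
  ... | R = stepBetween-R (abscissa-R P j e)

  edge-south : ∀ q → edge south q ≡ southEdge P q
  edge-south q = cong₂ _,_ (stepBetween-step q) (sym (vertex-coordinates P (q - 1ℤ)))

  edge-north : ∀ q → edge north q ≡ northEdge k P (q - + k)
  edge-north q = cong₂ _,_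
    (trans (cong (λ z → stepBetween (south z) (north q)) (+-swap-last q _ _)) (stepBetween-step (q - + k)))
    (trans (cong (λ z → south z , q - 1ℤ - south z) (+-swap-last q _ _))
      (trans (cong₂ _,_ (sym (ℤₚ.+-identityʳ _)) (lem q (+ k) (south (q - + k - 1ℤ))))
        (cong (_⊕ (0ℤ , + k)) (sym (vertex-coordinates P (q - + k - 1ℤ))))))
    where
    lem : ∀ q k x → q - 1ℤ - x ≡ q - k - 1ℤ - x + k
    lem = solve-∀

  edge-position : ∀ {Z q t x y} → edge Z q ≡ (t , (x , y)) → q - 1ℤ ≡ x + y × Z (q - 1ℤ) ≡ x
  edge-position {Z} {q} refl = lem q (Z (q - 1ℤ)) , refl
    where
    lem : ∀ q x → q - 1ℤ ≡ x + (q - 1ℤ - x)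
    lem = solve-∀

  edge-R : ∀ {Z q c} → Cut Z → edge Z q ≡ (R , c) → Z q ≡ Z (q - 1ℤ) + 1ℤ
  edge-R {Z} {q} cut e with Cut.steps cut q
  ... | inj₂ e′ = e′
  ... | inj₁ e′ with trans (sym (stepBetween-U e′)) (cong proj₁ e)
  ...   | ()

  -- On the antidiagonal through the top left corner of the box, that corner lies weakly right of
  -- the vertex of Z and strictly left of the vertex of Y.
  Between : (ℤ → ℤ) → (ℤ → ℤ) → Point → Set
  Between Z Y c = Z (diag c) ≤ proj₁ c × proj₁ c < Y (diag c)

  private
    -- A discrete intermediate value argument: `south` rises by at most one per step, so it has a
    -- right step over column x in the given range.
    search : ∀ {x} m q → south q ≤ x → x < south (q + + m) →
      ∃ λ j → south (j - 1ℤ) ≡ x × south j ≡ x + 1ℤ × q + 1ℤ ≤ j × j ≤ q + + m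
    search zero    q le lt = contradiction (subst (λ z → _ < south z) (ℤₚ.+-identityʳ q) lt) (ℤₚ.≤⇒≯ le)
    search {x} (suc m) q le lt with ℤₚ._≤?_ (south (q + + m)) x
    ... | no ¬le = let j , e , e′ , l , u = search m q le (ℤₚ.≰⇒> ¬le) in
                   j , e , e′ , l , ℤₚ.≤-trans u (ℤₚ.+-monoʳ-≤ q (+≤+ (ℕₚ.n≤1+n m)))
    ... | yes le′ with Cut.steps south-cut (q + + suc m)
    ...   | inj₁ e = contradiction (subst (x <_) (trans e (cong south (lem q (+ m)))) lt) (ℤₚ.≤⇒≯ le′)
      where
      lem : ∀ q m → q + (1ℤ + m) - 1ℤ ≡ q + m
      lem = solve-∀
    ...   | inj₂ e = q + + suc m , eq , trans e (cong (_+ 1ℤ) eq) , ℤₚ.+-monoʳ-≤ q (+≤+ (ℕ.s≤s ℕ.z≤n)) , ℤₚ.≤-refl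
      where
      lem : ∀ q m → q + (1ℤ + m) - 1ℤ ≡ q + m
      lem = solve-∀
      le″ : south (q + + suc m - 1ℤ) ≤ x
      le″ = subst (λ z → south z ≤ x) (sym (lem q (+ m))) le′
      eq : south (q + + suc m - 1ℤ) ≡ x
      eq = ℤₚ.≤-antisym le″ (<+1⇒≤ (subst (x <_) e lt))

  inStrip⁻ : ∀ c → InStrip k P c → Between north south c
  inStrip⁻ (x , y) (j , h , e , h≤y , y<h+k) =
    ℤₚ.≤-trans (Cut.mono south-cut {x + y + 1ℤ - + k} {j - 1ℤ} (lin≤ (<⇒+1≤ y<h+k) (trans (cong (_- (x + y + 1ℤ - + k)) posn) (lem₁ x y h (+ k))))) (ℤₚ.≤-reflexive atx) ,
    ℤₚ.<-≤-trans (subst (x <_) (sym atR) (a<a+1 x)) (Cut.mono south-cut {j} {x + y + 1ℤ} (lin≤ h≤y (trans (cong (λ z → x + y + 1ℤ - z) j≡) (lem₂ x y h))))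
    where
    e′ : edge south j ≡ (R , (x , h))
    e′ = trans (edge-south j) e
    posn : j - 1ℤ ≡ x + h
    posn = proj₁ (edge-position {south} {j} e′)
    atx : south (j - 1ℤ) ≡ x
    atx = proj₂ (edge-position {south} {j} e′)
    atR : south j ≡ x + 1ℤ
    atR = trans (edge-R {south} {j} south-cut e′) (cong (_+ 1ℤ) atx)
    j≡ : j ≡ x + h + 1ℤ
    j≡ = trans (sym (-1+1 j)) (cong (_+ 1ℤ) posn)
    lem₁ : ∀ x y h k → x + h - (x + y + 1ℤ - k) ≡ h + k - (y + 1ℤ)
    lem₁ = solve-∀
    lem₂ : ∀ x y h → x + y + 1ℤ - (x + h + 1ℤ) ≡ y - h
    lem₂ = solve-∀

  -- A right step over column x at height h has index x + h + 1. So the k indices ending with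
  -- `diag c` correspond to the heights with h ≤ y < h + k.
  inStrip⁺ : ∀ c → Between north south c → InStrip k P c
  inStrip⁺ (x , y) (le , lt) =
    let j , e , e′ , l , u = search k (x + y + 1ℤ - + k) le (subst (λ z → x < south z) (lem₀ (x + y + 1ℤ) (+ k)) lt) in
    j , j - 1ℤ - x ,
    cong₂ _,_ (R-abscissa P j (trans e′ (cong (_+ 1ℤ) (sym e)))) (trans (vertex-coordinates P (j - 1ℤ)) (cong (λ z → z , j - 1ℤ - z) e)) ,
    lin≤ u (lem₁ x y j (+ k)) , +1≤⇒< (lin≤ l (lem₂ x y j (+ k)))
    where
    lem₀ : ∀ a k → a ≡ a - k + k
    lem₀ = solve-∀
    lem₁ : ∀ x y j k → y - (j - 1ℤ - x) ≡ x + y + 1ℤ - k + k - j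
    lem₁ = solve-∀
    lem₂ : ∀ x y j k → j - 1ℤ - x + k - (y + 1ℤ) ≡ j - (x + y + 1ℤ - k + 1ℤ)
    lem₂ = solve-∀

  private
    v : Point
    v = period n k

  diag-box : ∀ Z q → diag (box Z q) ≡ q
  diag-box Z q = lem q (Z q)
    where
    lem : ∀ q x → x + (q - 1ℤ - x) + 1ℤ ≡ q
    lem = solve-∀

  box-unique : ∀ Z c → Z (diag c) ≡ proj₁ c → c ≡ box Z (diag c)
  box-unique Z (x , y) e = cong₂ _,_ (sym e) (trans (lem x y) (cong (λ z → x + y + 1ℤ - 1ℤ - z) (sym e)))
    where
    lem : ∀ x y → y ≡ x + y + 1ℤ - 1ℤ - x
    lem = solve-∀

  box-periodic : ∀ {Z} → Cut Z → ∀ q m → box Z (q + m * + n) ≡ box Z q ⊕ m ⊛ v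
  box-periodic {Z} cut q m = cong₂ _,_ (Cut.periodic cut q m)
    (trans (cong (λ z → q + m * + n - 1ℤ - z) (Cut.periodic cut q m)) (lem q (Z q) m (+ n) (+ k)))
    where
    lem : ∀ q x m N K → q + m * N - 1ℤ - (x + m * (N - K)) ≡ q - 1ℤ - x + m * K
    lem = solve-∀

  diag-⊕ : ∀ c m → diag (c ⊕ m ⊛ v) ≡ diag c + m * + n
  diag-⊕ (x , y) m = lem x y m (+ n) (+ k)
    where
    lem : ∀ x y m N K → x + m * (N - K) + (y + m * K) + 1ℤ ≡ x + y + 1ℤ + m * N
    lem = solve-∀

  between-periodic : ∀ {Z Y} → Cut Z → Cut Y → ∀ c m → Between Z Y c → Between Z Y (c ⊕ m ⊛ v)
  between-periodic {Z} {Y} cZ cY c m (le , lt) =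
    subst (_≤ proj₁ c + m * (+ n - + k)) (sym (trans (cong Z (diag-⊕ c m)) (Cut.periodic cZ _ m))) (ℤₚ.+-monoˡ-≤ _ le) ,
    subst (proj₁ c + m * (+ n - + k) <_) (sym (trans (cong Y (diag-⊕ c m)) (Cut.periodic cY _ m))) (ℤₚ.+-monoˡ-< _ lt)

  between-split : ∀ {Z Y} p c → Between Z Y c → (∃ λ m → c ≡ box Z (p + m * + n)) ⊎ Between (bump p Z) Y c
  between-split {Z} {Y} p c (le , lt) with + n ∣? (diag c - p)
  ... | no ¬h = inj₂ (subst (_≤ proj₁ c) refl le , lt)
  ... | yes h with Z (diag c) ℤₚ.≟ proj₁ c
  ...   | yes e = inj₁ (_∣_.quotient h , trans (box-unique Z c e) (cong (box Z) (∣⇒≡ p (diag c) h)))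
  ...   | no ne = inj₂ (<⇒+1≤ (ℤₚ.≤∧≢⇒< le ne) , lt)

  filling-periodic : ∀ {T} → IsPeriodicFilling k P T → ∀ c m → Between north south c → T (c ⊕ m ⊛ v) ≡ T c
  filling-periodic {T} per c m b = ℤ-ind {Q = λ m → T (c ⊕ m ⊛ v) ≡ T c} base up down m
    where
    base : T (c ⊕ 0ℤ ⊛ v) ≡ T c
    base = cong T (cong₂ _,_ (ℤₚ.+-identityʳ _) (ℤₚ.+-identityʳ _))
    lem : ∀ a m d → a + (m + 1ℤ) * d ≡ a + m * d + d
    lem = solve-∀
    next : ∀ m → T (c ⊕ (m + 1ℤ) ⊛ v) ≡ T (c ⊕ m ⊛ v)
    next m = trans (cong T (cong₂ _,_ (lem (proj₁ c) m (proj₁ v)) (lem (proj₂ c) m (proj₂ v)))) (per _ (inStrip⁺ (c ⊕ m ⊛ v) (between-periodic north-cut south-cut c m b)))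
    up : ∀ m → T (c ⊕ m ⊛ v) ≡ T c → T (c ⊕ (m + 1ℤ) ⊛ v) ≡ T c
    up m e = trans (next m) e
    down : ∀ m → T (c ⊕ (m + 1ℤ) ⊛ v) ≡ T c → T (c ⊕ m ⊛ v) ≡ T c
    down m e = trans (sym (next m)) e

-- Following the strands across the moving cut

module Tracing (n : ℕ) .{{_ : NonZero n}} (k : ℕ) (2≤n : 2 ℕ.≤ n) (P : Vec Step n) (isPath : IsLatticePath k P)
               (T : Point → Tile) (per : IsPeriodicFilling k P T) where
  open Words n 2≤n
  open Cuts n 2≤n (+ n - + k)
  open Strip n k 2≤n P isPath

  Through : ℤ → Edge → List Point → Set
  Through a e L = Σ (Strand k P T a e) λ σ → crossingsOn σ ≡ L

  bottom⁻ : ∀ {a e} (σ : Strand k P T a e) b → e ≡ bottom b → (∀ j → northEdge k P j ≢ bottom b) →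
    (T b ≡ crossing × Σ (Strand k P T a (top b)) λ σ′ → crossingsOn σ ≡ b ∷ crossingsOn σ′) ⊎
    (T b ≡ elbow × Σ (Strand k P T a (left b)) λ σ′ → crossingsOn σ ≡ crossingsOn σ′)
  bottom⁻ {a} enter                b e    ¬n = contradiction e (¬n a)
  bottom⁻ (crossFromLeft c _ _ σ)  b ()   ¬n
  bottom⁻ (crossFromTop  c _ t σ)  b refl ¬n = inj₁ (t , σ , refl)
  bottom⁻ (elbowFromLeft c _ t σ)  b refl ¬n = inj₂ (t , σ , refl)
  bottom⁻ (elbowFromTop  c _ _ σ)  b ()   ¬n

  private
    right-injective : ∀ b c → right c ≡ right b → c ≡ b
    right-injective (x , y) (x′ , y′) e = cong₂ _,_ (+-cancelʳ 1ℤ (cong (proj₁ ∘ proj₂) e)) (+-cancelʳ 0ℤ (cong (proj₂ ∘ proj₂) e))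

  right⁻ : ∀ {a e} (σ : Strand k P T a e) b → e ≡ right b → (∀ j → northEdge k P j ≢ right b) →
    (T b ≡ crossing × Σ (Strand k P T a (left b)) λ σ′ → crossingsOn σ ≡ b ∷ crossingsOn σ′) ⊎
    (T b ≡ elbow × Σ (Strand k P T a (top b)) λ σ′ → crossingsOn σ ≡ crossingsOn σ′)
  right⁻ {a} enter                b e ¬n = contradiction e (¬n a)
  right⁻ (crossFromLeft c _ t σ)  b e ¬n with right-injective b c e
  ... | refl = inj₁ (t , σ , refl)
  right⁻ (crossFromTop  c _ t σ)  b () ¬n
  right⁻ (elbowFromLeft c _ t σ)  b () ¬n
  right⁻ (elbowFromTop  c _ t σ)  b e ¬n with right-injective b c e
  ... | refl = inj₂ (t , σ , refl)

  northEdge-edge : ∀ j → northEdge k P j ≡ edge north (j + + k)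
  northEdge-edge j = trans (cong (northEdge k P) (lem j (+ k))) (sym (edge-north (j + + k)))
    where
    lem : ∀ j k → j ≡ j + k - k
    lem = solve-∀

  module _ {Z : ℤ → ℤ} (below : ∀ q → north q ≤ Z q) (q : ℤ) where

    -- The bottom and right sides of a box at Z lie beyond Z, whereas the northern boundary never
    -- passes Z. A strand found on such a side has therefore come through the box.
    north≢bottom : ∀ j → northEdge k P j ≢ bottom (box Z q)
    north≢bottom j e = ℤₚ.<⇒≱ (a<a+1 (Z q)) (subst (_≤ Z q) north-q (below q))
      where
      e′ : edge north (j + + k) ≡ bottom (box Z q)
      e′ = trans (sym (northEdge-edge j)) e
      posn = edge-position {north} {j + + k} e′
      lem : ∀ q x → x + (q - 1ℤ - x) + 1ℤ ≡ q
      lem = solve-∀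
      same : j + + k ≡ q
      same = trans (sym (-1+1 (j + + k))) (trans (cong (_+ 1ℤ) (proj₁ posn)) (lem q (Z q)))
      north-q : north q ≡ Z q + 1ℤ
      north-q = trans (cong north (sym same)) (trans (edge-R {north} {j + + k} north-cut e′) (cong (_+ 1ℤ) (proj₂ posn)))

    north≢right : ∀ j → northEdge k P j ≢ right (box Z q)
    north≢right j e = ℤₚ.<⇒≱ (a<a+1 (Z q)) (subst (_≤ Z q) north-q (below q))
      where
      e′ : edge north (j + + k) ≡ right (box Z q)
      e′ = trans (sym (northEdge-edge j)) e
      posn = edge-position {north} {j + + k} e′
      lem : ∀ q x → x + 1ℤ + (q - 1ℤ - x + 0ℤ) ≡ q
      lem = solve-∀
      north-q : north q ≡ Z q + 1ℤ
      north-q = trans (cong north (sym (trans (proj₁ posn) (lem q (Z q))))) (proj₂ posn)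

  private
    p+1-1 : ∀ p M → p + 1ℤ + M - 1ℤ ≡ p + M
    p+1-1 = solve-∀

  abstract
    -- The box, if any, just crossed by the strand now at position q. The case split is sealed;
    -- later proofs use only the three equations and `hits-∈`.
    hits : ℤ → (ℤ → ℤ) → ℤ → List Point
    hits p Z q with residue p q
    ... | at _ _    = box Z q ∷ []
    ... | after _ _ = box Z (q - 1ℤ) ∷ []
    ... | away _ _  = []

    hits-at : ∀ p Z m → hits p Z (p + m * + n) ≡ box Z (p + m * + n) ∷ []
    hits-at p Z m with residue p (p + m * + n)
    ... | at _ _    = refl
    ... | after m′ e = contradiction (≡⇒∣ (p + 1ℤ) m′ e) (at≢after p (p + m * + n) (≡⇒∣ p m refl))
    ... | away h _  = contradiction (≡⇒∣ p m refl) h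

    hits-after : ∀ p Z m → hits p Z (p + 1ℤ + m * + n) ≡ box Z (p + m * + n) ∷ []
    hits-after p Z m with residue p (p + 1ℤ + m * + n)
    ... | at m′ e   = contradiction (≡⇒∣ (p + 1ℤ) m refl) (at≢after p (p + 1ℤ + m * + n) (≡⇒∣ p m′ e))
    ... | after _ _ = cong (λ z → box Z z ∷ []) (p+1-1 p (m * + n))
    ... | away _ h  = contradiction (≡⇒∣ (p + 1ℤ) m refl) h

    hits-away : ∀ p Z {q} → ¬ (+ n ∣ q - p) → ¬ (+ n ∣ q - (p + 1ℤ)) → hits p Z q ≡ []
    hits-away p Z {q} h h′ with residue p q
    ... | at m e    = contradiction (≡⇒∣ p m e) h
    ... | after m e = contradiction (≡⇒∣ (p + 1ℤ) m e) h′
    ... | away _ _  = refl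

    hits-∈ : ∀ p Z q {c} → c ∈ hits p Z q → ∃ λ m → c ≡ box Z (p + m * + n) × (q ≡ p + m * + n ⊎ q ≡ p + 1ℤ + m * + n)
    hits-∈ p Z q c∈ with residue p q
    hits-∈ p Z q (here e) | at m refl    = m , e , inj₁ refl
    hits-∈ p Z q (here e) | after m refl = m , trans e (cong (box Z) (p+1-1 p (m * + n))) , inj₂ refl

  extend : Tile → ℤ → (ℤ → ℤ) → (ℤ → List Point) → (ℤ → List Point)
  extend elbow    p Z L   = L
  extend crossing p Z L q = hits p Z q ++ L (s n p q)

  -- Labels increase along the northern boundary and each mutual crossing exchanges the order of two
  -- strands, so disagreement of positions and labels records an odd number of crossings.
  Agree Disagree : (ℤ → ℤ) → ℤ → ℤ → Set
  Agree    u q q′ = (q < q′ × u q < u q′) ⊎ (q′ < q × u q′ < u q)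
  Disagree u q q′ = (q < q′ × u q′ < u q) ⊎ (q′ < q × u q < u q′)

  -- u q is the label and L q the list of crossings of the strand that meets the cut Z at position q.
  record State (Z u : ℤ → ℤ) (L : ℤ → List Point) : Set where
    field
      cut       : Cut Z
      below     : ∀ q → north q ≤ Z q
      labelling : Labelling u
      through   : ∀ q → Through (u q) (edge Z q) (L q)
      unique    : ∀ q {a e} (σ : Strand k P T a e) → e ≡ edge Z q → a ≡ u q × crossingsOn σ ≡ L q
      -- Keeps recorded crossings strictly behind the cut, so that a newly swept box occurs on no
      -- older list.
      passed    : ∀ q {c} → c ∈ L q → proj₁ c < Z (diag c)
      even      : ∀ q q′ → Agree u q q′ → 2 ℕ∣.∣ common (L q) (L q′)
      odd       : ∀ q q′ → Disagree u q q′ → ¬ (2 ℕ∣.∣ common (L q) (L q′))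

  initial : State north (λ q → q - + k) (λ _ → [])
  initial = record
    { cut       = north-cut
    ; below     = λ _ → ℤₚ.≤-refl
    ; labelling = record { periodic = λ q m → +-swap-last q _ _ ; injective = +-cancelʳ (- + k) }
    ; through   = λ q → subst (λ e → Through (q - + k) e []) (sym (edge-north q)) (enter , refl)
    ; unique    = unique₀
    ; passed    = λ _ ()
    ; even      = λ _ _ _ → ℕ∣._∣0 2
    ; odd       = odd₀
    }
    where
    odd₀ : ∀ q q′ → Disagree (λ q → q - + k) q q′ → ¬ (2 ℕ∣.∣ 0)
    odd₀ q q′ (inj₁ (lt , gt)) _ = ℤₚ.<-asym gt (ℤₚ.+-monoˡ-< (- + k) lt)
    odd₀ q q′ (inj₂ (gt , lt)) _ = ℤₚ.<-asym lt (ℤₚ.+-monoˡ-< (- + k) gt)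
    no-right : ∀ q c → InStrip k P c → right c ≢ edge north q
    no-right q c@(x , y) c∈ e = ℤₚ.<⇒≱ (a<a+1 x) (subst (_≤ x) (trans (cong north (sym (trans (proj₁ posn) (lem x y)))) (proj₂ posn)) (proj₁ (inStrip⁻ c c∈)))
      where
      posn = edge-position {north} {q} (sym e)
      lem : ∀ x y → x + 1ℤ + (y + 0ℤ) ≡ x + y + 1ℤ
      lem = solve-∀
    no-bottom : ∀ q c → InStrip k P c → bottom c ≢ edge north q
    no-bottom q c@(x , y) c∈ e = ℤₚ.<⇒≱ (a<a+1 x) (subst (_≤ x) eq (proj₁ (inStrip⁻ c c∈)))
      where
      posn = edge-position {north} {q} (sym e)
      eq : north (x + y + 1ℤ) ≡ x + 1ℤ
      eq = trans (cong north (trans (cong (_+ 1ℤ) (sym (proj₁ posn))) (-1+1 q))) (trans (edge-R {north} {q} north-cut (sym e)) (cong (_+ 1ℤ) (proj₂ posn)))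
    unique₀ : ∀ q {a e} (σ : Strand k P T a e) → e ≡ edge north q → a ≡ q - + k × crossingsOn σ ≡ []
    unique₀ q {a} enter e = trans (lem a (+ k)) (cong (_- + k) same) , refl
      where
      posn = edge-position {north} {a + + k} (trans (sym (northEdge-edge a)) e)
      lem : ∀ a k → a ≡ a + k - k
      lem = solve-∀
      lem₂ : ∀ q x → x + (q - 1ℤ - x) + 1ℤ ≡ q
      lem₂ = solve-∀
      same : a + + k ≡ q
      same = trans (sym (-1+1 (a + + k))) (trans (cong (_+ 1ℤ) (proj₁ posn)) (lem₂ q (north (q - 1ℤ))))
    unique₀ q (crossFromLeft c c∈ _ _) e = contradiction e (no-right q c c∈)
    unique₀ q (crossFromTop  c c∈ _ _) e = contradiction e (no-bottom q c c∈)
    unique₀ q (elbowFromLeft c c∈ _ _) e = contradiction e (no-bottom q c c∈)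
    unique₀ q (elbowFromTop  c c∈ _ _) e = contradiction e (no-right q c c∈)

  private
    transport : ∀ {a a′ e e′ L L′} → a ≡ a′ → e ≡ e′ → L ≡ L′ → Through a e L → Through a′ e′ L′
    transport refl refl refl σ = σ

    crossing≢elbow : crossing ≢ elbow
    crossing≢elbow ()

  module Flip {Z u L} (st : State Z u L) {p} (c : Corner Z p) (unfinished : Z p < south p) where
    open State st

    private
      Z′ = bump p Z

    cornerAt : ∀ m → Corner Z (p + m * + n)
    cornerAt m = corner-periodic cut m c

    between-box : ∀ m → Between north south (box Z (p + m * + n))
    between-box m =
      subst (λ z → north z ≤ Z (p + m * + n)) (sym (diag-box Z _)) (below _) ,
      subst (λ z → Z (p + m * + n) < south z) (sym (diag-box Z _))
        (subst₂ _<_ (sym (Cut.periodic cut p m)) (sym (Cut.periodic south-cut p m)) (ℤₚ.+-monoˡ-< (m * (+ n - + k)) unfinished))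

    inStrip-box : ∀ m → InStrip k P (box Z (p + m * + n))
    inStrip-box m = inStrip⁺ _ (between-box m)

    tile-box : ∀ m → T (box Z (p + m * + n)) ≡ T (box Z p)
    tile-box m = trans (cong T (box-periodic cut p m)) (filling-periodic per (box Z p) m
      (subst (Between north south ∘ box Z) (ℤₚ.+-identityʳ p) (between-box 0ℤ)))

    edge-top′ : ∀ m → edge Z (p + 1ℤ + m * + n) ≡ top (box Z (p + m * + n))
    edge-top′ m = trans (cong (edge Z) (+-swap-last p _ _)) (edge-top (cornerAt m))

    edge-at : ∀ m → edge Z′ (p + m * + n) ≡ bottom (box Z (p + m * + n))
    edge-at m = edge-bottom (cornerAt m) {Z′} (bump-at p Z m) (bump-at-1 p Z m)

    edge-after : ∀ m → edge Z′ (p + 1ℤ + m * + n) ≡ right (box Z (p + m * + n))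
    edge-after m = trans (cong (edge Z′) (+-swap-last p _ _)) (edge-right (cornerAt m) {Z′} (bump-at p Z m)
      (subst (λ z → Z′ z ≡ Z z) (+-swap-last p _ _) (bump-after p Z m)))

    edge-away : ∀ {q} → ¬ (+ n ∣ q - p) → ¬ (+ n ∣ q - (p + 1ℤ)) → edge Z′ q ≡ edge Z q
    edge-away {q} h h′ = cong₂ (λ a b → stepBetween a b , (a , q - 1ℤ - a)) (bump-away p Z {q} h′) (bump-off p Z h)

    through′ : ∀ t → T (box Z p) ≡ t → ∀ q → Through (act t p u q) (edge Z′ q) (extend t p Z L q)
    through′ crossing t q with residue p q
    ... | at m refl =
      let σ , e = transport refl (edge-top′ m) refl (through (p + 1ℤ + m * + n)) in
      transport (cong u (sym (s-at p m))) (sym (edge-at m)) (sym (cong₂ _++_ (hits-at p Z m) (cong L (s-at p m))))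
        (crossFromTop _ (inStrip-box m) (trans (tile-box m) t) σ , cong (_ ∷_) e)
    ... | after m refl =
      let σ , e = transport refl (edge-left (cornerAt m)) refl (through (p + m * + n)) in
      transport (cong u (sym (s-after p m))) (sym (edge-after m)) (sym (cong₂ _++_ (hits-after p Z m) (cong L (s-after p m))))
        (crossFromLeft _ (inStrip-box m) (trans (tile-box m) t) σ , cong (_ ∷_) e)
    ... | away h h′ = transport (cong u (sym (s-away p h h′))) (sym (edge-away h h′))
      (sym (cong₂ _++_ (hits-away p Z h h′) (cong L (s-away p h h′)))) (through q)
    through′ elbow t q with residue p q
    ... | at m refl =
      let σ , e = transport refl (edge-left (cornerAt m)) refl (through (p + m * + n)) in
      transport refl (sym (edge-at m)) refl (elbowFromLeft _ (inStrip-box m) (trans (tile-box m) t) σ , e)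
    ... | after m refl =
      let σ , e = transport refl (edge-top′ m) refl (through (p + 1ℤ + m * + n)) in
      transport refl (sym (edge-after m)) refl (elbowFromTop _ (inStrip-box m) (trans (tile-box m) t) σ , e)
    ... | away h h′ = transport refl (sym (edge-away h h′)) refl (through q)

    private
      unique-at : ∀ m t → T (box Z p) ≡ t → ∀ {a e} (σ : Strand k P T a e) →
        (T (box Z (p + m * + n)) ≡ crossing × Σ (Strand k P T a (top (box Z (p + m * + n)))) λ σ′ → crossingsOn σ ≡ box Z (p + m * + n) ∷ crossingsOn σ′) ⊎
        (T (box Z (p + m * + n)) ≡ elbow × Σ (Strand k P T a (left (box Z (p + m * + n)))) λ σ′ → crossingsOn σ ≡ crossingsOn σ′) →
        a ≡ act t p u (p + m * + n) × crossingsOn σ ≡ extend t p Z L (p + m * + n)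
      unique-at m crossing tt σ (inj₁ (_ , σ′ , e)) =
        let ea , el = unique (p + 1ℤ + m * + n) σ′ (sym (edge-top′ m)) in
        trans ea (cong u (sym (s-at p m))) ,
        trans e (trans (cong (box Z (p + m * + n) ∷_) el) (sym (cong₂ _++_ (hits-at p Z m) (cong L (s-at p m)))))
      unique-at m elbow    tt σ (inj₂ (_ , σ′ , e)) =
        let ea , el = unique (p + m * + n) σ′ (sym (edge-left (cornerAt m))) in ea , trans e el
      unique-at m elbow    tt σ (inj₁ (t′ , _)) = contradiction (trans (sym t′) (trans (tile-box m) tt)) crossing≢elbow
      unique-at m crossing tt σ (inj₂ (t′ , _)) = contradiction (trans (sym (trans (tile-box m) tt)) t′) crossing≢elbow

      unique-after : ∀ m t → T (box Z p) ≡ t → ∀ {a e} (σ : Strand k P T a e) →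
        (T (box Z (p + m * + n)) ≡ crossing × Σ (Strand k P T a (left (box Z (p + m * + n)))) λ σ′ → crossingsOn σ ≡ box Z (p + m * + n) ∷ crossingsOn σ′) ⊎
        (T (box Z (p + m * + n)) ≡ elbow × Σ (Strand k P T a (top (box Z (p + m * + n)))) λ σ′ → crossingsOn σ ≡ crossingsOn σ′) →
        a ≡ act t p u (p + 1ℤ + m * + n) × crossingsOn σ ≡ extend t p Z L (p + 1ℤ + m * + n)
      unique-after m crossing tt σ (inj₁ (_ , σ′ , e)) =
        let ea , el = unique (p + m * + n) σ′ (sym (edge-left (cornerAt m))) in
        trans ea (cong u (sym (s-after p m))) ,
        trans e (trans (cong (box Z (p + m * + n) ∷_) el) (sym (cong₂ _++_ (hits-after p Z m) (cong L (s-after p m)))))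
      unique-after m elbow    tt σ (inj₂ (_ , σ′ , e)) =
        let ea , el = unique (p + 1ℤ + m * + n) σ′ (sym (edge-top′ m)) in ea , trans e el
      unique-after m elbow    tt σ (inj₁ (t′ , _)) = contradiction (trans (sym t′) (trans (tile-box m) tt)) crossing≢elbow
      unique-after m crossing tt σ (inj₂ (t′ , _)) = contradiction (trans (sym (trans (tile-box m) tt)) t′) crossing≢elbow

      unique-away : ∀ t {q} → ¬ (+ n ∣ q - p) → ¬ (+ n ∣ q - (p + 1ℤ)) → ∀ {a e} (σ : Strand k P T a e) → e ≡ edge Z q →
        a ≡ act t p u q × crossingsOn σ ≡ extend t p Z L q
      unique-away crossing {q} h h′ σ eq =
        let ea , el = unique q σ eq in
        trans ea (cong u (sym (s-away p h h′))) ,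
        trans el (sym (cong₂ _++_ (hits-away p Z h h′) (cong L (s-away p h h′))))
      unique-away elbow    {q} h h′ σ eq = unique q σ eq

    unique′ : ∀ t → T (box Z p) ≡ t → ∀ q {a e} (σ : Strand k P T a e) → e ≡ edge Z′ q →
      a ≡ act t p u q × crossingsOn σ ≡ extend t p Z L q
    unique′ t tt q σ eq = go (residue p q)
      where
      go : Residue p q → _
      go (at m refl)    = unique-at m t tt σ (bottom⁻ σ (box Z (p + m * + n)) (trans eq (edge-at m)) (north≢bottom {Z} below (p + m * + n)))
      go (after m refl) = unique-after m t tt σ (right⁻ σ (box Z (p + m * + n)) (trans eq (edge-after m)) (north≢right {Z} below (p + m * + n)))
      go (away h h′)    = unique-away t h h′ σ (trans eq (edge-away h h′))

    hits-fresh : ∀ q {b} → b ∈ hits p Z q → Z (diag b) ≡ proj₁ b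
    hits-fresh q b∈ with hits-∈ p Z q b∈
    ... | m , refl , _ = cong Z (diag-box Z (p + m * + n))

    hits∉L : ∀ q q′ {b} → b ∈ hits p Z q → b ∉ L q′
    hits∉L q q′ b∈ b∈L = ℤₚ.<-irrefl (sym (hits-fresh q b∈)) (passed q′ b∈L)

    passed′ : ∀ t q {b} → b ∈ extend t p Z L q → proj₁ b < Z′ (diag b)
    passed′ elbow    q b∈ = ℤₚ.<-≤-trans (passed q b∈) (bump-≥ p Z _)
    passed′ crossing q b∈ with ∈-++⁻ (hits p Z q) b∈
    ... | inj₂ b∈L = ℤₚ.<-≤-trans (passed (s n p q) b∈L) (bump-≥ p Z _)
    ... | inj₁ b∈h with hits-∈ p Z q b∈h
    ...   | m , refl , _ = subst (Z (p + m * + n) <_) (sym (trans (cong Z′ (diag-box Z (p + m * + n))) (bump-at p Z m))) (a<a+1 _)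

    hits-disjoint : ∀ q q′ → q ≢ q′ → s n p q ≢ q′ → ∀ {b} → b ∈ hits p Z q → b ∉ hits p Z q′
    hits-disjoint q q′ ne sw b∈ b∈′ with hits-∈ p Z q b∈ | hits-∈ p Z q′ b∈′
    ... | m , e , r | m′ , e′ , r′ with trans (sym (diag-box Z _)) (trans (cong diag (trans (sym e) e′)) (diag-box Z _))
    ... | same = go r r′
      where
      go : q ≡ p + m * + n ⊎ q ≡ p + 1ℤ + m * + n → q′ ≡ p + m′ * + n ⊎ q′ ≡ p + 1ℤ + m′ * + n → ⊥
      same₊ : p + 1ℤ + m * + n ≡ p + 1ℤ + m′ * + n
      same₊ = trans (+-swap-last p _ _) (trans (cong (_+ 1ℤ) same) (+-swap-last p _ _))
      go (inj₁ r) (inj₁ r′) = ne (trans r (trans same (sym r′)))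
      go (inj₁ r) (inj₂ r′) = sw (trans (cong (s n p) r) (trans (s-at p m) (trans same₊ (sym r′))))
      go (inj₂ r) (inj₁ r′) = sw (trans (cong (s n p) r) (trans (s-after p m) (trans same (sym r′))))
      go (inj₂ r) (inj₂ r′) = ne (trans r (trans same₊ (sym r′)))

    -- Strands not exchanged by this flip receive no common new box, and a new box lies on no older
    -- list.
    common-apart : ∀ q q′ → q ≢ q′ → s n p q ≢ q′ →
      common (extend crossing p Z L q) (extend crossing p Z L q′) ≡ common (L (s n p q)) (L (s n p q′))
    common-apart q q′ ne sw = trans (common-++ˡ (hits p Z q) _ _ fresh)
        (common-++ʳ (L (s n p q)) (hits p Z q′) _ λ b∈L b∈h → hits∉L q′ (s n p q) b∈h b∈L)
      where
      fresh : ∀ {b} → b ∈ hits p Z q → b ∉ hits p Z q′ ++ L (s n p q′)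
      fresh b∈ b∈′ with ∈-++⁻ (hits p Z q′) b∈′
      ... | inj₁ b∈h = hits-disjoint q q′ ne sw b∈ b∈h
      ... | inj₂ b∈L = hits∉L q (s n p q′) b∈ b∈L

    hits-swap : ∀ q → s n p q ≢ q → ∃ λ b → hits p Z q ≡ b ∷ [] × hits p Z (s n p q) ≡ b ∷ []
    hits-swap q ne with residue p q
    ... | at m refl    = _ , hits-at p Z m , trans (cong (hits p Z) (s-at p m)) (hits-after p Z m)
    ... | after m refl = _ , hits-after p Z m , trans (cong (hits p Z) (s-after p m)) (hits-at p Z m)
    ... | away h h′    = contradiction (s-away p h h′) ne

    common-swapped : ∀ q → s n p q ≢ q →
      common (extend crossing p Z L q) (extend crossing p Z L (s n p q)) ≡ suc (common (L (s n p q)) (L q))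
    common-swapped q ne with hits-swap q ne
    ... | b , e , e′ = begin
      common (hits p Z q ++ L a) (hits p Z a ++ L (s n p a))   ≡⟨ cong₂ (λ x y → common (x ++ L a) (y ++ L (s n p a))) e e′ ⟩
      common (b ∷ L a) (b ∷ L (s n p a))                       ≡⟨ common-∷-∈ (L a) _ (here refl) ⟩
      suc (common (L a) (b ∷ L (s n p a)))                     ≡⟨ cong suc (common-++ʳ (L a) (b ∷ []) _ fresh) ⟩
      suc (common (L a) (L (s n p a)))                         ≡⟨ cong (λ z → suc (common (L a) (L z))) (s-involutive p q) ⟩
      suc (common (L a) (L q))                                 ∎
      where
      open ≡-Reasoning
      a = s n p q
      fresh : ∀ {x} → x ∈ L a → x ∉ b ∷ []
      fresh x∈L x∈b = hits∉L q a (subst (_ ∈_) (sym e) x∈b) x∈L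

    private
      apart : ∀ {q q′} → q < q′ ⊎ q′ < q → q ≢ q′
      apart (inj₁ lt) e = ℤₚ.<⇒≢ lt e
      apart (inj₂ lt) e = ℤₚ.<⇒≢ lt (sym e)

      sw-sym : ∀ {q q′} → s n p q ≢ q′ → s n p q′ ≢ q
      sw-sym {q} {q′} ne e = ne (trans (cong (s n p) (sym e)) (s-involutive p q′))

      agree-apart : ∀ {q q′} → s n p q ≢ q′ → Agree (u ∘ s n p) q q′ → Agree u (s n p q) (s n p q′)
      agree-apart sw (inj₁ (lt , lt′)) = inj₁ (s-mono-< p lt sw , lt′)
      agree-apart sw (inj₂ (lt , lt′)) = inj₂ (s-mono-< p lt (sw-sym sw) , lt′)

      disagree-apart : ∀ {q q′} → s n p q ≢ q′ → Disagree (u ∘ s n p) q q′ → Disagree u (s n p q) (s n p q′)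
      disagree-apart sw (inj₁ (lt , lt′)) = inj₁ (s-mono-< p lt sw , lt′)
      disagree-apart sw (inj₂ (lt , lt′)) = inj₂ (s-mono-< p lt (sw-sym sw) , lt′)

      agree-swapped : ∀ q → Agree (u ∘ s n p) q (s n p q) → Disagree u (s n p q) q
      agree-swapped q (inj₁ (lt , lt′)) = inj₂ (lt , subst (λ z → u (s n p q) < u z) (s-involutive p q) lt′)
      agree-swapped q (inj₂ (lt , lt′)) = inj₁ (lt , subst (λ z → u z < u (s n p q)) (s-involutive p q) lt′)

      disagree-swapped : ∀ q → Disagree (u ∘ s n p) q (s n p q) → Agree u (s n p q) q
      disagree-swapped q (inj₁ (lt , lt′)) = inj₂ (lt , subst (λ z → u z < u (s n p q)) (s-involutive p q) lt′)
      disagree-swapped q (inj₂ (lt , lt′)) = inj₁ (lt , subst (λ z → u (s n p q) < u z) (s-involutive p q) lt′)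

      order : ∀ {q q′} {A B : Set} → (q < q′ × A) ⊎ (q′ < q × B) → q < q′ ⊎ q′ < q
      order (inj₁ (lt , _)) = inj₁ lt
      order (inj₂ (lt , _)) = inj₂ lt

    even′ : ∀ t q q′ → Agree (act t p u) q q′ → 2 ℕ∣.∣ common (extend t p Z L q) (extend t p Z L q′)
    even′ elbow    q q′ ag = even q q′ ag
    even′ crossing q q′ ag with s n p q ℤₚ.≟ q′
    ... | no sw = subst (2 ℕ∣.∣_) (sym (common-apart q q′ (apart (order ag)) sw)) (even _ _ (agree-apart sw ag))
    -- The exchanged pair gains one common crossing and changes the relative order of its labels, so
    -- parity and order flip together.
    ... | yes refl = subst (2 ℕ∣.∣_) (sym (common-swapped q λ e → apart (order ag) (sym e)))
                       (2∤⇒2∣suc _ (odd _ _ (agree-swapped q ag)))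

    odd′ : ∀ t q q′ → Disagree (act t p u) q q′ → ¬ (2 ℕ∣.∣ common (extend t p Z L q) (extend t p Z L q′))
    odd′ elbow    q q′ dis = odd q q′ dis
    odd′ crossing q q′ dis with s n p q ℤₚ.≟ q′
    ... | no sw = odd _ _ (disagree-apart sw dis) ∘ subst (2 ℕ∣.∣_) (common-apart q q′ (apart (order dis)) sw)
    ... | yes refl = λ d → 2∣suc⇒2∤ _ (subst (2 ℕ∣.∣_) (common-swapped q λ e → apart (order dis) (sym e)) d) (even _ _ (disagree-swapped q dis))

    state′ : State Z′ (act (T (box Z p)) p u) (extend (T (box Z p)) p Z L)
    state′ = record
      { cut       = bump-cut cut c
      ; below     = λ q → ℤₚ.≤-trans (below q) (bump-≥ p Z q)
      ; labelling = act-labelling (T (box Z p)) p labelling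
      ; through   = through′ (T (box Z p)) refl
      ; unique    = unique′ (T (box Z p)) refl
      ; passed    = passed′ (T (box Z p))
      ; even      = even′ (T (box Z p))
      ; odd       = odd′ (T (box Z p))
      }

-- Comparing cardinalities of setoids

injection⇒≤ : ∀ {A B : Setoid 0ℓ 0ℓ} {a b} (h : Setoid.Carrier A → Setoid.Carrier B) →
  (∀ {x y} → Setoid._≈_ B (h x) (h y) → Setoid._≈_ A x y) → HasCardinality A a → HasCardinality B b → a ℕ.≤ b
injection⇒≤ {A} {B} h h-injective φ ψ = Finₚ.injective⇒≤ {f = λ j → proj₁ (index j)} λ {x} {y} e →
  Bijection.injective φ (h-injective (Setoid.trans B (Setoid.sym B (proj₂ (index x))) (Setoid.trans B (Bijection.cong ψ e) (proj₂ (index y)))))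
  where
  index : ∀ j → ∃ λ j′ → Setoid._≈_ B (Bijection.to ψ j′) (h (Bijection.to φ j))
  index j = let j′ , e = Bijection.surjective ψ (h (Bijection.to φ j)) in j′ , e refl

cardinality-unique : ∀ {S : Setoid 0ℓ 0ℓ} {a b} → HasCardinality S a → HasCardinality S b → a ≡ b
cardinality-unique {S} φ ψ = ℕₚ.≤-antisym (injection⇒≤ {S} {S} (λ x → x) (λ e → e) φ ψ) (injection⇒≤ {S} {S} (λ x → x) (λ e → e) ψ φ)

-- Deograms as distinguished subwords of a sweeping word

module _ (n : ℕ) (2≤n : 2 ℕ.≤ n) (k : ℕ) where
  open Words n 2≤n

  -- The final labels are indexed by southern edges and name northern ones, so they form the inverse
  -- of the strand permutation; `exits` says this without naming an inverse of f.
  record WordDeogram {N} (r : ℤ) (f : ℤ → ℤ) (w : Vec ℤ N) : Set where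
    field
      tiles         : Vec Tile N
      distinguished : Distinguished (λ q → q - + k) w tiles
      exits         : ∀ j → final (λ q → q - + k) w tiles (f j) ≡ j
      count         : r ≡ + elbows tiles

  WordDeograms : ∀ {N} → ℤ → (ℤ → ℤ) → Vec ℤ N → Setoid 0ℓ 0ℓ
  WordDeograms {N} r f w = On.setoid {B = WordDeogram r f w} (setoid (Vec Tile N)) WordDeogram.tiles

-- Reading a filling along a sweep

module Encoding (n : ℕ) .{{_ : NonZero n}} (k : ℕ) (2≤n : 2 ℕ.≤ n) (P : Vec Step n) (isPath : IsLatticePath k P) where
  open Words n 2≤n
  open Cuts n 2≤n (+ n - + k)
  open Strip n k 2≤n P isPath

  private
    v : Point
    v = period n k

  read : ∀ {N} → (Point → Tile) → (ℤ → ℤ) → Vec ℤ N → Vec Tile N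
  read T Z []      = []
  read T Z (p ∷ w) = T (box Z p) ∷ read T (bump p Z) w

  module Reading (T : Point → Tile) (per : IsPeriodicFilling k P T) where
    open Tracing n k 2≤n P isPath T per

    private
      unfinished : ∀ {N Z p} {w : Vec ℤ N} → Sweep (bump p Z) south w → Z p < south p
      unfinished {Z = Z} {p} sw = ℤₚ.<-≤-trans (subst (Z p <_) (sym on) (a<a+1 (Z p))) (sweep-≤ sw p)
        where
        on : bump p Z p ≡ Z p + 1ℤ
        on = bump-on p Z (≡⇒∣ p 0ℤ (sym (ℤₚ.+-identityʳ p)))

      at-0 : ∀ p → p ≡ p + 0ℤ * + n
      at-0 p = sym (ℤₚ.+-identityʳ p)

    run : ∀ {N Z u L} {w : Vec ℤ N} → Sweep Z south w → State Z u L →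
      ∃₂ λ Z′ L′ → (∀ q → Z′ q ≡ south q) × State Z′ (final u w (read T Z w)) L′
    run (done eq)    st = _ , _ , eq , st
    run (flip c sw) st = run sw (Flip.state′ st c (unfinished sw))

    private
      edge-cong : ∀ {Z Z′} → (∀ q → Z q ≡ Z′ q) → ∀ q → edge Z q ≡ edge Z′ q
      edge-cong eq q = cong₂ (λ a b → stepBetween a b , (a , q - 1ℤ - a)) (eq _) (eq q)

    module _ {N} {w : Vec ℤ N} (sw : Sweep north south w) {f : ℤ → ℤ} where

      read-exits : HasStrandPermutation k P T f → ∀ j → final (λ q → q - + k) w (read T north w) (f j) ≡ j
      read-exits perm j =
        let _ , _ , eq , st = run sw initial
        in sym (proj₁ (State.unique st (f j) (perm j) (trans (sym (edge-south (f j))) (sym (edge-cong eq (f j))))))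

      exits-read : (∀ j → final (λ q → q - + k) w (read T north w) (f j) ≡ j) → HasStrandPermutation k P T f
      exits-read exits j =
        let _ , _ , eq , st = run sw initial
        in subst₂ (Strand k P T) (exits j) (trans (edge-cong eq (f j)) (edge-south (f j))) (proj₁ (State.through st (f j)))

    private
      nothing-between : ∀ {Z b} {A : Set} → (∀ q → Z q ≡ south q) → Between Z south b → A
      nothing-between eq (le , lt) =
        contradiction (ℤₚ.<-≤-trans lt (ℤₚ.≤-trans (ℤₚ.≤-reflexive (sym (eq _))) le)) (ℤₚ.<-irrefl refl)

      -- The distinguished condition makes the mutual crossings of the traced strands even, while
      -- decreasing labels would make them odd.
      ordered : IsDistinguished k P T → ∀ {Z u L p} (st : State Z u L) (c : Corner Z p) → Z p < south p →
        T (box Z p) ≡ elbow → u p < u (p + 1ℤ)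
      ordered dist {Z} {u} {L} {p} st c lt t = decide (ℤₚ.<-cmp (u p) (u (p + 1ℤ)))
        where
        open State st
        σ : Through (u p) (left (box Z p)) (L p)
        σ = subst (λ e → Through (u p) e (L p)) (edge-left c) (through p)
        τ : Through (u (p + 1ℤ)) (top (box Z p)) (L (p + 1ℤ))
        τ = subst (λ e → Through (u (p + 1ℤ)) e (L (p + 1ℤ))) (edge-top c) (through (p + 1ℤ))
        even-crossings : 2 ℕ∣.∣ common (L p) (L (p + 1ℤ))
        even-crossings = subst₂ (λ x y → 2 ℕ∣.∣ common x y) (proj₂ σ) (proj₂ τ)
          (dist (box Z p) _ _ (subst (InStrip k P ∘ box Z) (sym (at-0 p)) (Flip.inStrip-box st c lt 0ℤ)) t (proj₁ σ) (proj₁ τ))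
        decide : Tri (u p < u (p + 1ℤ)) (u p ≡ u (p + 1ℤ)) (u (p + 1ℤ) < u p) → u p < u (p + 1ℤ)
        decide (tri< lt _ _) = lt
        decide (tri≈ _ e _)  = contradiction (Labelling.injective labelling e) (ℤₚ.<⇒≢ (a<a+1 p))
        decide (tri> _ _ gt) = contradiction even-crossings (odd p (p + 1ℤ) (inj₁ (a<a+1 p , gt)))

      even-at : ∀ {Z u L p} (st : State Z u L) (c : Corner Z p) → Z p < south p →
        (T (box Z p) ≡ elbow → u p < u (p + 1ℤ)) → ∀ m {b i j} → b ≡ box Z (p + m * + n) → T b ≡ elbow →
        (σ : Strand k P T i (left b)) (τ : Strand k P T j (top b)) → 2 ℕ∣.∣ common (crossingsOn σ) (crossingsOn τ)
      even-at {Z} {u} {L} {p} st c lt d m refl t σ τ =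
        subst₂ (λ x y → 2 ℕ∣.∣ common x y) (sym eσ) (sym eτ) (even q q⁺ (inj₁ (q<q⁺ , uq<uq⁺)))
        where
        open State st
        q q⁺ : ℤ
        q  = p + m * + n
        q⁺ = p + 1ℤ + m * + n
        q<q⁺ : q < q⁺
        q<q⁺ = ℤₚ.+-monoˡ-< (m * + n) (a<a+1 p)
        uq<uq⁺ : u q < u q⁺
        uq<uq⁺ = subst₂ _<_ (sym (Labelling.periodic labelling p m)) (sym (Labelling.periodic labelling (p + 1ℤ) m))
               (ℤₚ.+-monoˡ-< (m * + n) (d (trans (sym (Flip.tile-box st c lt m)) t)))
        eσ : crossingsOn σ ≡ L q
        eσ = proj₂ (unique q σ (sym (edge-left (Flip.cornerAt st c lt m))))
        eτ : crossingsOn τ ≡ L q⁺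
        eτ = proj₂ (unique q⁺ τ (sym (Flip.edge-top′ st c lt m)))

    read-distinguished : IsDistinguished k P T → ∀ {N Z u L} {w : Vec ℤ N} → Sweep Z south w → State Z u L →
      Distinguished u w (read T Z w)
    read-distinguished dist (done eq)   st = []
    read-distinguished dist (flip c sw) st =
      ordered dist st c (unfinished sw) ∷ read-distinguished dist sw (Flip.state′ st c (unfinished sw))

    -- Every box of the region is a translate of a box swept by some letter. There the uniqueness of
    -- traced strands identifies the crossings of σ and τ with the recorded lists.
    distinguished-read : ∀ {N Z u L} {w : Vec ℤ N} → Sweep Z south w → State Z u L →
      Distinguished u w (read T Z w) → ∀ b {i j} → Between Z south b → T b ≡ elbow →
      (σ : Strand k P T i (left b)) (τ : Strand k P T j (top b)) → 2 ℕ∣.∣ common (crossingsOn σ) (crossingsOn τ)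
    distinguished-read {Z = Z} (done eq) st [] b btw t σ τ = nothing-between {Z} {b} eq btw
    distinguished-read {Z = Z} (flip {p = p} c sw) st (d ∷ ds) b btw t σ τ = split (between-split {Z} {south} p b btw)
      where
      split : (∃ λ m → b ≡ box Z (p + m * + n)) ⊎ Between (bump p Z) south b → 2 ℕ∣.∣ common (crossingsOn σ) (crossingsOn τ)
      split (inj₁ (m , e)) = even-at st c (unfinished sw) d m e t σ τ
      split (inj₂ btw′)    = distinguished-read sw (Flip.state′ st c (unfinished sw)) ds b btw′ t σ τ

    -- Representatives of the elbow classes modulo the period, collected flip by flip, so that
    -- counting elbow letters counts these classes.
    record Enumeration (Z : ℤ → ℤ) (m : ℕ) : Set where
      field
        list       : Fin m → Point
        between    : ∀ j → Between Z south (list j)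
        isElbow    : ∀ j → T (list j) ≡ elbow
        distinct   : ∀ {j j′} a → list j′ ≡ list j ⊕ a ⊛ v → j ≡ j′
        exhaustive : ∀ b → Between Z south b → T b ≡ elbow → ∃₂ λ j a → b ≡ list j ⊕ a ⊛ v

    private
      between-unbump : ∀ {Z} p {b} → Between (bump p Z) south b → Between Z south b
      between-unbump {Z} p {b} (le , lt) = ℤₚ.≤-trans (bump-≥ p Z _) le , lt

      ⊕-back : ∀ b b′ a → b′ ≡ b ⊕ a ⊛ v → b ≡ b′ ⊕ (- a) ⊛ v
      ⊕-back (x , y) _ a refl = cong₂ _,_ (lem x a (+ n - + k)) (lem y a (+ k))
        where
        lem : ∀ x a d → x ≡ x + a * d + (- a) * d
        lem = solve-∀

      -- A swept box and its translates lie behind the bumped cut, so no later letter lists this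
      -- class again.
      box-swept : ∀ {Z p} → Cut Z → ∀ {b a} → Between (bump p Z) south b → b ≢ box Z p ⊕ a ⊛ v
      box-swept {Z} {p} cut {b} {a} btw e =
        ℤₚ.<⇒≱ (a<a+1 (Z q)) (subst (_≤ Z q) (trans (cong (bump p Z) (diag-box Z q)) (bump-at p Z a)) le)
        where
        q : ℤ
        q = p + a * + n
        le : bump p Z (diag (box Z q)) ≤ Z q
        le = proj₁ (subst (Between (bump p Z) south) (trans e (sym (box-periodic cut p a))) btw)

    enumeration : ∀ {N Z} {w : Vec ℤ N} → (∀ q → north q ≤ Z q) → Cut Z → Sweep Z south w → Enumeration Z (elbows (read T Z w))
    enumeration below cut (done eq) = record
      { list = λ () ; between = λ () ; isElbow = λ () ; distinct = λ { {()} }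
      ; exhaustive = λ b btw _ → nothing-between {_} {b} eq btw
      }
    enumeration {Z = Z} below cut (flip {p = p} {w = w} c sw) = extendBy (T (box Z p)) refl
      where
      rest : Enumeration (bump p Z) (elbows (read T (bump p Z) w))
      rest = enumeration (λ q → ℤₚ.≤-trans (below q) (bump-≥ p Z q)) (bump-cut cut c) sw
      open Enumeration rest
      btw : Between Z south (box Z p)
      btw = ℤₚ.≤-reflexive (cong Z (diag-box Z p)) , subst (λ z → Z p < south z) (sym (diag-box Z p)) (unfinished sw)
      btwN : Between north south (box Z p)
      btwN = ℤₚ.≤-trans (below _) (proj₁ btw) , proj₂ btw
      tile-at : ∀ m → T (box Z (p + m * + n)) ≡ T (box Z p)
      tile-at m = trans (cong T (box-periodic cut p m)) (filling-periodic per (box Z p) m btwN)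
      extendBy : ∀ t → T (box Z p) ≡ t → Enumeration Z (weight t ℕ.+ elbows (read T (bump p Z) w))
      extendBy crossing t = record
        { list       = list
        ; between    = λ j → between-unbump p (between j)
        ; isElbow    = isElbow
        ; distinct   = distinct
        ; exhaustive = exhaustive′
        }
        where
        exhaustive′ : ∀ b → Between Z south b → T b ≡ elbow → ∃₂ λ j a → b ≡ list j ⊕ a ⊛ v
        exhaustive′ b btw e = split (between-split {Z} {south} p b btw)
          where
          split : (∃ λ m → b ≡ box Z (p + m * + n)) ⊎ Between (bump p Z) south b → ∃₂ λ j a → b ≡ list j ⊕ a ⊛ v
          split (inj₁ (m , e′)) = contradiction (trans (sym t) (trans (sym (tile-at m)) (trans (cong T (sym e′)) e))) λ ()
          split (inj₂ btw′)     = exhaustive b btw′ e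
      extendBy elbow t = record
        { list       = list′
        ; between    = λ { Fin.zero → btw ; (Fin.suc j) → between-unbump p (between j) }
        ; isElbow    = λ { Fin.zero → t ; (Fin.suc j) → isElbow j }
        ; distinct   = λ {j} {j′} → distinct′ j j′
        ; exhaustive = exhaustive′
        }
        where
        list′ : Fin (suc (elbows (read T (bump p Z) w))) → Point
        list′ Fin.zero    = box Z p
        list′ (Fin.suc j) = list j
        distinct′ : ∀ j j′ a → list′ j′ ≡ list′ j ⊕ a ⊛ v → j ≡ j′
        distinct′ Fin.zero    Fin.zero     a e = refl
        distinct′ Fin.zero    (Fin.suc j′) a e = contradiction e (box-swept cut {a = a} (between j′))
        distinct′ (Fin.suc j) Fin.zero     a e = contradiction (⊕-back (list j) (box Z p) a e) (box-swept cut {a = - a} (between j))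
        distinct′ (Fin.suc j) (Fin.suc j′) a e = cong Fin.suc (distinct a e)
        exhaustive′ : ∀ b → Between Z south b → T b ≡ elbow → ∃₂ λ j a → b ≡ list′ j ⊕ a ⊛ v
        exhaustive′ b btw e = split (between-split {Z} {south} p b btw)
          where
          split : (∃ λ m → b ≡ box Z (p + m * + n)) ⊎ Between (bump p Z) south b → ∃₂ λ j a → b ≡ list′ j ⊕ a ⊛ v
          split (inj₁ (m , e′)) = Fin.zero , m , trans e′ (box-periodic cut p m)
          split (inj₂ btw′)     = let j , a , e′ = exhaustive b btw′ e in Fin.suc j , a , e′

    cardinality : ∀ {N} {w : Vec ℤ N} → Sweep north south w → HasCardinality (Elbows k P T) (elbows (read T north w))
    cardinality sw = record
      { to        = λ j → list j , inStrip⁺ _ (between j) , isElbow j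
      ; cong      = λ { refl → Setoid.refl (ModTranslation v) }
      ; bijective = (λ (a , e) → distinct a e) , λ (b , b∈ , t) →
          let j , a , e = exhaustive b (inStrip⁻ b b∈) t in j , λ { refl → a , e }
      }
      where open Enumeration (enumeration (λ _ → ℤₚ.≤-refl) north-cut sw)

-- Rebuilding a filling from a word

module Decoding (n : ℕ) .{{_ : NonZero n}} (k : ℕ) (2≤n : 2 ℕ.≤ n) (P : Vec Step n) (isPath : IsLatticePath k P) where
  open Words n 2≤n
  open Cuts n 2≤n (+ n - + k)
  open Strip n k 2≤n P isPath
  open Encoding n k 2≤n P isPath

  private
    v : Point
    v = period n k

  fill : ∀ {N} → (ℤ → ℤ) → Vec ℤ N → Vec Tile N → Point → Tile
  -- A box met by no letter receives a crossing; the choice is free because 𝒜 compares fillings on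
  -- the strip only.
  fill Z []      []      c = crossing
  fill Z (p ∷ w) (t ∷ τ) c with + n ∣? (diag c - p) | Z (diag c) ℤₚ.≟ proj₁ c
  ... | yes _ | yes _ = t
  ... | yes _ | no  _ = fill (bump p Z) w τ c
  ... | no  _ | _     = fill (bump p Z) w τ c

  fill-here : ∀ {N} Z p (w : Vec ℤ N) t τ c → + n ∣ diag c - p → Z (diag c) ≡ proj₁ c → fill Z (p ∷ w) (t ∷ τ) c ≡ t
  fill-here Z p w t τ c h e with + n ∣? (diag c - p) | Z (diag c) ℤₚ.≟ proj₁ c
  ... | yes _ | yes _ = refl
  ... | yes _ | no ne = contradiction e ne
  ... | no ¬h | _     = contradiction h ¬h

  fill-later : ∀ {N} Z p (w : Vec ℤ N) t τ c → bump p Z (diag c) ≤ proj₁ c → fill Z (p ∷ w) (t ∷ τ) c ≡ fill (bump p Z) w τ c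
  fill-later Z p w t τ c le = go (+ n ∣? (diag c - p)) (Z (diag c) ℤₚ.≟ proj₁ c)
    where
    go : Dec (+ n ∣ diag c - p) → Dec (Z (diag c) ≡ proj₁ c) → fill Z (p ∷ w) (t ∷ τ) c ≡ fill (bump p Z) w τ c
    go (yes h) (yes e) = contradiction (subst (_≤ proj₁ c) (trans (bump-on p Z h) (cong (_+ 1ℤ) e)) le) (ℤₚ.<⇒≱ (a<a+1 _))
    go (yes h) (no ne) with + n ∣? (diag c - p) | Z (diag c) ℤₚ.≟ proj₁ c
    ... | yes _ | yes e = contradiction e ne
    ... | yes _ | no  _ = refl
    ... | no  _ | _     = refl
    go (no ¬h) _ with + n ∣? (diag c - p) | Z (diag c) ℤₚ.≟ proj₁ c
    ... | yes h | _     = contradiction h ¬h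
    ... | no  _ | _     = refl

  private
    diag-⊕v : ∀ c → diag (c ⊕ v) ≡ diag c + 1ℤ * + n
    diag-⊕v (x , y) = lem x y (+ n) (+ k)
      where
      lem : ∀ x y N K → x + (N - K) + (y + K) + 1ℤ ≡ x + y + 1ℤ + 1ℤ * N
      lem = solve-∀

    ∣⊕v : ∀ c p → + n ∣ diag c - p → + n ∣ diag (c ⊕ v) - p
    ∣⊕v c p h = subst (+ n ∣_) (trans (lem (diag c) p (+ n)) (cong (_- p) (sym (diag-⊕v c)))) (∣m∣n⇒∣m+n h (divides 1ℤ refl))
      where
      lem : ∀ a p N → a - p + 1ℤ * N ≡ a + 1ℤ * N - p
      lem = solve-∀

    ∣⊕v⁻ : ∀ c p → + n ∣ diag (c ⊕ v) - p → + n ∣ diag c - p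
    ∣⊕v⁻ c p h = ∣-shift (diag c) p 1ℤ (subst (λ z → + n ∣ z - p) (diag-⊕v c) h)

  -- Both tests made by `fill` are invariant under the period, so the result is periodic on the
  -- whole plane.
  fill-periodic : ∀ {N Z} {w : Vec ℤ N} {Y} τ → Cut Z → Sweep Z Y w → ∀ c → fill Z w τ (c ⊕ v) ≡ fill Z w τ c
  fill-periodic []      cut (done _) c = refl
  fill-periodic {Z = Z} (t ∷ τ) cut (flip {p = p} {w = w} cn sw) c
    with + n ∣? (diag c - p) | Z (diag c) ℤₚ.≟ proj₁ c | + n ∣? (diag (c ⊕ v) - p) | Z (diag (c ⊕ v)) ℤₚ.≟ proj₁ (c ⊕ v)
  ... | yes _ | yes _ | yes _ | yes _ = refl
  ... | yes _ | yes e | yes _ | no ne = contradiction (Zeq e) ne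
    where
    Zeq : Z (diag c) ≡ proj₁ c → Z (diag (c ⊕ v)) ≡ proj₁ (c ⊕ v)
    Zeq e = trans (cong Z (diag-⊕v c)) (trans (Cut.periodic cut (diag c) 1ℤ) (cong₂ _+_ e (ℤₚ.*-identityˡ _)))
  ... | yes h | yes _ | no ¬h | _     = contradiction (∣⊕v c p h) ¬h
  ... | yes _ | no ne | yes _ | yes e = contradiction (+-cancelʳ (+ n - + k) (trans (trans (cong (λ z → Z (diag c) + z) (sym (ℤₚ.*-identityˡ _))) (sym (trans (cong Z (diag-⊕v c)) (Cut.periodic cut (diag c) 1ℤ)))) e)) ne
  ... | yes _ | no _  | yes _ | no _  = fill-periodic τ (bump-cut cut cn) sw c
  ... | yes _ | no _  | no _  | _     = fill-periodic τ (bump-cut cut cn) sw c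
  ... | no ¬h | _     | yes h | yes _ = contradiction (∣⊕v⁻ c p h) ¬h
  ... | no _  | _     | yes _ | no _  = fill-periodic τ (bump-cut cut cn) sw c
  ... | no _  | _     | no _  | _     = fill-periodic τ (bump-cut cut cn) sw c

  -- T stays fixed while the word is consumed, so it is only required to agree with `fill` on boxes
  -- not behind Z; this survives each flip.
  read-fill : ∀ {N T} Z (w : Vec ℤ N) τ → (∀ c → Z (diag c) ≤ proj₁ c → T c ≡ fill Z w τ c) → read T Z w ≡ τ
  read-fill Z []      []      h = refl
  read-fill {T = T} Z (p ∷ w) (t ∷ τ) h = cong₂ _∷_
    (trans (h (box Z p) (ℤₚ.≤-reflexive Zp)) (fill-here Z p w t τ (box Z p) (≡⇒∣ p 0ℤ (trans (diag-box Z p) (sym (ℤₚ.+-identityʳ p)))) Zp))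
    (read-fill (bump p Z) w τ λ c le → trans (h c (ℤₚ.≤-trans (bump-≥ p Z _) le)) (fill-later Z p w t τ c le))
    where
    Zp : Z (diag (box Z p)) ≡ Z p
    Zp = cong Z (diag-box Z p)

  fill-read : ∀ {N T Z} {w : Vec ℤ N} → IsPeriodicFilling k P T → Cut Z → (∀ q → north q ≤ Z q) → Sweep Z south w →
    ∀ c → Between Z south c → fill Z w (read T Z w) c ≡ T c
  fill-read per cut below (done eq) c (le , lt) =
    contradiction (ℤₚ.<-≤-trans lt (ℤₚ.≤-trans (ℤₚ.≤-reflexive (sym (eq _))) le)) (ℤₚ.<-irrefl refl)
  fill-read {T = T} {Z} per cut below (flip {p = p} {w = w} cn sw) c btw = split (between-split {Z} {south} p c btw)
    where
    lem : ∀ p m N → p ≡ p + m * N + (- m) * N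
    lem = solve-∀
    btw₀ : ∀ m → c ≡ box Z (p + m * + n) → Between Z south (box Z p)
    btw₀ m e = subst (Between Z south) (sym (trans (cong (box Z) (lem p m (+ n))) (box-periodic cut (p + m * + n) (- m))))
             (between-periodic cut south-cut (box Z (p + m * + n)) (- m) (subst (Between Z south) e btw))
    btwN : ∀ m → c ≡ box Z (p + m * + n) → Between north south (box Z p)
    btwN m e = ℤₚ.≤-trans (below _) (proj₁ (btw₀ m e)) , proj₂ (btw₀ m e)
    split : (∃ λ m → c ≡ box Z (p + m * + n)) ⊎ Between (bump p Z) south c → fill Z (p ∷ w) (read T Z (p ∷ w)) c ≡ T c
    split (inj₂ btw′) = trans (fill-later Z p w _ _ c (proj₁ btw′))
      (fill-read per (bump-cut cut cn) (λ q → ℤₚ.≤-trans (below q) (bump-≥ p Z q)) sw c btw′)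
    split (inj₁ (m , e)) = trans (cong (fill Z (p ∷ w) (read T Z (p ∷ w))) e) (trans
      (fill-here Z p w _ _ (box Z (p + m * + n)) (≡⇒∣ p m (diag-box Z _)) (cong Z (diag-box Z _)))
      (sym (trans (cong T (trans e (box-periodic cut p m))) (filling-periodic per (box Z p) m (btwN m e)))))

  module _ {N} {w : Vec ℤ N} (sw : Sweep north south w) {r : ℤ} {f : ℤ → ℤ} where

    encode : AffineDeogram k r f P → WordDeogram n 2≤n k r f w
    encode D = record
      { tiles         = read (tile D) north w
      ; distinguished = read-distinguished (AffineDeogram.distinguished D) sw initial
      ; exits         = read-exits sw (AffineDeogram.strandPermutation D)
      ; count         = let m , e , card = AffineDeogram.elbowCount D in
                        trans e (cong +_ (cardinality-unique {Elbows k P (tile D)} card (cardinality sw)))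
      }
      where
      open Reading (tile D) (AffineDeogram.periodic D)
      open Tracing n k 2≤n P isPath (tile D) (AffineDeogram.periodic D) using (initial)

    decode : WordDeogram n 2≤n k r f w → AffineDeogram k r f P
    decode W = record
      { tile              = T
      ; periodic          = per
      ; strandPermutation = exits-read sw (subst (λ τ → ∀ j → final (λ q → q - + k) w τ (f j) ≡ j) (sym reads) exits)
      ; distinguished     = λ c i j c∈ t σ τ → distinguished-read sw initial
          (subst (Distinguished (λ q → q - + k) w) (sym reads) distinguished) c (inStrip⁻ c c∈) t σ τ
      ; elbowCount        = _ , trans count (cong (+_ ∘ elbows) (sym reads)) , cardinality sw
      }
      where
      open WordDeogram W
      T : Point → Tile
      T = fill north w tiles
      per : IsPeriodicFilling k P T
      per c _ = fill-periodic tiles north-cut sw c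
      reads : read T north w ≡ tiles
      reads = read-fill north w tiles λ _ _ → refl
      open Reading T per
      open Tracing n k 2≤n P isPath T per using (initial)

    encoding : Inverse (𝒜 k r f P) (WordDeograms n 2≤n k r f w)
    encoding = record
      { to        = encode
      ; from      = decode
      ; to-cong   = λ {D} {E} D≈E → read-cong D E D≈E
      ; from-cong = λ e c _ → cong (λ τ → fill north w τ c) e
      ; inverse   = (λ {W} {D} D≈ → trans (read-cong D (decode W) D≈) (read-fill north w _ λ _ _ → refl))
                  , (λ {D} {W} e c c∈ → trans (cong (λ τ → fill north w τ c) e)
                      (fill-read (AffineDeogram.periodic D) north-cut (λ _ → ℤₚ.≤-refl) sw c (inStrip⁻ c c∈)))
      }
      where
      read-agree : ∀ {N Z T T′} {w : Vec ℤ N} → (∀ q → north q ≤ Z q) → Sweep Z south w →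
        (∀ c → InStrip k P c → T c ≡ T′ c) → read T Z w ≡ read T′ Z w
      read-agree below (done _) h = refl
      read-agree {Z = Z} below (flip {p = p} _ sw) h = cong₂ _∷_
        (h (box Z p) (inStrip⁺ (box Z p) (ℤₚ.≤-trans (below _) (ℤₚ.≤-reflexive (cong Z (diag-box Z p))) ,
          subst (λ z → Z p < south z) (sym (diag-box Z p)) (+1≤⇒< (subst (_≤ south p) (bump-on p Z (≡⇒∣ p 0ℤ (sym (ℤₚ.+-identityʳ p)))) (sweep-≤ sw p))))))
        (read-agree (λ q → ℤₚ.≤-trans (below q) (bump-≥ p Z q)) sw h)
      read-cong : ∀ (D E : AffineDeogram k r f P) → (∀ c → InStrip k P c → tile D c ≡ tile E c) → read (tile D) north w ≡ read (tile E) north w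
      read-cong D E = read-agree (λ _ → ℤₚ.≤-refl) sw

-- Length comparisons as order conditions on f

module Lengths (n : ℕ) .{{_ : NonZero n}} (2≤n : 2 ℕ.≤ n) (i : ℤ) where
  open Words n 2≤n
  open Shifting i using (S)

  affine-labelling : ∀ {f} → IsAffinePermutation n f → Labelling f
  affine-labelling {f} aff = record
    { periodic  = λ q → ℤ-ind {Q = λ m → f (q + m * + n) ≡ f q + m * + n}
        (trans (cong f (ℤₚ.+-identityʳ q)) (sym (ℤₚ.+-identityʳ (f q))))
        (λ m e → trans (next q m) (trans (cong (_+ + n) e) (sym (lem (f q) m (+ n)))))
        (λ m e → +-cancelʳ (+ n) (trans (sym (next q m)) (trans e (lem (f q) m (+ n)))))
    ; injective = proj₁ bijective
    }
    where
    open IsAffinePermutation aff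
    lem : ∀ q m N → q + (m + 1ℤ) * N ≡ q + m * N + N
    lem = solve-∀
    next : ∀ q m → f (q + (m + 1ℤ) * + n) ≡ f (q + m * + n) + + n
    next q m = trans (cong f (lem q m (+ n))) (periodic (q + m * + n))

  s-increases : ∀ {a b} → a < b → S a ≡ b → ∃ λ m → a ≡ i + m * + n × b ≡ i + 1ℤ + m * + n
  s-increases {a} {b} a<b e = go (residue i a)
    where
    go : Residue i a → ∃ λ m → a ≡ i + m * + n × b ≡ i + 1ℤ + m * + n
    go (at m e′)    = m , e′ , trans (sym e) (trans (cong S e′) (s-at i m))
    go (after m e′) = contradiction a<b (ℤₚ.<-asym (subst₂ _<_ (trans (sym (trans (cong S e′) (s-after i m))) e) (sym e′) (ℤₚ.+-monoˡ-< (m * + n) (a<a+1 i))))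
    go (away h h′)  = contradiction (trans (sym (s-away i h h′)) e) (ℤₚ.<⇒≢ a<b)

  S-i : S i ≡ i + 1ℤ
  S-i = s-at′ i (≡⇒∣ i 0ℤ (sym (ℤₚ.+-identityʳ i)))

  S-i+1 : S (i + 1ℤ) ≡ i
  S-i+1 = trans (cong S (sym S-i)) (s-involutive i i)

  -- Suppose b < a. `S` reverses only pairs of values i+mn and i+1+mn, and f takes the larger of
  -- them at the smaller position. Hence every inversion of `f · S` is already an inversion of f,
  -- which contradicts the lengths.
  shorter-values : ∀ {f} → Labelling f → Shorter n f (f · S) → ∀ {a b} → f a ≡ i → f b ≡ i + 1ℤ → a < b
  shorter-values {f} lab (ℓ , ℓ′ , card , card′ , ℓ<ℓ′) {a} {b} fa fb = decide (ℤₚ.<-cmp a b)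
    where
    open Labelling lab
    module _ (b<a : b < a) where
      still : ∀ {a′ b′} → a′ < b′ → S (f b′) < S (f a′) → f b′ < f a′
      still {a′} {b′} a′<b′ lt = go (ℤₚ.<-cmp (f a′) (f b′))
        where
        locate : ∀ {c x x′} m → f x ≡ c → f x′ ≡ c + m * + n → x′ ≡ x + m * + n
        locate {x = x} m e e′ = injective (trans e′ (trans (cong (_+ m * + n) (sym e)) (sym (periodic x m))))
        absurd : ∀ m → f a′ ≡ i + m * + n → f b′ ≡ i + 1ℤ + m * + n → b′ < a′
        absurd m e e′ = subst₂ _<_ (sym (locate m fb e′)) (sym (locate m fa e)) (ℤₚ.+-monoˡ-< (m * + n) b<a)
        go : Tri (f a′ < f b′) (f a′ ≡ f b′) (f b′ < f a′) → f b′ < f a′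
        go (tri> _ _ gt) = gt
        go (tri≈ _ e _)  = contradiction (injective e) (ℤₚ.<⇒≢ a′<b′)
        go (tri< lt′ _ _) with S (f a′) ℤₚ.≟ f b′
        ... | no ne = contradiction lt (ℤₚ.<-asym (s-mono-< i lt′ ne))
        ... | yes e = let m , e₁ , e₂ = s-increases lt′ e in contradiction (absurd m e₁ e₂) (ℤₚ.<-asym a′<b′)
      include : Σ (ℤ × ℤ) (IsInversion n (f · S)) → Σ (ℤ × ℤ) (IsInversion n f)
      include ((a′ , b′) , l , u , lt , inv) = (a′ , b′) , l , u , lt , still lt inv
    decide : Tri (a < b) (a ≡ b) (b < a) → a < b
    decide (tri< lt _ _) = lt
    decide (tri≈ _ e _)  = contradiction (trans (sym fa) (trans (cong f e) fb)) (ℤₚ.<⇒≢ (a<a+1 i))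
    decide (tri> _ _ gt) = contradiction ℓ<ℓ′ (ℕₚ.≤⇒≯ (injection⇒≤ {Inversions n (f · S)} {Inversions n f} (include gt) (λ e → e) card′ card))

  private
    window-unique : ∀ {a a′} m → 1ℤ ≤ a → a ≤ + n → 1ℤ ≤ a′ → a′ ≤ + n → a ≡ a′ + m * + n → a ≡ a′
    window-unique {+ suc x} {+ suc x′} m (+≤+ _) (+≤+ x<n) (+≤+ _) (+≤+ x′<n) e =
      cong (λ z → + suc z) (trans (sym (%ℕ-unique n 0ℤ x<n (sym (ℤₚ.+-identityʳ (+ x)))))
        (%ℕ-unique n m x′<n (trans (lem (+ x)) (trans (cong (_- 1ℤ) e) (lem′ (+ x′) (m * + n))))))
      where
      lem : ∀ x → x ≡ 1ℤ + x - 1ℤ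
      lem = solve-∀
      lem′ : ∀ x M → 1ℤ + x + M - 1ℤ ≡ x + M
      lem′ = solve-∀
    window-unique {+ zero}         m (+≤+ ()) _ _ _ _
    window-unique {+ suc _} {+ zero} m _ _ (+≤+ ()) _ _

    turns : ℤ → ℤ
    turns a = (a - 1ℤ) /ℕ n

    normalise : ℤ → ℤ → ℤ
    normalise w a = a + (- w) * + n

    normalise-window : ∀ a → 1ℤ ≤ normalise (turns a) a × normalise (turns a) a ≤ + n
    normalise-window a = subst (λ z → 1ℤ ≤ z × z ≤ + n) (sym eq) (+≤+ (ℕ.s≤s ℕ.z≤n) , +≤+ (n%ℕd<d (a - 1ℤ) n))
      where
      lem : ∀ a w N → a + (- w) * N ≡ a - 1ℤ + 1ℤ + (- w) * N
      lem = solve-∀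
      lem′ : ∀ r w N → r + w * N + 1ℤ + (- w) * N ≡ 1ℤ + r
      lem′ = solve-∀
      eq : normalise (turns a) a ≡ + suc ((a - 1ℤ) %ℕ n)
      eq = trans (lem a (turns a) (+ n)) (trans (cong (λ z → z + 1ℤ + (- turns a) * + n) (a≡a%ℕn+[a/ℕn]*n (a - 1ℤ) n)) (lem′ (+ ((a - 1ℤ) %ℕ n)) (turns a) (+ n)))

    unnormalise : ∀ w w′ {a a′} → normalise w a ≡ normalise w′ a′ → a ≡ a′ + (w - w′) * + n
    unnormalise w w′ {a} {a′} e = trans (lem a w (+ n)) (trans (cong (_+ w * + n) e) (lem′ a′ w w′ (+ n)))
      where
      lem : ∀ a w N → a ≡ a + (- w) * N + w * N
      lem = solve-∀
      lem′ : ∀ a w w′ N → a + (- w′) * N + w * N ≡ a + (w - w′) * N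
      lem′ = solve-∀

  -- Applying `S` to both entries of an inversion of f keeps them in order, since by the ascent a
  -- pair reversed by `S` is no inversion. As `S a` may leave the window 1, ..., n, the pair is
  -- translated back by whole periods; `window-unique` still recovers a.
  ascent-embedding : ∀ {f g} → Labelling f → f i < f (i + 1ℤ) → (∀ a → g a ≡ f (S a)) →
    ∀ {ℓ ℓ′} → HasLength n f ℓ → HasLength n g ℓ′ → ℓ ℕ.≤ ℓ′
  ascent-embedding {f} {g} lab asc g≗ card card′ = injection⇒≤ {Inversions n f} {Inversions n g} move (λ {x} {y} → move-injective x y) card card′
    where
    open Labelling lab
    pair : ℤ × ℤ → ℤ × ℤ
    pair (a , b) = normalise (turns (S a)) (S a) , normalise (turns (S a)) (S b)
    value : ∀ w a → g (normalise w (S a)) ≡ f a + (- w) * + n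
    value w a = trans (g≗ _) (trans (cong f (trans (s-shift i (S a) (- w)) (cong (_+ (- w) * + n) (s-involutive i a)))) (periodic a (- w)))
    still : ∀ {a b} → a < b → f b < f a → S a < S b
    still {a} {b} a<b inv = s-mono-< i a<b λ e →
      let m , e₁ , e₂ = s-increases a<b e
      in ℤₚ.<-asym inv (subst₂ _<_ (sym (trans (cong f e₁) (periodic i m))) (sym (trans (cong f e₂) (periodic (i + 1ℤ) m))) (ℤₚ.+-monoˡ-< (m * + n) asc))
    move : Σ (ℤ × ℤ) (IsInversion n f) → Σ (ℤ × ℤ) (IsInversion n g)
    move ((a , b) , _ , _ , lt , inv) = pair (a , b) ,
      proj₁ (normalise-window (S a)) , proj₂ (normalise-window (S a)) ,
      ℤₚ.+-monoˡ-< ((- turns (S a)) * + n) (still lt inv) ,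
      subst₂ _<_ (sym (value (turns (S a)) b)) (sym (value (turns (S a)) a)) (ℤₚ.+-monoˡ-< ((- turns (S a)) * + n) inv)
    move-injective : ∀ x y → proj₁ (move x) ≡ proj₁ (move y) → proj₁ x ≡ proj₁ y
    move-injective ((a , b) , l , u , _) ((a′ , b′) , l′ , u′ , _) e = cong₂ _,_ a≡a′ b≡b′
      where
      w  = turns (S a)
      w′ = turns (S a′)
      a≡a′ : a ≡ a′
      a≡a′ = window-unique (w - w′) l u l′ u′ (s-injective i (trans (unnormalise w w′ {S a} {S a′} (cong proj₁ e)) (sym (s-shift i a′ (w - w′)))))
      b≡b′ : b ≡ b′
      b≡b′ = s-injective i (+-cancelʳ ((- w) * + n) (trans (cong proj₂ e) (cong (λ z → normalise (turns (S z)) (S b′)) (sym a≡a′))))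

  shorter-descent : ∀ {f} → Labelling f → Shorter n (S · f) f → f (i + 1ℤ) < f i
  shorter-descent {f} lab (ℓ , ℓ′ , card , card′ , ℓ<ℓ′) = decide (ℤₚ.<-cmp (f i) (f (i + 1ℤ)))
    where
    decide : Tri (f i < f (i + 1ℤ)) (f i ≡ f (i + 1ℤ)) (f (i + 1ℤ) < f i) → f (i + 1ℤ) < f i
    decide (tri> _ _ gt) = gt
    decide (tri≈ _ e _)  = contradiction (Labelling.injective lab e) (ℤₚ.<⇒≢ (a<a+1 i))
    decide (tri< lt _ _) = contradiction ℓ<ℓ′ (ℕₚ.≤⇒≯ (ascent-embedding lab lt (λ _ → refl) card′ card))

  shorter-ascent : ∀ {f} → Labelling f → Shorter n f (S · f) → f i < f (i + 1ℤ)
  shorter-ascent {f} lab (ℓ , ℓ′ , card , card′ , ℓ<ℓ′) = decide (ℤₚ.<-cmp (f i) (f (i + 1ℤ)))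
    where
    decide : Tri (f i < f (i + 1ℤ)) (f i ≡ f (i + 1ℤ)) (f (i + 1ℤ) < f i) → f i < f (i + 1ℤ)
    decide (tri< lt _ _) = lt
    decide (tri≈ _ e _)  = contradiction (Labelling.injective lab e) (ℤₚ.<⇒≢ (a<a+1 i))
    -- A descent of f at i is an ascent of `S · f`, and composing with `S` again gives f back, so
    -- the embedding applies with the roles exchanged.
    decide (tri> _ _ gt) = contradiction ℓ<ℓ′ (ℕₚ.≤⇒≯ (ascent-embedding (act-labelling crossing i lab)
      (subst₂ _<_ (sym (cong f S-i)) (sym (cong f S-i+1)) gt) (λ a → cong f (sym (s-involutive i a))) card′ card))

-- The bijection on words and the forced last crossing

module Rotation (n : ℕ) .{{_ : NonZero n}} (2≤n : 2 ℕ.≤ n) (k : ℕ) (i : ℤ) {f : ℤ → ℤ}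
  (lab : Words.Labelling n 2≤n f)
  (values : ∀ {a b} → f a ≡ i → f b ≡ i + 1ℤ → a < b)
  (unfixed : ∀ m → f (i + m * + n) ≡ i → f (i + 1ℤ + m * + n) ≢ i + 1ℤ)
  {N : ℕ} (w : Vec ℤ N) where

  open Words n 2≤n
  open Shifting i
  open Lengths n 2≤n i using (s-increases; S-i; S-i+1)

  private
    start : ℤ → ℤ
    start q = q - + k

    start-labelling : Labelling start
    start-labelling = record { periodic = λ q m → +-swap-last q _ _ ; injective = +-cancelʳ (- + k) }

    after-first : Tile → ℤ → ℤ
    after-first b = act b (i + + k) start

    after-first-labelling : ∀ b → Labelling (after-first b)
    after-first-labelling b = act-labelling b (i + + k) start-labelling

    -- As the first letter is a meeting, crossing there is the same as applying `S` to the labels.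
    -- Its tile thus starts as the pending one, and the second run begins from untouched labels.
    swapped-first : ∀ b → Swapped b (after-first b) start
    swapped-first elbow    q = refl
    swapped-first crossing q = trans (sym (s-involutive i (q - + k))) (cong S (sym (trans (cong (λ z → s n (i + + k) z - + k) (lem q (+ k)))
      (trans (cong (_- + k) (s-translate i (+ k) (q - + k))) (lem′ (S (q - + k)) (+ k))))))
      where
      lem : ∀ q k → q ≡ q - k + k
      lem = solve-∀
      lem′ : ∀ q k → q + k - k ≡ q
      lem′ = solve-∀

    start-inOrder : ∀ b → b ≡ elbow → InOrder (after-first b)
    start-inOrder elbow refl q q′ e e′ = lin< (subst₂ _<_ (sym e) (sym e′) (a<a+1 i)) (lem q q′ (+ k))
      where
      lem : ∀ q q′ k → q′ - q ≡ q′ - k - (q - k)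
      lem = solve-∀

    inverse-inOrder : ∀ {u} → (∀ j → u (f j) ≡ j) → Labelling u → f i < f (i + 1ℤ) → InOrder u
    inverse-inOrder exits labU lt q q′ e e′ = subst₂ _<_ (find e) (find e′) lt
      where
      find : ∀ {j x} → _ ≡ j → f j ≡ x
      find e = Labelling.injective labU (trans (exits _) (sym e))

    inOrder-inverse : ∀ {u} → (∀ j → u (f j) ≡ j) → InOrder u → f i < f (i + 1ℤ)
    inOrder-inverse exits ord = ord (f i) (f (i + 1ℤ)) (exits i) (exits (i + 1ℤ))

  -- The last tile carried by the shift decides which of the two permutations results.
  rotated : Tile → ℤ → ℤ
  rotated crossing = S · f · S
  rotated elbow    = f · S

  lowered : Tile → ℤ → ℤ
  lowered crossing r = r
  lowered elbow    r = r - 1ℤ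

  Source : ℤ → Set
  Source r = WordDeogram n 2≤n k r f (i + + k ∷ w)

  Target : ℤ → Tile → Set
  Target r b = WordDeogram n 2≤n k (lowered b r) (rotated b) (w ∷ʳ i)

  open WordDeogram

  -- The graph of the bijection on tile words. Since it is functional and injective, `forward` and
  -- `backward` are mutually inverse without any computation of composites.
  data Linked : Vec Tile (suc N) → Tile → Vec Tile (suc N) → Set where
    linked : ∀ {b τ τ′ b′} → Shift (after-first b) b w τ τ′ b′ → Linked (b ∷ τ) b′ (τ′ ∷ʳ crossing)

  linked-functional : ∀ {σ b₁ b₂ ρ₁ ρ₂} → Linked σ b₁ ρ₁ → Linked σ b₂ ρ₂ → b₁ ≡ b₂ × ρ₁ ≡ ρ₂
  linked-functional (linked x) (linked y) = let e , e′ = shift-functional x y in e′ , cong (_∷ʳ crossing) e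

  linked-injective : ∀ {σ₁ σ₂ b ρ₁ ρ₂} → ρ₁ ≡ ρ₂ → Linked σ₁ b ρ₁ → Linked σ₂ b ρ₂ → σ₁ ≡ σ₂
  linked-injective e (linked {b₁} {τ′ = τ₁} x) (linked {b₂} {τ′ = τ₂} y) =
    let eb , eτ = shift-injective (after-first-labelling b₁) (after-first-labelling b₂) (swapped-first b₁) (swapped-first b₂)
                    (subst (λ τ → Shift _ _ w _ τ _) (Vecₚ.∷ʳ-injectiveˡ τ₁ τ₂ e) x) y
    in cong₂ _∷_ eb eτ

  -- The summand 0 is the weight of the crossing appended at the last letter.
  lowered-count : ∀ b′ {r a c} → r ≡ + a → a ≡ c ℕ.+ weight b′ → lowered b′ r ≡ + (c ℕ.+ 0)
  lowered-count crossing e e′ = trans e (cong +_ e′)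
  lowered-count elbow {c = c} e e′ = trans (cong (_- 1ℤ) (trans e (cong +_ (trans e′ (ℕₚ.+-comm c 1))))) (cong +_ (sym (ℕₚ.+-identityʳ c)))

  unlowered-count : ∀ b′ {r a c} → lowered b′ r ≡ + (c ℕ.+ 0) → a ≡ c ℕ.+ weight b′ → r ≡ + a
  unlowered-count crossing e e′ = trans e (cong +_ (sym e′))
  unlowered-count elbow {r} {c = c} e e′ = trans (sym (-1+1 r)) (trans (cong (_+ 1ℤ) e)
    (cong +_ (trans (cong (ℕ._+ 1) (ℕₚ.+-identityʳ c)) (sym e′))))

  private
    -- The `S` applied before v is the effect of the final crossing at i on positions.
    rotated-exits : ∀ b′ {u v} → Swapped b′ u v → (∀ j → u (f j) ≡ j) → ∀ j → v (S (rotated b′ j)) ≡ j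
    rotated-exits crossing {u} sw exits j = trans (sw _) (trans (cong S (trans (cong u (s-involutive i (f (S j)))) (exits (S j)))) (s-involutive i j))
    rotated-exits elbow    {u} sw exits j = trans (sw _) (trans (cong u (s-involutive i (f j))) (exits j))

    unrotated-exits : ∀ b′ {u v} → Swapped b′ u v → (∀ j → v (S (rotated b′ j)) ≡ j) → ∀ j → u (f j) ≡ j
    unrotated-exits crossing {u} {v} sw exits j = s-injective i (begin
      S (u (f j))                       ≡⟨ sw (f j) ⟨
      v (f j)                           ≡⟨ cong (v ∘ f) (s-involutive i j) ⟨
      v (f (S (S j)))                   ≡⟨ cong v (s-involutive i _) ⟨
      v (S (S (f (S (S j)))))           ≡⟨ exits (S j) ⟩
      S j                               ∎)
      where open ≡-Reasoning
    unrotated-exits elbow {u} {v} sw exits j = trans (sym (sw (f j))) (trans (cong v (sym (s-involutive i (f j)))) (exits j))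

    last-crosses : ∀ b′ {v} → Labelling v → (∀ j → v (rotated b′ j) ≡ j) → ¬ (v i < v (i + 1ℤ))
    last-crosses elbow {v} labV exits lt = ℤₚ.<-asym lt (values (at′ (i + 1ℤ) S-i+1) (at′ i S-i))
      where
      at′ : ∀ c {d} → S c ≡ d → f (v c) ≡ d
      at′ c e = s-injective i (trans (Labelling.injective labV (exits (v c))) (trans (sym (s-involutive i c)) (cong S e)))
    last-crosses crossing {v} labV exits lt = decide (S (v i) ℤₚ.≟ v (i + 1ℤ))
      where
      at′ : ∀ c {d} → S c ≡ d → f (S (v c)) ≡ d
      at′ c e = s-injective i (trans (Labelling.injective labV (exits (v c))) (trans (sym (s-involutive i c)) (cong S e)))
      decide : Dec (S (v i) ≡ v (i + 1ℤ)) → ⊥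
      decide (no ne) = ℤₚ.<-asym (s-mono-< i lt ne) (values (at′ (i + 1ℤ) S-i+1) (at′ i S-i))
      -- Here S (v (i+1)) = v i = i+mn and S (v i) = v (i+1) = i+1+mn, so f would send i+mn to i and
      -- i+1+mn to i+1.
      decide (yes e) = let m , e₁ , e₂ = s-increases lt e in
        unfixed m
          (trans (cong f (trans (sym e₁) (trans (sym (s-involutive i (v i))) (cong S e)))) (at′ (i + 1ℤ) S-i+1))
          (trans (cong f (trans (sym e₂) (sym e))) (at′ i S-i))

  forward : ∀ {r} (W : Source r) → ∃ λ b′ → (b′ ≡ elbow → f i < f (i + 1ℤ)) × Σ (Target r b′) λ W′ → Linked (tiles W) b′ (tiles W′)
  forward {r} record { tiles = b ∷ τ ; distinguished = _ ∷ ds ; exits = ex ; count = ct } =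
    let τ′ , b′ , sh = shift (after-first b) b w τ
        labU         = after-first-labelling b
        sw           = swapped-first b
        ds′ , ord    = shift-distinguished labU sw sh (start-inOrder b) ds
    in b′ , (λ e → inOrder-inverse ex (ord e)) , record
      { tiles         = τ′ ∷ʳ crossing
      ; distinguished = distinguished-∷ʳ⁺ ds′ λ ()
      ; exits         = λ j → trans (cong (λ v → v (rotated b′ j)) (final-∷ʳ w τ′ i crossing)) (rotated-exits b′ (shift-final labU sw sh) ex j)
      ; count         = trans (lowered-count b′ ct (shift-elbows sh)) (cong +_ (sym (elbows-∷ʳ τ′ crossing)))
      } , linked sh

  backward : ∀ {r} b′ → (b′ ≡ elbow → f i < f (i + 1ℤ)) → (W′ : Target r b′) → Σ (Source r) λ W → Linked (tiles W) b′ (tiles W′)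
  backward {r} b′ asc record { tiles = ρ ; distinguished = ds ; exits = ex ; count = ct } = go (Vec.initLast ρ) ds ex ct
    where
    go : ∀ {ρ} → (∃₂ λ τ′ t → ρ ≡ τ′ ∷ʳ t) → Distinguished start (w ∷ʳ i) ρ →
      (∀ j → final start (w ∷ʳ i) ρ (rotated b′ j) ≡ j) → lowered b′ r ≡ + elbows ρ → Σ (Source r) λ W → Linked (tiles W) b′ ρ
    go (τ′ , elbow , refl) ds ex ct = contradiction (proj₂ (distinguished-∷ʳ⁻ w τ′ ds) refl)
      (last-crosses b′ (final-labelling w τ′ start-labelling) λ j → trans (cong (λ v → v (rotated b′ j)) (sym (final-∷ʳ w τ′ i elbow))) (ex j))
    go (τ′ , crossing , refl) ds ex ct =
      let b , τ , mk = unshift start w τ′ b′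
          labU       = after-first-labelling b
          sw         = swapped-first b
          sh         = mk labU sw
          ex′        = unrotated-exits b′ (shift-final labU sw sh) λ j → trans (cong (λ v → v (rotated b′ j)) (sym (final-∷ʳ w τ′ i crossing))) (ex j)
          ds′ , _    = unshift-distinguished labU sw sh (λ e → inverse-inOrder ex′ (final-labelling w τ labU) (asc e)) (proj₁ (distinguished-∷ʳ⁻ w τ′ ds))
      in record
        { tiles         = b ∷ τ
        -- The first letter is read on the northern boundary, where labels increase, so either tile
        -- is allowed.
        ; distinguished = (λ _ → ℤₚ.+-monoˡ-< (- + k) (a<a+1 (i + + k))) ∷ ds′
        ; exits         = ex′
        ; count         = unlowered-count b′ (trans ct (cong +_ (elbows-∷ʳ τ′ crossing))) (shift-elbows sh)
        } , linked sh

  private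
    Words₁ : ℤ → Setoid 0ℓ 0ℓ
    Words₁ r = WordDeograms n 2≤n k r f (i + + k ∷ w)

    Words₂ : ℤ → Tile → Setoid 0ℓ 0ℓ
    Words₂ r b = WordDeograms n 2≤n k (lowered b r) (rotated b) (w ∷ʳ i)

  rotation-descent : f (i + 1ℤ) < f i → ∀ r → Inverse (Words₁ r) (Words₂ r crossing)
  rotation-descent desc r = record
    { to        = λ W → proj₁ (to W)
    ; from      = λ W′ → proj₁ (backward crossing (λ ()) W′)
    ; to-cong   = λ {W} {W′} e → proj₂ (linked-functional (proj₂ (to W)) (subst (λ σ → Linked σ crossing _) (sym e) (proj₂ (to W′))))
    ; from-cong = λ {W} {W′} e → linked-injective e (proj₂ (backward {r} crossing (λ ()) W)) (proj₂ (backward {r} crossing (λ ()) W′))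
    ; inverse   = (λ {W′} {W} e → proj₂ (linked-functional (proj₂ (to W)) (subst (λ σ → Linked σ crossing (tiles W′)) (sym e) (proj₂ (backward {r} crossing (λ ()) W′)))))
                , (λ {W} {W′} e → linked-injective e (proj₂ (backward {r} crossing (λ ()) W′)) (proj₂ (to W)))
    }
    where
    to : (W : Source r) → Σ (Target r crossing) λ W′ → Linked (tiles W) crossing (tiles W′)
    to W = pick (forward W)
      where
      pick : (∃ λ b′ → (b′ ≡ elbow → f i < f (i + 1ℤ)) × Σ (Target r b′) λ W′ → Linked (tiles W) b′ (tiles W′)) →
        Σ (Target r crossing) λ W′ → Linked (tiles W) crossing (tiles W′)
      pick (crossing , _ , W′)  = W′
      pick (elbow , asc , _)    = contradiction desc (ℤₚ.<-asym (asc refl))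

  rotation-ascent : f i < f (i + 1ℤ) → ∀ r → Inverse (Words₁ r) (Words₂ r elbow ⊎ₛ Words₂ r crossing)
  rotation-ascent asc r = record
    { to        = to
    ; from      = from
    ; to-cong   = λ {W} {W′} e → functional _ _ (to-linked W) (subst (λ σ → LinkedTo σ (to W′)) (sym e) (to-linked W′))
    ; from-cong = λ {x} {y} e → injective e (from-linked x) (from-linked y)
    ; inverse   = (λ {x} {W} e → functional _ _ (to-linked W) (subst (λ σ → LinkedTo σ x) (sym e) (from-linked x)))
                , (λ {W} {x} e → injective e (from-linked x) (to-linked W))
    }
    where
    open Setoid (Words₂ r elbow ⊎ₛ Words₂ r crossing) using (_≈_)
    LinkedTo : Vec Tile (suc N) → Target r elbow ⊎ Target r crossing → Set
    LinkedTo σ (inj₁ W′) = Linked σ elbow (tiles W′)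
    LinkedTo σ (inj₂ W′) = Linked σ crossing (tiles W′)
    functional : ∀ {σ} x y → LinkedTo σ x → LinkedTo σ y → x ≈ y
    functional (inj₁ _) (inj₁ _) l l′ = inj₁ (proj₂ (linked-functional l l′))
    functional (inj₂ _) (inj₂ _) l l′ = inj₂ (proj₂ (linked-functional l l′))
    functional (inj₁ _) (inj₂ _) l l′ = contradiction (proj₁ (linked-functional l l′)) λ ()
    functional (inj₂ _) (inj₁ _) l l′ = contradiction (proj₁ (linked-functional l l′)) λ ()
    injective : ∀ {σ₁ σ₂ x y} → x ≈ y → LinkedTo σ₁ x → LinkedTo σ₂ y → σ₁ ≡ σ₂
    injective (inj₁ e) l l′ = linked-injective e l l′
    injective (inj₂ e) l l′ = linked-injective e l l′
    place : ∀ b′ → Target r b′ → Target r elbow ⊎ Target r crossing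
    place elbow    W′ = inj₁ W′
    place crossing W′ = inj₂ W′
    place-linked : ∀ {σ} b′ (W′ : Target r b′) → Linked σ b′ (tiles W′) → LinkedTo σ (place b′ W′)
    place-linked elbow    W′ l = l
    place-linked crossing W′ l = l
    to : Source r → Target r elbow ⊎ Target r crossing
    to W = let b′ , _ , W′ , _ = forward W in place b′ W′
    to-linked : ∀ W → LinkedTo (tiles W) (to W)
    to-linked W = let b′ , _ , W′ , l = forward W in place-linked b′ W′ l
    from : Target r elbow ⊎ Target r crossing → Source r
    from (inj₁ W′) = proj₁ (backward elbow (λ _ → asc) W′)
    from (inj₂ W′) = proj₁ (backward crossing (λ ()) W′)
    from-linked : ∀ x → LinkedTo (tiles (from x)) x
    from-linked (inj₁ W′) = proj₂ (backward elbow (λ _ → asc) W′)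
    from-linked (inj₂ W′) = proj₂ (backward crossing (λ ()) W′)

-- Sweeping words for the strips of P and s_i P

module Rotating (n : ℕ) .{{_ : NonZero n}} (k : ℕ) (2≤n : 2 ℕ.≤ n) (i : ℤ) (P : Vec Step n) (isPath : IsLatticePath k P)
                (Pᵢ : step P i ≡ U) (Pᵢ₊₁ : step P (i + 1ℤ) ≡ R) where
  open Residues n 2≤n
  open Cuts n 2≤n (+ n - + k)
  open Paths n k 2≤n
  open Strip n k 2≤n P isPath

  corner-south : Corner south i
  corner-south = corner (abscissa-U P i Pᵢ) (trans (abscissa-R P (i + 1ℤ) Pᵢ₊₁) (cong (λ z → south z + 1ℤ) (+1-1 i)))

  corner-north : Corner north (i + + k)
  corner-north = corner
    (trans (cong south (cancel i (+ k))) (trans before (cong south (lem₁ i (+ k)))))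
    (trans (cong south (lem₂ i (+ k))) (trans behind (cong (λ z → south z + 1ℤ) (sym (cancel i (+ k))))))
    where
    open Corner corner-south
    cancel : ∀ i k → i + k - k ≡ i
    cancel = solve-∀
    lem₁ : ∀ i k → i - 1ℤ ≡ i + k - 1ℤ - k
    lem₁ = solve-∀
    lem₂ : ∀ i k → i + k + 1ℤ - k ≡ i + 1ℤ
    lem₂ = solve-∀

  private
    d : ℤ
    d = + n - + k

    module South = Cut south-cut

    south+n : ∀ q → south (q + + n) ≡ south q + d
    south+n q = trans (cong south (lem q (+ n))) (trans (South.periodic q 1ℤ) (cong (λ z → south q + z) (ℤₚ.*-identityˡ d)))
      where
      lem : ∀ q N → q + N ≡ q + 1ℤ * N
      lem = solve-∀

    1≤n : 1ℤ ≤ + n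
    1≤n = +≤+ (ℕₚ.≤-trans (ℕ.s≤s ℕ.z≤n) 2≤n)

  -- The right step i+1 lies in the period starting at vertex i, so this period advances at least
  -- one unit to the right.
  0<d : 0ℤ < d
  0<d = +1≤⇒< (lin≤ (subst₂ _≤_ (Corner.behind corner-south) (south+n i) (South.mono (ℤₚ.+-monoʳ-≤ i 1≤n))) (lem (south i) d))
    where
    lem : ∀ x d → d - (0ℤ + 1ℤ) ≡ x + d - (x + 1ℤ)
    lem = solve-∀

  -- The up step i lies in the period starting at vertex i-1; heights never decrease, so this period
  -- rises by at least one.
  0<k : 0ℤ < + k
  0<k = +1≤⇒< (lin≤ (subst (λ z → i - south i ≤ i - 1ℤ + + n - z) eq total) (lem (south i) i (+ n) (+ k)))
    where
    height-mono : ∀ {a b} → a ≤ b → a - south a ≤ b - south b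
    height-mono {a} a≤b = ≤-ind {Q = λ q → a - south a ≤ q - south q} up a≤b ℤₚ.≤-refl
      where
      up : ∀ q → a - south a ≤ q - south q → a - south a ≤ q + 1ℤ - south (q + 1ℤ)
      up q h with South.steps (q + 1ℤ)
      ... | inj₁ e = ℤₚ.≤-trans h (ℤₚ.≤-trans (ℤₚ.+-monoˡ-≤ (- south q) (a≤a+1 q)) (ℤₚ.≤-reflexive (cong (λ z → q + 1ℤ - z) (sym (trans e (cong south (+1-1 q)))))))
      ... | inj₂ e = ℤₚ.≤-trans h (ℤₚ.≤-reflexive (trans (lem q (south q)) (cong (λ z → q + 1ℤ - z) (sym (trans e (cong (λ z → south z + 1ℤ) (+1-1 q)))))))
        where
        lem : ∀ q x → q - x ≡ q + 1ℤ - (x + 1ℤ)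
        lem = solve-∀
    total : i - south i ≤ i - 1ℤ + + n - south (i - 1ℤ + + n)
    total = height-mono {i} {i - 1ℤ + + n} (lin≤ 1≤n (lem i (+ n)))
      where
      lem : ∀ i N → i - 1ℤ + N - i ≡ N - 1ℤ
      lem = solve-∀
    eq : south (i - 1ℤ + + n) ≡ south i + d
    eq = trans (south+n (i - 1ℤ)) (cong (_+ d) (sym (Corner.before corner-south)))
    lem : ∀ x i N K → K - (0ℤ + 1ℤ) ≡ i - 1ℤ + N - (x + (N - K)) - (i - x)
    lem = solve-∀

  d<n : d < + n
  d<n = lin< 0<k (lem (+ n) (+ k))
    where
    lem : ∀ N K → N - (N - K) ≡ K - 0ℤ
    lem = solve-∀

  -- At a flipped vertex the raised abscissa is that of the next northern vertex, namely `south` at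
  -- q + 1 - k, and k ≥ 1 makes this index at most q.
  flipped-north≤south : ∀ q → bump (i + + k) north q ≤ south q
  flipped-north≤south q = go (+ n ∣? (q - (i + + k)))
    where
    back : ∀ q k → q - (q - k) ≡ k - 0ℤ
    back = solve-∀
    back₁ : ∀ q k → q - (q + 1ℤ - k) ≡ k - (0ℤ + 1ℤ)
    back₁ = solve-∀
    go : Dec (+ n ∣ q - (i + + k)) → bump (i + + k) north q ≤ south q
    go (no ¬h) = subst (_≤ south q) (sym (bump-off (i + + k) north ¬h))
      (South.mono {q - + k} {q} (lin≤ (ℤₚ.<⇒≤ 0<k) (back q (+ k))))
    go (yes h) = subst (_≤ south q) (trans behind (sym (bump-on (i + + k) north h)))
      (South.mono {q + 1ℤ - + k} {q} (lin≤ (<⇒+1≤ 0<k) (back₁ q (+ k))))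
      where open Corner (subst (Corner north) (sym (∣⇒≡ (i + + k) q h)) (corner-periodic north-cut (_∣_.quotient h) corner-north))

  middle : ∃ λ N → Σ (Vec ℤ N) (Sweep (bump (i + + k) north) south)
  middle = sweep-exists 0<d d<n south-cut (bump-cut north-cut corner-north) flipped-north≤south

  private
    P′ : Vec Step n
    P′ = swapSteps i P

    X′ B : ℤ → ℤ
    X′ = abscissa P′
    B  = bump i south

    B-cut : Cut B
    B-cut = bump-cut south-cut corner-south

    -- The path of s_i P and the flipped cut B are compared by increments, since their starting
    -- abscissae may differ.
    same-step : ∀ q → ∃ λ e → X′ q ≡ X′ (q - 1ℤ) + e × B q ≡ B (q - 1ℤ) + e
    same-step q = go (residue i q)
      where
      go : Residue i q → ∃ λ e → X′ q ≡ X′ (q - 1ℤ) + e × B q ≡ B (q - 1ℤ) + e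
      go (at m refl) = 1ℤ ,
        abscissa-R P′ q (trans (step-swapSteps i P q) (trans (cong (step P) (s-at i m)) (trans (step-periodic P (i + 1ℤ) m) Pᵢ₊₁))) ,
        trans (bump-at i south m) (cong (_+ 1ℤ) (trans (Corner.before (corner-periodic south-cut m corner-south)) (sym (bump-at-1 i south m))))
      go (after m refl) = 0ℤ ,
        trans (abscissa-U P′ q (trans (step-swapSteps i P q) (trans (cong (step P) (s-after i m)) (trans (step-periodic P i m) Pᵢ)))) (sym (ℤₚ.+-identityʳ _)) ,
        trans (bump-after i south m) (trans (cong south (+-swap-last i _ _)) (trans (Corner.behind (corner-periodic south-cut m corner-south))
          (trans (sym (bump-at i south m)) (trans (cong B (lem i (m * + n))) (sym (ℤₚ.+-identityʳ _))))))
        where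
        lem : ∀ i M → i + M ≡ i + 1ℤ + M - 1ℤ
        lem = solve-∀
      go (away h h′) = by-step (step P q) refl
        where
        step′ : step P′ q ≡ step P q
        step′ = trans (step-swapSteps i P q) (cong (step P) (s-away i h h′))
        B-step : ∀ {e} → south q ≡ south (q - 1ℤ) + e → B q ≡ B (q - 1ℤ) + e
        B-step {e} eq = trans (bump-off i south h) (trans eq (cong (_+ e) (sym (bump-away i south {q} h′))))
        by-step : ∀ t → step P q ≡ t → ∃ λ e → X′ q ≡ X′ (q - 1ℤ) + e × B q ≡ B (q - 1ℤ) + e
        by-step R eq = 1ℤ , abscissa-R P′ q (trans step′ eq) , B-step (abscissa-R P q eq)
        by-step U eq = 0ℤ , trans (abscissa-U P′ q (trans step′ eq)) (sym (ℤₚ.+-identityʳ _)) ,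
                       B-step (trans (abscissa-U P q eq) (sym (ℤₚ.+-identityʳ _)))

    -- For i = n the flipped corner is the origin itself, where vertex 0 is pinned; hence the offset.
    offset : ℤ
    offset = - B 0ℤ

    X′≡B : ∀ q → X′ q ≡ B q + offset
    X′≡B = ℤ-ind {Q = λ q → X′ q ≡ B q + offset} (sym (ℤₚ.+-inverseʳ (B 0ℤ))) up down
      where
      step₁ : ∀ q → ∃ λ e → X′ (q + 1ℤ) ≡ X′ q + e × B (q + 1ℤ) ≡ B q + e
      step₁ q = let e , e₁ , e₂ = same-step (q + 1ℤ) in e , trans e₁ (cong (λ z → X′ z + e) (+1-1 q)) , trans e₂ (cong (λ z → B z + e) (+1-1 q))
      up : ∀ q → X′ q ≡ B q + offset → X′ (q + 1ℤ) ≡ B (q + 1ℤ) + offset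
      up q h = let e , e₁ , e₂ = step₁ q in
        trans e₁ (trans (cong (_+ e) h) (trans (+-swap-last (B q) offset e) (cong (_+ offset) (sym e₂))))
      down : ∀ q → X′ (q + 1ℤ) ≡ B (q + 1ℤ) + offset → X′ q ≡ B q + offset
      down q h = let e , e₁ , e₂ = step₁ q in
        +-cancelʳ e (trans (sym e₁) (trans h (trans (cong (_+ offset) e₂) (+-swap-last (B q) e offset))))

  -- The number of up steps is read off from the displacement n - k over one period, which flipping
  -- a corner preserves.
  isPath′ : IsLatticePath k (swapSteps i P)
  isPath′ = ℤₚ.+-injective (trans (lem (X′ (+ n)) (+ Vec.count (_≟ˢ U) P′)) (trans (cong₂ _-_ (abscissa-total P′) X′n) (lem₂ (+ n) (+ k))))
    where
    lem : ∀ x c → c ≡ x + c - x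
    lem = solve-∀
    lem₂ : ∀ N K → N - (N - K) ≡ K
    lem₂ = solve-∀
    lem₃ : ∀ b d → b + 1ℤ * d + - b ≡ d
    lem₃ = solve-∀
    X′n : X′ (+ n) ≡ d
    X′n = trans (X′≡B (+ n)) (trans (cong (λ z → B z + offset) (lem₄ (+ n))) (trans (cong (_+ offset) (Cut.periodic B-cut 0ℤ 1ℤ)) (lem₃ (B 0ℤ) d)))
      where
      lem₄ : ∀ N → N ≡ 0ℤ + 1ℤ * N
      lem₄ = solve-∀

  module Strip′ = Strip n k 2≤n (swapSteps i P) isPath′

  sweep : Sweep north south (i + + k ∷ proj₁ (proj₂ middle))
  sweep = flip corner-north (proj₂ (proj₂ middle))

  sweep′ : Sweep Strip′.north Strip′.south (proj₁ (proj₂ middle) ∷ʳ i)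
  sweep′ = sweep-translate offset north≡ X′≡B (sweep-∷ʳ (proj₂ (proj₂ middle)) corner-south)
    where
    bump-north : ∀ q → B (q - + k) ≡ bump (i + + k) north q
    bump-north q = go (+ n ∣? (q - (i + + k)))
      where
      lem : ∀ q i k → q - (i + k) ≡ q - k - i
      lem = solve-∀
      go : Dec (+ n ∣ q - (i + + k)) → B (q - + k) ≡ bump (i + + k) north q
      go (yes h) = trans (bump-on i south (subst (+ n ∣_) (lem q i (+ k)) h)) (sym (bump-on (i + + k) north h))
      go (no ¬h) = trans (bump-off i south (¬h ∘ subst (+ n ∣_) (sym (lem q i (+ k))))) (sym (bump-off (i + + k) north ¬h))
    north≡ : ∀ q → Strip′.north q ≡ bump (i + + k) north q + offset
    north≡ q = trans (X′≡B (q - + k)) (cong (_+ offset) (bump-north q))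

  encoding₁ : ∀ {r f} → Inverse (𝒜 k r f P) (WordDeograms n 2≤n k r f (i + + k ∷ proj₁ (proj₂ middle)))
  encoding₁ = Decoding.encoding n k 2≤n P isPath sweep

  encoding₂ : ∀ {r f} → Inverse (𝒜 k r f (swapSteps i P)) (WordDeograms n 2≤n k r f (proj₁ (proj₂ middle) ∷ʳ i))
  encoding₂ = Decoding.encoding n k 2≤n (swapSteps i P) isPath′ sweep′

-- Otherwise f(i) = i - mn and f(i+1) = i+1 - mn, and the bounds on s_i f force 0 < -mn < n.
bounded-unfixed : (n k : ℕ) .{{_ : NonZero n}} (2≤n : 2 ℕ.≤ n) (i : ℤ) {f : ℤ → ℤ} → Words.Labelling n 2≤n f → 𝐁 n k (s n i · f) →
  ∀ m → f (i + m * + n) ≡ i → f (i + 1ℤ + m * + n) ≢ i + 1ℤ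
bounded-unfixed n k 2≤n i {f} lab bounded m e e′ = absurd ((- m) * + n) (divides (- m) refl)
    (lin≤ (subst (λ z → i + 1ℤ ≤ z) (trans (cong f S-i+1) (at-0 i e)) (𝐁.lowerBound bounded (i + 1ℤ))) (lem₁ i ((- m) * + n)))
    (lin≤ (subst (λ z → z ≤ i + + n) (trans (cong f S-i) (at-0 (i + 1ℤ) e′)) (𝐁.upperBound bounded i)) (lem₂ i ((- m) * + n) (+ n)))
  where
  open Lengths n 2≤n i using (S-i; S-i+1)
  open Words.Labelling lab
  lem₁ : ∀ i M → M - 1ℤ ≡ i + M - (i + 1ℤ)
  lem₁ = solve-∀
  lem₂ : ∀ i M N → N - (M + 1ℤ) ≡ i + N - (i + 1ℤ + M)
  lem₂ = solve-∀
  at-0 : ∀ c → f (c + m * + n) ≡ c → f c ≡ c + (- m) * + n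
  at-0 c e = trans (cong f (lem c m (+ n))) (trans (periodic (c + m * + n) (- m)) (cong (_+ (- m) * + n) e))
    where
    lem : ∀ c m N → c ≡ c + m * N + (- m) * N
    lem = solve-∀
  absurd : ∀ M → + n ∣ M → 1ℤ ≤ M → M + 1ℤ ≤ + n → ⊥
  absurd (+ suc M) h (+≤+ _) (+≤+ le) = ℕₚ.<⇒≱ (ℕₚ.≤-trans (ℕₚ.≤-reflexive (ℕₚ.+-comm 1 (suc M))) le) (ℕ∣.∣⇒≤ (∣⇒∣ᵤ h))
  absurd (+ zero)  h (+≤+ ())

lemma3p25 : (n k : ℕ) .{{_ : NonZero n}} → 2 ℕ.≤ n → k ℕ.≤ n →
    (i : ℤ) → 1ℤ ≤ i → i ≤ + n →
    (f : ℤ → ℤ) → 𝐁 n k f → 𝐁 n k (s n i · f) → 𝐁 n k (f · s n i) → 𝐁 n k (s n i · f · s n i) →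
    Shorter n f (f · s n i) →
    (P : Vec Step n) → IsLatticePath k P → step P i ≡ U → step P (i + 1ℤ) ≡ R →
    (r : ℤ) →
    (Shorter n (s n i · f) f →
    Bijection (𝒜 k r f P) (𝒜 k r (s n i · f · s n i) (swapSteps i P)))
    ×
    (Shorter n f (s n i · f) →
    Bijection (𝒜 k r f P) (𝒜 k (r - 1ℤ) (f · s n i) (swapSteps i P) ⊎ₛ 𝒜 k r (s n i · f · s n i) (swapSteps i P)))
lemma3p25 n k 2≤n _ i _ _ f f∈B sf∈B _ _ f<fs P isPath Pᵢ Pᵢ₊₁ r =
  (λ sf<f → Inverseₚ.Inverse⇒Bijection (Inverseₚ.trans encoding₁ (Inverseₚ.trans
    (rotation-descent (shorter-descent lab sf<f) r) (Inverseₚ.sym encoding₂)))) ,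
  (λ f<sf → Inverseₚ.Inverse⇒Bijection (Inverseₚ.trans encoding₁ (Inverseₚ.trans
    (rotation-ascent (shorter-ascent lab f<sf) r) (Inverseₚ.sym encoding₂ ⊎-inverse Inverseₚ.sym encoding₂))))
  where
  open Lengths n 2≤n i
  open Rotating n k 2≤n i P isPath Pᵢ Pᵢ₊₁ using (middle; encoding₁; encoding₂)
  lab : Words.Labelling n 2≤n f
  lab = affine-labelling (𝐁.isAffinePermutation f∈B)
  -- f s_i > f enters as the order of the preimages of i and i+1, and the bounds of s_i f as the
  -- exclusion of the one pair of preimages that conjugation could reverse.
  open Rotation n 2≤n k i lab (shorter-values lab f<fs) (bounded-unfixed n k 2≤n i lab sf∈B) (proj₁ (proj₂ middle))
    using (rotation-descent; rotation-ascent)
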